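{- Let $\ell\ge5$ be a prime number and let $t=3$. Then $$\mathrm{Prob}_\ell(X_3;\mu=0,\lambda=1)=\frac{\ell^2}{\ell^2+\ell+1}.$$ If $\ell\equiv2\pmod3$, then $$\mathrm{Prob}_\ell(X_3;\mu=\mu_0,\lambda=\lambda_0)=\begin{cases}\frac{\ell^2}{\ell^2+\ell+1}&\text{if }\mu_0=0\text{ and }\lambda_0=1,\\ \frac{\ell+1}{\ell^2+\ell+1}&\text{if }\mu_0=0\text{ and }\lambda_0=3,\\ 0&\text{otherwise.}\end{cases}$$ If $\ell\equiv1\pmod3$, then $$\mathrm{Prob}_\ell(X_3;\mu=\mu_0,\lambda=\lambda_0)=\begin{cases}\frac{\ell^2}{\ell^2+\ell+1}&\text{if }\mu_0=0\text{ and }\lambda_0=1,\\ \frac{\ell-7}{\ell^2+\ell+1}&\text{if }\mu_0=0\text{ and }\lambda_0=3,\\ \frac{8}{\ell^2+\ell+1}&\text{if }\mu_0=0\text{ and }\lambda_0=5,\\ 0&\text{otherwise.}\end{cases}$$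
   Context: For $b\in\mathbb{Z}_\ell$ put $\binom{b}{n}=\frac{b(b-1)\cdots(b-n+1)}{n!}\in\mathbb{Z}_\ell$ and $(1+T)^b=\sum_{n\ge0}\binom{b}{n}T^n\in\mathbb{Z}_\ell[[T]]$. The bouquet $X_t$ is the multigraph with one vertex and $t$ undirected loops; a vector $\alpha=(\alpha_1,\dots,\alpha_t)\in\mathbb{Z}_\ell^t$ assigns the voltage $\alpha_j$ to the $j$-th loop. It is admissible if $\alpha\in\mathbb{Z}_\ell^t\setminus(\ell\mathbb{Z}_\ell)^t$. The characteristic series is $$f(T)=f_{X_t,\alpha}(T)=\sum_{j=1}^t\big(2-(1+T)^{\alpha_j}-(1+T)^{ -\alpha_j}\big)\in\mathbb{Z}_\ell[[T]].$$ For admissible $\alpha$ it is nonzero, and it has zero constant term. By Weierstrass preparation write $f(T)=\ell^{\mu}g(T)u(T)$ with $\mu\in\mathbb{Z}_{\ge0}$, $g$ a distinguished polynomial (monic, all non-leading coefficients divisible by $\ell$) and $u\in\mathbb{Z}_\ell[[T]]^\times$. Then $\mu_\ell(X_t,\alpha):=\mu$ and $\lambda_\ell(X_t,\alpha):=\deg g-1$ (note the shift by $-1$). Let $\tau$ be the Haar measure on $\mathbb{Z}_\ell^t$ normalized by $\tau(\mathbb{Z}_\ell^t)=1$, so $\tau(\mathbb{Z}_\ell^t\setminus(\ell\mathbb{Z}_\ell)^t)=1-\ell^{ -t}$. Define $$\mathrm{Prob}_\ell(X_t;\mu=\mu_0,\lambda=\lambda_0)=(1-\ell^{ -t})^{ -1}\,\tau\big(\{\alpha\in\mathbb{Z}_\ell^t\setminus(\ell\mathbb{Z}_\ell)^t:\mu_\ell(X_t,\alpha)=\mu_0,\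 \lambda_\ell(X_t,\alpha)=\lambda_0\}\big).$$ -}

module Defs where

open import Algebra.Bundles using (RawMonoid)
open import Data.Fin.Base using (Fin; toℕ)
open import Data.Integer.Base as ℤ using (ℤ; +_; _%ℕ_)
import Data.Integer.DivMod as ℤ
import Data.Integer.Properties as ℤ
open import Data.Integer.Divisibility.Signed as ℤ
  using (divides; ∣ᵤ⇒∣; ∣⇒∣ᵤ; ∣-trans; ∣m∣n⇒∣m+n; ∣m⇒∣m*n; ∣n⇒∣m*n; ∣m⇒∣-m)
  renaming (_∣_ to _∣ℤ_)
open import Data.Integer.Tactic.RingSolver using (solve-∀)
open import Data.Maybe.Base using (Maybe; just; nothing)
open import Data.Nat.Base as ℕ using (ℕ; zero; suc; NonZero; _!)
open import Data.Nat.Combinatorics using (_C_; nCk+nC[k+1]≡[n+1]C[k+1])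
open import Data.Nat.Divisibility as ℕ using (_∣_)
open import Data.Nat.Induction using (Acc; acc; <-wellFounded)
import Data.Nat.Properties as ℕ
open import Data.Nat.Properties using (_!≢0)
open import Data.Nat.Tactic.RingSolver using () renaming (solve-∀ to ℕ-solve-∀)
open import Data.Empty using (⊥)
open import Data.Nat.Primality using (Prime; prime⇒nonZero; prime⇒nonTrivial; euclidsLemma)
open import Data.Product.Base using (Σ-syntax; ∃-syntax; _×_; _,_)
open import Data.Rational.Base as ℚ using (ℚ; 0ℚ; 1ℚ)
open import Data.Sum.Base using (inj₁; inj₂)
open import Level using (0ℓ)
open import Relation.Binary.PropositionalEquality
  using (_≡_; refl; sym; trans; cong; cong₂; subst; subst₂; module ≡-Reasoning)
open import Relation.Nullary using (¬_; yes; no; contradiction)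
open import Relation.Unary using (Pred; ∁) renaming (_∈_ to _∈ₛ_)

infix 4 _≡_[mod_]

record _≡_[mod_] (x y : ℤ) (m : ℕ) : Set where
  constructor mod
  field divisible : + m ∣ℤ x ℤ.- y

open _≡_[mod_] public

mod-refl : ∀ {m} x → x ≡ x [mod m ]
mod-refl x = mod (divides (+ 0) (ℤ.+-inverseʳ x))

mod-sym : ∀ {m x y} → x ≡ y [mod m ] → y ≡ x [mod m ]
mod-sym {m} {x} {y} (mod p) = mod (subst (+ m ∣ℤ_) (lemma x y) (∣m⇒∣-m p))
  where
  lemma : ∀ x y → ℤ.- (x ℤ.- y) ≡ y ℤ.- x
  lemma = solve-∀

mod-trans : ∀ {m x y z} → x ≡ y [mod m ] → y ≡ z [mod m ] → x ≡ z [mod m ]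
mod-trans {m} {x} {y} {z} (mod p) (mod q) = mod
  (subst (+ m ∣ℤ_) (lemma x y z) (∣m∣n⇒∣m+n p q))
  where
  lemma : ∀ x y z → (x ℤ.- y) ℤ.+ (y ℤ.- z) ≡ x ℤ.- z
  lemma = solve-∀

mod-+ : ∀ {m a b c d} → a ≡ b [mod m ] → c ≡ d [mod m ] →
        a ℤ.+ c ≡ b ℤ.+ d [mod m ]
mod-+ {m} {a} {b} {c} {d} (mod p) (mod q) = mod
  (subst (+ m ∣ℤ_) (lemma a b c d) (∣m∣n⇒∣m+n p q))
  where
  lemma : ∀ a b c d → (a ℤ.- b) ℤ.+ (c ℤ.- d) ≡ (a ℤ.+ c) ℤ.- (b ℤ.+ d)
  lemma = solve-∀

mod-neg : ∀ {m a b} → a ≡ b [mod m ] → ℤ.- a ≡ ℤ.- b [mod m ]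
mod-neg {m} {a} {b} (mod p) = mod (subst (+ m ∣ℤ_) (lemma a b) (∣m⇒∣-m p))
  where
  lemma : ∀ a b → ℤ.- (a ℤ.- b) ≡ (ℤ.- a) ℤ.- (ℤ.- b)
  lemma = solve-∀

mod-* : ∀ {m a b c d} → a ≡ b [mod m ] → c ≡ d [mod m ] →
        a ℤ.* c ≡ b ℤ.* d [mod m ]
mod-* {m} {a} {b} {c} {d} (mod p) (mod q) = mod
  (subst (+ m ∣ℤ_) (lemma a b c d) (∣m∣n⇒∣m+n (∣m⇒∣m*n c p) (∣n⇒∣m*n b q)))
  where
  lemma : ∀ a b c d →
          (a ℤ.- b) ℤ.* c ℤ.+ b ℤ.* (c ℤ.- d) ≡ a ℤ.* c ℤ.- b ℤ.* d
  lemma = solve-∀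

mod-weaken : ∀ {m n x y} → m ∣ n → x ≡ y [mod n ] → x ≡ y [mod m ]
mod-weaken m∣n (mod p) = mod (∣-trans (∣ᵤ⇒∣ m∣n) p)

mod-%ℕ : ∀ x m .{{_ : NonZero m}} → x ≡ + (x %ℕ m) [mod m ]
mod-%ℕ x m = mod (divides (x ℤ./ℕ m)
  (trans (cong (ℤ._- + (x %ℕ m)) (ℤ.a≡a%ℕn+[a/ℕn]*n x m)) (lemma (+ (x %ℕ m)) _)))
  where
  lemma : ∀ r q → (r ℤ.+ q) ℤ.- r ≡ q
  lemma = solve-∀

fallingℤ : ℤ → ℕ → ℤ
fallingℤ x zero    = + 1
fallingℤ x (suc n) = fallingℤ x n ℤ.* (x ℤ.- + n)

mod-fallingℤ : ∀ {m x y} n → x ≡ y [mod m ] →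
               fallingℤ x n ≡ fallingℤ y n [mod m ]
mod-fallingℤ zero    p = mod-refl (+ 1)
mod-fallingℤ (suc n) p = mod-* (mod-fallingℤ n p) (mod-+ p (mod-refl (ℤ.- + n)))

absorption : ∀ a n → (+ suc n) ℤ.* + (a C suc n) ≡ + (a C n) ℤ.* (+ a ℤ.- + n)
absorption zero zero    = refl
absorption zero (suc n) = ℤ.*-zeroʳ (+ suc (suc n))
absorption (suc a) zero = begin
  + 1 ℤ.* + (suc a C 1)         ≡⟨ cong (λ z → + 1 ℤ.* + z) (nCk+nC[k+1]≡[n+1]C[k+1] a 0) ⟨
  + 1 ℤ.* + (1 ℕ.+ a C 1)       ≡⟨ lemma₁ (+ (a C 1)) ⟩
  + 1 ℤ.+ + 1 ℤ.* + (a C 1)     ≡⟨ cong (λ z → + 1 ℤ.+ z) (absorption a 0) ⟩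
  + 1 ℤ.+ + 1 ℤ.* (+ a ℤ.- + 0) ≡⟨ lemma₂ (+ a) ⟩
  + 1 ℤ.* (+ suc a ℤ.- + 0)     ∎
  where
  open ≡-Reasoning
  lemma₁ : ∀ x → + 1 ℤ.* (+ 1 ℤ.+ x) ≡ + 1 ℤ.+ + 1 ℤ.* x
  lemma₁ = solve-∀
  lemma₂ : ∀ x → + 1 ℤ.+ + 1 ℤ.* (x ℤ.- + 0) ≡ + 1 ℤ.* ((+ 1 ℤ.+ x) ℤ.- + 0)
  lemma₂ = solve-∀
absorption (suc a) (suc n) = begin
  + suc (suc n) ℤ.* + (suc a C suc (suc n))
    ≡⟨ cong (λ z → + suc (suc n) ℤ.* + z) (nCk+nC[k+1]≡[n+1]C[k+1] a (suc n)) ⟨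
  (+ 1 ℤ.+ + suc n) ℤ.* (y ℤ.+ z)
    ≡⟨ lemma₁ (+ suc n) y z ⟩
  y ℤ.+ + suc n ℤ.* y ℤ.+ (+ 1 ℤ.+ + suc n) ℤ.* z
    ≡⟨ cong₂ (λ v w → y ℤ.+ v ℤ.+ w) (absorption a n) (absorption a (suc n)) ⟩
  y ℤ.+ x ℤ.* (+ a ℤ.- + n) ℤ.+ y ℤ.* (+ a ℤ.- (+ 1 ℤ.+ + n))
    ≡⟨ lemma₂ x y (+ a) (+ n) ⟩
  (x ℤ.+ y) ℤ.* ((+ 1 ℤ.+ + a) ℤ.- (+ 1 ℤ.+ + n))
    ≡⟨ cong (λ z → + z ℤ.* (+ suc a ℤ.- + suc n)) (nCk+nC[k+1]≡[n+1]C[k+1] a n) ⟩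
  + (suc a C suc n) ℤ.* (+ suc a ℤ.- + suc n) ∎
  where
  open ≡-Reasoning
  x = + (a C n)
  y = + (a C suc n)
  z = + (a C suc (suc n))
  lemma₁ : ∀ n y z → (+ 1 ℤ.+ n) ℤ.* (y ℤ.+ z) ≡ y ℤ.+ n ℤ.* y ℤ.+ (+ 1 ℤ.+ n) ℤ.* z
  lemma₁ = solve-∀
  lemma₂ : ∀ x y a n →
           y ℤ.+ x ℤ.* (a ℤ.- n) ℤ.+ y ℤ.* (a ℤ.- (+ 1 ℤ.+ n)) ≡
           (x ℤ.+ y) ℤ.* ((+ 1 ℤ.+ a) ℤ.- (+ 1 ℤ.+ n))
  lemma₂ = solve-∀

fallingℤ-C : ∀ a n → fallingℤ (+ a) n ≡ + (n !) ℤ.* + (a C n)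
fallingℤ-C a zero    = refl
fallingℤ-C a (suc n) = begin
  fallingℤ (+ a) n ℤ.* (+ a ℤ.- + n)             ≡⟨ cong (ℤ._* (+ a ℤ.- + n)) (fallingℤ-C a n) ⟩
  + (n !) ℤ.* + (a C n) ℤ.* (+ a ℤ.- + n)        ≡⟨ ℤ.*-assoc (+ (n !)) _ _ ⟩
  + (n !) ℤ.* (+ (a C n) ℤ.* (+ a ℤ.- + n))      ≡⟨ cong (+ (n !) ℤ.*_) (absorption a n) ⟨
  + (n !) ℤ.* (+ suc n ℤ.* + (a C suc n))        ≡⟨ lemma (+ (n !)) (+ suc n) _ ⟩
  (+ suc n ℤ.* + (n !)) ℤ.* + (a C suc n)        ≡⟨ cong (ℤ._* + (a C suc n)) (ℤ.pos-* (suc n) (n !)) ⟨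
  + (suc n !) ℤ.* + (a C suc n)                  ∎
  where
  open ≡-Reasoning
  lemma : ∀ x y z → x ℤ.* (y ℤ.* z) ≡ (y ℤ.* x) ℤ.* z
  lemma = solve-∀

module Adic (ℓ : ℕ) (ℓ-prime : Prime ℓ) where

  private instance
    ℓ≢0 : NonZero ℓ
    ℓ≢0 = prime⇒nonZero ℓ-prime

  -- The ring ℤ_ℓ = lim ℤ/ℓⁿ: an ℓ-adic integer is a sequence whose n-th
  -- entry is an integer representing its class modulo ℓⁿ.

  record ℤₗ : Set where
    field
      rep      : ℕ → ℤ
      coherent : ∀ n → rep (suc n) ≡ rep n [mod ℓ ℕ.^ n ]

  open ℤₗ public

  infix  4 _≈_
  infixl 6 _+_ _-_
  infixl 7 _*_
  infix  8 -_

  record _≈_ (x y : ℤₗ) : Set where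
    constructor ≈-by
    field at : ∀ n → rep x n ≡ rep y n [mod ℓ ℕ.^ n ]

  open _≈_ public

  fromℤ : ℤ → ℤₗ
  fromℤ z .rep      n = z
  fromℤ z .coherent n = mod-refl z

  0ₗ 1ₗ : ℤₗ
  0ₗ = fromℤ (+ 0)
  1ₗ = fromℤ (+ 1)

  _+_ _*_ : ℤₗ → ℤₗ → ℤₗ
  (x + y) .rep      n = rep x n ℤ.+ rep y n
  (x + y) .coherent n = mod-+ (coherent x n) (coherent y n)
  (x * y) .rep      n = rep x n ℤ.* rep y n
  (x * y) .coherent n = mod-* (coherent x n) (coherent y n)

  -_ : ℤₗ → ℤₗ
  (- x) .rep      n = ℤ.- rep x n
  (- x) .coherent n = mod-neg (coherent x n)

  _-_ : ℤₗ → ℤₗ → ℤₗ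
  x - y = x + (- y)

  _∣ₗ_ : ℤₗ → ℤₗ → Set
  x ∣ₗ y = ∃[ q ] y ≈ q * x

  +-rawMonoid : RawMonoid 0ℓ 0ℓ
  +-rawMonoid = record { Carrier = ℤₗ ; _≈_ = _≈_ ; _∙_ = _+_ ; ε = 0ₗ }

  open import Algebra.Definitions.RawMonoid +-rawMonoid using (sum)

  ^-mono-∣ : ∀ {m n} → m ℕ.≤ n → ℓ ℕ.^ m ∣ ℓ ℕ.^ n
  ^-mono-∣ {m} {n} m≤n = ℕ.divides (ℓ ℕ.^ (n ℕ.∸ m))
    (trans (cong (ℓ ℕ.^_) (sym (ℕ.m∸n+n≡m m≤n))) (ℕ.^-distribˡ-+-* ℓ (n ℕ.∸ m) m))

  coherent⁺ : ∀ x n m → rep x (m ℕ.+ n) ≡ rep x n [mod ℓ ℕ.^ n ]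
  coherent⁺ x n zero    = mod-refl (rep x n)
  coherent⁺ x n (suc m) = mod-trans
    (mod-weaken (^-mono-∣ (ℕ.m≤n+m n m)) (coherent x (m ℕ.+ n))) (coherent⁺ x n m)

  cancel-coprime : ∀ d m x → ¬ ℓ ∣ d → ℓ ℕ.^ m ∣ d ℕ.* x → ℓ ℕ.^ m ∣ x
  cancel-coprime d zero    x ℓ∤d p = ℕ.1∣ x
  cancel-coprime d (suc m) x ℓ∤d p
    with euclidsLemma d x ℓ-prime (ℕ.∣-trans (ℕ.m∣m*n (ℓ ℕ.^ m)) p)
  ... | inj₁ ℓ∣d = contradiction ℓ∣d ℓ∤d
  ... | inj₂ (ℕ.divides y refl) = subst (ℓ ℕ.^ suc m ∣_) (ℕ.*-comm ℓ y)
    (ℕ.*-monoʳ-∣ ℓ (cancel-coprime d m y ℓ∤d (ℕ.*-cancelˡ-∣ ℓ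
      (subst (ℓ ℕ.^ suc m ∣_) (lemma d y ℓ) p))))
    where
    lemma : ∀ d y l → d ℕ.* (y ℕ.* l) ≡ l ℕ.* (d ℕ.* y)
    lemma = ℕ-solve-∀

  cancel-ℕ : ∀ d k x .{{_ : NonZero d}} →
             ℓ ℕ.^ (k ℕ.+ d) ∣ d ℕ.* x → ℓ ℕ.^ k ∣ x
  cancel-ℕ d k x = go d (<-wellFounded d)
    where
    lemma : ∀ q l x → (q ℕ.* l) ℕ.* x ≡ l ℕ.* (q ℕ.* x)
    lemma = ℕ-solve-∀

    go : ∀ d → Acc ℕ._<_ d → .{{_ : NonZero d}} →
         ℓ ℕ.^ (k ℕ.+ d) ∣ d ℕ.* x → ℓ ℕ.^ k ∣ x
    go d@(suc d-1) (acc rs) p with ℓ ℕ.∣? d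
    ... | no ℓ∤d = cancel-coprime d k x ℓ∤d
      (ℕ.∣-trans (^-mono-∣ (ℕ.m≤m+n k d)) p)
    ... | yes (ℕ.divides zero ())
    ... | yes (ℕ.divides q@(suc _) eq) =
      go q (rs q<d) (ℕ.∣-trans (^-mono-∣ (ℕ.+-monoʳ-≤ k (ℕ.s≤s⁻¹ q<d)))
        (ℕ.*-cancelˡ-∣ ℓ (subst₂ _∣_
          (cong (ℓ ℕ.^_) (ℕ.+-suc k d-1))
          (trans (cong (ℕ._* x) eq) (lemma q ℓ x)) p)))
      where
      q<d : q ℕ.< d
      q<d = subst (q ℕ.<_) (sym eq) (ℕ.m<m*n q ℓ (ℕ.nonTrivial⇒n>1 ℓ {{prime⇒nonTrivial ℓ-prime}}))

  cancel-ℤ : ∀ d k x y .{{_ : NonZero d}} →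
             + d ℤ.* x ≡ + d ℤ.* y [mod ℓ ℕ.^ (k ℕ.+ d) ] → x ≡ y [mod ℓ ℕ.^ k ]
  cancel-ℤ d k x y (mod p) = mod (∣ᵤ⇒∣ (cancel-ℕ d k _
    (subst (ℓ ℕ.^ (k ℕ.+ d) ∣_) (trans (cong ℤ.∣_∣ (lemma (+ d) x y)) (ℤ.abs-* (+ d) _)) (∣⇒∣ᵤ p))))
    where
    lemma : ∀ d x y → d ℤ.* x ℤ.- d ℤ.* y ≡ d ℤ.* (x ℤ.- y)
    lemma = solve-∀

  residue : ℤₗ → ℕ → ℕ
  residue b m = (rep b m %ℕ ℓ ℕ.^ m) {{ℕ.m^n≢0 ℓ m}}

  n!*residue-C : ∀ b n m →
    + (n !) ℤ.* + (residue b m C n) ≡ fallingℤ (rep b m) n [mod ℓ ℕ.^ m ]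
  n!*residue-C b n m = subst (_≡ fallingℤ (rep b m) n [mod ℓ ℕ.^ m ])
    (fallingℤ-C (residue b m) n)
    (mod-sym (mod-fallingℤ n (mod-%ℕ (rep b m) (ℓ ℕ.^ m) {{ℕ.m^n≢0 ℓ m}})))

  -- b (b − 1) ⋯ (b − n + 1) / n!, computed modulo ℓᵏ as the ordinary binomial
  -- coefficient of a natural number congruent to b modulo ℓ^(k + n!).  That
  -- precision suffices because the ℓ-adic valuation of n! is at most n!;
  -- binom-spec below confirms that the result is the intended quotient.
  binom : ℤₗ → ℕ → ℤₗ
  binom b n .rep      k = + (residue b (k ℕ.+ n !) C n)
  binom b n .coherent k = cancel-ℤ (n !) k _ _ {{n !≢0}}
    (mod-trans (mod-weaken (^-mono-∣ (ℕ.n≤1+n m)) (n!*residue-C b n (suc m)))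
    (mod-trans (mod-fallingℤ n (coherent b m)) (mod-sym (n!*residue-C b n m))))
    where
    m = k ℕ.+ n !

  falling : ℤₗ → ℕ → ℤₗ
  falling b zero    = 1ₗ
  falling b (suc n) = falling b n * (b - fromℤ (+ n))

  binom-spec : ∀ b n → fromℤ (+ (n !)) * binom b n ≈ falling b n
  binom-spec b n = ≈-by λ k → subst
    (rep (fromℤ (+ (n !)) * binom b n) k ≡_[mod ℓ ℕ.^ k ]) (sym (rep-falling k n))
    (mod-trans (mod-weaken (^-mono-∣ (ℕ.m≤m+n k (n !))) (n!*residue-C b n (k ℕ.+ n !)))
      (mod-fallingℤ n (subst (λ m → rep b m ≡ rep b k [mod ℓ ℕ.^ k ])
        (ℕ.+-comm (n !) k) (coherent⁺ b k (n !)))))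
    where
    rep-falling : ∀ k n → rep (falling b n) k ≡ fallingℤ (rep b k) n
    rep-falling k zero    = refl
    rep-falling k (suc n) = cong (ℤ._* (rep b k ℤ.- + n)) (rep-falling k n)

  -- The ring ℤ_ℓ[[T]]: a power series is its sequence of coefficients.

  Series : Set
  Series = ℕ → ℤₗ

  infix  4 _≈ₛ_
  infixl 6 _-ₛ_
  infixl 7 _*ₛ_

  _≈ₛ_ : Series → Series → Set
  f ≈ₛ g = ∀ n → f n ≈ g n

  constant : ℤₗ → Series
  constant c zero    = c
  constant c (suc _) = 0ₗ

  _-ₛ_ _*ₛ_ : Series → Series → Series
  (f -ₛ g) n = f n - g n
  (f *ₛ g) n = sum {suc n} λ i → f (toℕ i) * g (n ℕ.∸ toℕ i)

  sumₛ : ∀ {t} → (Fin t → Series) → Series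
  sumₛ f n = sum λ j → f j n

  IsUnit : Series → Set
  IsUnit u = ∃[ v ] u *ₛ v ≈ₛ constant 1ₗ

  record IsDistinguished (g : Series) (d : ℕ) : Set where
    field
      monic      : g d ≈ 1ₗ
      degree     : ∀ n → d ℕ.< n → g n ≈ 0ₗ
      nonLeading : ∀ n → n ℕ.< d → fromℤ (+ ℓ) ∣ₗ g n

  record WeierstrassForm (f : Series) (μ d : ℕ) : Set where
    field
      g u             : Series
      g-distinguished : IsDistinguished g d
      u-unit          : IsUnit u
      factorization   : f ≈ₛ constant (fromℤ (+ (ℓ ℕ.^ μ))) *ₛ (g *ₛ u)

  [1+T]^_ : ℤₗ → Series
  [1+T]^ b = binom b

  charSeries : ∀ {t} → (Fin t → ℤₗ) → Series
  charSeries α = sumₛ λ j →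
    constant (fromℤ (+ 2)) -ₛ [1+T]^ (α j) -ₛ [1+T]^ (- α j)

  Admissible : ∀ {t} → Pred (Fin t → ℤₗ) 0ℓ
  Admissible α = ¬ (∀ j → fromℤ (+ ℓ) ∣ₗ α j)

  -- μ_ℓ(X_t, α) = μ and λ_ℓ(X_t, α) = λ′, the distinguished polynomial
  -- having degree λ′ + 1.
  HasInvariants : ∀ {t} → (Fin t → ℤₗ) → ℕ → ℕ → Set
  HasInvariants α μ λ′ = WeierstrassForm (charSeries α) μ (suc λ′)

  -- The translate c + (ℓⁿℤ_ℓ)ᵗ.  For fixed n there are ℓⁿᵗ of them and they
  -- partition ℤ_ℓᵗ, so normalization and translation invariance force the
  -- measure of each to be ℓ⁻ⁿᵗ.
  record Ball (t : ℕ) : Set where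
    field
      level  : ℕ
      centre : Fin t → ℤₗ

  open Ball

  _∈ᵇ_ : ∀ {t} → (Fin t → ℤₗ) → Maybe (Ball t) → Set
  α ∈ᵇ nothing = ⊥
  α ∈ᵇ just B  = ∀ j → fromℤ (+ (ℓ ℕ.^ level B)) ∣ₗ (α j - centre B j)

  ℓ^-_ : ℕ → ℚ
  ℓ^- n = (+ 1 ℚ./ (ℓ ℕ.^ n)) {{ℕ.m^n≢0 ℓ n}}

  volume : ∀ {t} → Maybe (Ball t) → ℚ
  volume     nothing  = 0ℚ
  volume {t} (just B) = ℓ^- (level B ℕ.* t)

  totalVolume : ∀ {t} → (ℕ → Maybe (Ball t)) → ℕ → ℚ
  totalVolume U zero    = 0ℚ
  totalVolume U (suc N) = totalVolume U N ℚ.+ volume (U N)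

  -- τ*(S) ≤ q for the outer measure τ* induced by the volume of balls: the
  -- infimum, over all countable covers of S by balls (or empty sets), of the
  -- sums of their volumes.  Only q is rational; the infimum itself is a real
  -- number, and a sum is at most q + ε when all its partial sums are.
  OuterMeasure≤ : ∀ {t} → Pred (Fin t → ℤₗ) 0ℓ → ℚ → Set
  OuterMeasure≤ {t} S q = ∀ ε → 0ℚ ℚ.< ε →
    Σ[ U ∈ (ℕ → Maybe (Ball t)) ]
      (∀ α → α ∈ₛ S → ∃[ i ] α ∈ᵇ U i) ×
      (∀ N → totalVolume U N ℚ.≤ q ℚ.+ ε)

  -- S is measurable with τ(S) = q, in Lebesgue's sense: τ*(S) ≤ q ≤ τ₊(S),
  -- where τ₊(S) = 1 − τ*(∁ S) is the inner measure; classically τ₊ ≤ τ*, so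
  -- both equal q.
  HasMeasure : ∀ {t} → Pred (Fin t → ℤₗ) 0ℓ → ℚ → Set
  HasMeasure S q = OuterMeasure≤ S q × OuterMeasure≤ (∁ S) (1ℚ ℚ.- q)

  -- Prob_ℓ(X_t; μ = μ₀, λ = λ₀) = p, with the normalizing factor
  -- (1 − ℓ⁻ᵗ)⁻¹ moved to the other side.
  Prob≡ : (t μ₀ λ₀ : ℕ) → ℚ → Set
  Prob≡ t μ₀ λ₀ p =
    HasMeasure {t} (λ α → Admissible α × HasInvariants α μ₀ λ₀)
               ((1ℚ ℚ.- ℓ^- t) ℚ.* p)

{-# OPTIONS --safe #-}

-- Up to n!, the n-th coefficient of the characteristic series modulo ℓ is a
-- combination of the power sums of α₁², α₂², α₃².  The coefficients of T⁰ and
-- T¹ vanish and that of T² is −Σα².  If Σα² ≡ 0, the next one to survive is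
-- that of T⁴, −Σα⁴/12; if moreover Σα⁴ ≡ 0, it is that of T⁶, −Σα⁶/360.  By
-- Weierstrass preparation, μ = 0 and λ + 1 is the index of the first coefficient
-- prime to ℓ, so the invariants depend only on α modulo ℓ, and both a level set
-- and its complement are unions of residue classes, whose numbers add up to ℓ³.
--
-- It remains to count over 𝔽_ℓ.  The cone a² + b² + c² = 0 has ℓ² points.  Those
-- with a⁴ + b⁴ + c⁴ = 0 as well are the origin and the 8(ℓ − 1) points
-- (a , ±ωa , ±ω²a) with a ≠ 0 and ω a primitive cube root of unity, which exists
-- if and only if ℓ ≡ 1 mod 3.
module Submission where

open import Defs
import Algebra.Properties.CommutativeMonoid.Sum as MonoidSum
open import Data.Bool.Base using (Bool; true; false; if_then_else_)
open import Data.Fin.Base using (Fin; zero; suc; toℕ; fromℕ<; splitAt; join)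
import Data.Fin.Properties as Fin
open import Data.Fin.Properties using (pigeonhole; any?)
open import Data.Fin.Permutation using (Permutation; permutation; reverse)
open import Data.Integer.Base as ℤ using (ℤ; +_; _%ℕ_)
open import Data.Integer.Divisibility.Signed using
  (divides; ∣m∣n⇒∣m+n; ∣n⇒∣m*n; ∣⇒∣ᵤ; ∣ᵤ⇒∣; _∣?_) renaming (_∣_ to _∣ℤ_)
open import Data.Integer.DivMod using (n%ℕd<d)
import Data.Integer.Properties as ℤ
open import Data.Integer.Tactic.RingSolver using (solve; solve-∀)
open import Data.List.Base using
  (List; []; _∷_; _++_; length; map; filter; lookup; allFin; cartesianProduct)
open import Data.List.Membership.Propositional using (_∈_)
open import Data.List.Membership.Propositional.Properties using
  (∈-lookup; ∈-filter⁺; ∈-filter⁻; ∈-map⁺; ∈-map⁻; ∈-++⁺ˡ; ∈-++⁺ʳ; ∈-++⁻; ∈-allFin;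
   ∈-cartesianProduct⁺; ∈-cartesianProduct⁻)
import Data.List.Properties as List
open import Data.List.Relation.Binary.Subset.Propositional using (_⊆_)
import Data.List.Relation.Unary.All as All
open import Data.List.Relation.Unary.AllPairs using ([]; _∷_)
open import Data.List.Relation.Unary.Any using (here; there; index)
open import Data.List.Relation.Unary.Any.Properties using (lookup-index)
open import Data.List.Relation.Unary.Unique.Propositional using (Unique)
import Data.List.Relation.Unary.Unique.Propositional.Properties as Unique
open import Data.Maybe.Base using (Maybe; just; nothing)
open import Data.Nat.Base as ℕ using (ℕ; zero; suc; NonZero; s≤s)
open import Data.Nat.Divisibility using (_∣_)
import Data.Nat.Divisibility as ℕ
open import Data.Nat.Coprimality using (prime⇒coprime; coprime-Bézout)
open import Data.Nat.GCD using (module Bézout)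
import Data.Nat.DivMod as ℕ
open import Data.Nat.Primality using (Prime; prime⇒nonZero; prime⇒nonTrivial; prime⇒irreducible; euclidsLemma)
import Data.Nat.Properties as ℕ
open import Data.Product.Base using (∃-syntax; _×_; _,_; proj₁; proj₂)
open import Data.Product.Properties using (≡-dec)
open import Data.Rational.Base as ℚ using (ℚ; 0ℚ; 1ℚ; toℚᵘ)
import Data.Rational.Properties as ℚ
open import Data.Rational.Unnormalised.Base as ℚᵘ using (mkℚᵘ; *≡*; _≃_)
import Data.Rational.Unnormalised.Properties as ℚᵘ
import Data.Sum.Base as Sum
open import Data.Sum.Base using (_⊎_; inj₁; inj₂)
open import Function.Base using (_∘_)
open import Relation.Binary.PropositionalEquality
  using (_≡_; _≢_; refl; sym; trans; cong; cong₂; subst; subst₂; module ≡-Reasoning)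
open import Level using (0ℓ)
open import Relation.Binary.Definitions using (DecidableEquality; tri<; tri≈; tri>)
open import Relation.Nullary.Decidable using (decidable-stable)
open import Relation.Nullary using (¬_; Dec; yes; no; does; contradiction)
open import Relation.Unary using (Pred; ∁)

-- The invariant λ is always odd here: the series is invariant under 1 + T ↦ (1 + T)⁻¹, which acts
-- on the lowest term of its reduction modulo ℓ as T ↦ -T, so the order of that reduction is even.
-- This is why the coefficients of T³ and T⁵ vanish together with the earlier ones. Order 6 is the
-- last case because at a nonzero common zero of the two forms the squares of the coordinates are
-- a², wa², w²a² up to order, with w a primitive cube root of unity, and their cubes add up to 3a⁶.
-- In particular μ > 0 never occurs.
--
-- The level sets are stable under scaling, so the numerators count points of the projective plane
-- over 𝔽_ℓ, which has ℓ² + ℓ + 1 points: ℓ + 1 lie on the conic, and 0 or 8 of these on the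
-- quartic.
--
-- Two facts about 𝔽_ℓ are obtained by counting alone: -1 is a sum of two squares by the pigeonhole
-- principle, which makes the conic split, and the criterion for cube roots of unity follows from
-- permutations of order 3. Weierstrass preparation is carried out on integer representatives, so
-- each congruence has to record its precision.

-- Divisibility and congruences of integers.

module Congruence where

  open import Data.Integer.Base using (_+_; _*_; _-_; -_)

  infixl 6 _⊕_
  infixr 7 _⊙_

  _⊕_ : ∀ {d x y} → d ∣ℤ x → d ∣ℤ y → d ∣ℤ x + y
  _⊕_ = ∣m∣n⇒∣m+n

  _⊙_ : ∀ {d} c {x} → d ∣ℤ x → d ∣ℤ c * x
  c ⊙ h = ∣n⇒∣m*n c h

  -- Abstract, so that quotients do not unfold to the proof terms of the ring solver.
  abstract
    by : ∀ {d x y} → d ∣ℤ x → x ≡ y → d ∣ℤ y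
    by {d} h eq = subst (d ∣ℤ_) eq h

  ≡⇒mod : ∀ {m x y} → x ≡ y → x ≡ y [mod m ]
  ≡⇒mod refl = mod-refl _

  mod-1 : ∀ {x y} → x ≡ y [mod 1 ]
  mod-1 {x} {y} = mod (divides (x - y) (sym (ℤ.*-identityʳ (x - y))))

  0⇒∣ : ∀ {m x} → x ≡ + 0 [mod m ] → + m ∣ℤ x
  0⇒∣ {x = x} (mod h) = by h (solve (x ∷ []))

  ∣⇒0 : ∀ {m x} → + m ∣ℤ x → x ≡ + 0 [mod m ]
  ∣⇒0 {x = x} h = mod (by h (solve (x ∷ [])))

  mod-- : ∀ {m a b c d} → a ≡ b [mod m ] → c ≡ d [mod m ] → a - c ≡ b - d [mod m ]
  mod-- h k = mod-+ h (mod-neg k)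

  -- x y - x′ y′ = y (x - x′) + x′ (y - y′), and in the second term a multiple of a meets a multiple
  -- of b. With a = ℓ and b = ℓᵏ this is where the iteration for Weierstrass preparation gains a
  -- digit.
  mod-*-contract : ∀ {a b x x′ y y′} → x ≡ x′ [mod a ℕ.* b ] → x′ ≡ + 0 [mod a ] →
                   y ≡ y′ [mod b ] → x * y ≡ x′ * y′ [mod a ℕ.* b ]
  mod-*-contract {a} {b} {x} {x′} {y} {y′} (mod h) x′≡0 (mod k) with 0⇒∣ x′≡0 | k
  ... | divides q refl | divides r eq = mod (by (y ⊙ h ⊕ product) (split x (q * + a) y y′))
    where
    split : ∀ x x′ y y′ → y * (x - x′) + x′ * (y - y′) ≡ x * y - x′ * y′
    split = solve-∀
    product : + (a ℕ.* b) ∣ℤ q * + a * (y - y′)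
    product = divides (q * r) (begin
      q * + a * (y - y′)    ≡⟨ cong (q * + a *_) eq ⟩
      q * + a * (r * + b)   ≡⟨ lemma q (+ a) r (+ b) ⟩
      q * r * (+ a * + b)   ≡⟨ cong (q * r *_) (ℤ.pos-* a b) ⟨
      q * r * + (a ℕ.* b)   ∎)
      where
      open ≡-Reasoning
      lemma : ∀ q a r b → q * a * (r * b) ≡ q * r * (a * b)
      lemma = solve-∀

-- Integer power series: convolution and division with remainder of precision.

module PowerSeries where

  open import Data.Integer.Base using (_+_; _*_; _-_; -_)
  open Congruence
  open MonoidSum ℤ.+-0-commutativeMonoid

  sum-mod : ∀ {m n} {s t : Fin n → ℤ} → (∀ i → s i ≡ t i [mod m ]) → sum s ≡ sum t [mod m ]
  sum-mod {n = zero}  h = mod-refl (+ 0)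
  sum-mod {n = suc n} h = mod-+ (h zero) (sum-mod (h ∘ suc))

  conv : (ℕ → ℤ) → (ℕ → ℤ) → ℕ → ℤ
  conv f g n = sum {suc n} λ i → f (toℕ i) * g (n ℕ.∸ toℕ i)

  -- The monomial c Tᵐ; likewise `shift m u` below is Tᵐ u. Both indices recurse together because
  -- dropping the first summand of `conv` lowers them simultaneously.
  mono : ℤ → ℕ → ℕ → ℤ
  mono c zero    zero    = c
  mono c zero    (suc n) = + 0
  mono c (suc m) zero    = + 0
  mono c (suc m) (suc n) = mono c m n

  mono-≡ : ∀ c m → mono c m m ≡ c
  mono-≡ c zero    = refl
  mono-≡ c (suc m) = mono-≡ c m

  mono-≢ : ∀ c {m n} → m ≢ n → mono c m n ≡ + 0
  mono-≢ c {zero}  {zero}  m≢n = contradiction refl m≢n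
  mono-≢ c {zero}  {suc n} m≢n = refl
  mono-≢ c {suc m} {zero}  m≢n = refl
  mono-≢ c {suc m} {suc n} m≢n = mono-≢ c (m≢n ∘ cong suc)

  shift : ℕ → (ℕ → ℤ) → ℕ → ℤ
  shift zero    u n       = u n
  shift (suc m) u zero    = + 0
  shift (suc m) u (suc n) = shift m u n

  shift-< : ∀ {m n} u → n ℕ.< m → shift m u n ≡ + 0
  shift-< {suc m} {zero}  u _         = refl
  shift-< {suc m} {suc n} u (s≤s n<m) = shift-< u n<m

  shift-+ : ∀ m n u → shift m u (m ℕ.+ n) ≡ u n
  shift-+ zero    n u = refl
  shift-+ (suc m) n u = shift-+ m n u

  conv-comm : ∀ f g n → conv f g n ≡ conv g f n
  conv-comm f g n = trans
    (sum-permute (λ i → f (toℕ i) * g (n ℕ.∸ toℕ i)) reverse)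
    (sum-cong-≗ λ i → trans (ℤ.*-comm (f _) (g _))
      (cong₂ (λ a b → g a * f b)
        (trans (cong (n ℕ.∸_) (Fin.opposite-prop i)) (ℕ.m∸[m∸n]≡n (ℕ.s≤s⁻¹ (Fin.toℕ<n i))))
        (Fin.opposite-prop i)))

  conv-+ : ∀ f f′ g n → conv (λ i → f i + f′ i) g n ≡ conv f g n + conv f′ g n
  conv-+ f f′ g n = trans
    (sum-cong-≗ {suc n} λ i → ℤ.*-distribʳ-+ (g (n ℕ.∸ toℕ i)) (f (toℕ i)) (f′ (toℕ i)))
    (∑-distrib-+ {suc n} (λ i → f (toℕ i) * g (n ℕ.∸ toℕ i)) (λ i → f′ (toℕ i) * g (n ℕ.∸ toℕ i)))

  conv-zeroˡ : ∀ g n → conv (λ _ → + 0) g n ≡ + 0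
  conv-zeroˡ g n = sum-replicate-zero (suc n)

  conv-mono : ∀ c m u n → conv (mono c m) u n ≡ c * shift m u n
  conv-mono c zero    u zero    = ℤ.+-identityʳ (c * u 0)
  conv-mono c zero    u (suc n) = trans (cong (_+_ (c * u (suc n))) (conv-zeroˡ u n))
    (ℤ.+-identityʳ (c * u (suc n)))
  conv-mono c (suc m) u zero    = sym (ℤ.*-zeroʳ c)
  conv-mono c (suc m) u (suc n) = trans (ℤ.+-identityˡ _) (conv-mono c m u n)

  conv-congˡ : ∀ {m f f′} g n → (∀ i → i ℕ.≤ n → f i ≡ f′ i [mod m ]) →
               conv f g n ≡ conv f′ g n [mod m ]
  conv-congˡ g n h = sum-mod {n = suc n} λ i → mod-* (h (toℕ i) (ℕ.s≤s⁻¹ (Fin.toℕ<n i))) (mod-refl (g (n ℕ.∸ toℕ i)))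

  conv-contract : ∀ {a b f f′ g g′} → (∀ i → f i ≡ f′ i [mod a ℕ.* b ]) →
                  (∀ i → f′ i ≡ + 0 [mod a ]) → (∀ i → g i ≡ g′ i [mod b ]) →
                  ∀ n → conv f g n ≡ conv f′ g′ n [mod a ℕ.* b ]
  conv-contract f≡f′ f′≡0 g≡g′ n = sum-mod {n = suc n} λ i →
    mod-*-contract (f≡f′ (toℕ i)) (f′≡0 (toℕ i)) (g≡g′ (n ℕ.∸ toℕ i))

  conv-small : ∀ {a f} g → (∀ i → f i ≡ + 0 [mod a ]) → ∀ n → conv f g n ≡ + 0 [mod a ]
  conv-small g f≡0 n = mod-trans (conv-congˡ g n λ i _ → f≡0 i) (≡⇒mod (conv-zeroˡ g n))

  -- The first m coefficients of F / u, followed by zeros; y is an inverse of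
  -- the constant term of u.
  quot : (F u : ℕ → ℤ) (y : ℤ) → ℕ → ℕ → ℤ
  quot F u y zero    n = + 0
  quot F u y (suc m) n =
    quot F u y m n + mono (y * (F m - conv (quot F u y m) u m)) m n

  module _ (F u : ℕ → ℤ) (y : ℤ) where

    quot-≥ : ∀ {m n} → m ℕ.≤ n → quot F u y m n ≡ + 0
    quot-≥ {zero}  m≤n = refl
    quot-≥ {suc m} m<n =
      cong₂ _+_ (quot-≥ (ℕ.<⇒≤ m<n)) (mono-≢ _ (ℕ.<⇒≢ m<n))

    quot-stable : ∀ {m n} → n ℕ.< m → quot F u y m n ≡ quot F u y (suc n) n
    quot-stable {suc m} {n} (s≤s n≤m) with ℕ.m≤n⇒m<n∨m≡n n≤m
    ... | inj₂ refl = refl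
    ... | inj₁ n<m  = trans
      (cong₂ _+_ (quot-stable n<m) (mono-≢ _ (ℕ.>⇒≢ n<m))) (ℤ.+-identityʳ _)

    -- Adding the monomial of degree m leaves the product unchanged below degree m and adds to its
    -- coefficient of Tᵐ the current error times y u(0) ≡ 1.
    quot-spec : ∀ {k} → u 0 * y ≡ + 1 [mod k ] → ∀ {m n} → n ℕ.< m →
                conv (quot F u y m) u n ≡ F n [mod k ]
    quot-spec (mod inv) {suc m} {n} (s≤s n≤m) = mod-trans
      (≡⇒mod (trans (conv-+ (quot F u y m) (mono c m) u n) (cong (_+_ (conv (quot F u y m) u n)) (conv-mono c m u n))))
      (last (ℕ.m≤n⇒m<n∨m≡n n≤m))
      where
      c = y * (F m - conv (quot F u y m) u m)
      drop : ∀ s c → s + c * + 0 ≡ s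
      drop = solve-∀
      last : n ℕ.< m ⊎ n ≡ m → conv (quot F u y m) u n + c * shift m u n ≡ F n [mod _ ]
      last (inj₁ n<m) = subst (λ s → conv (quot F u y m) u n + c * s ≡ F n [mod _ ]) (sym (shift-< u n<m))
        (mod-trans (≡⇒mod (drop (conv (quot F u y m) u n) c)) (quot-spec (mod inv) n<m))
      last (inj₂ refl) = subst (λ s → conv (quot F u y m) u n + c * s ≡ F n [mod _ ]) (sym u₀)
        (finish (conv (quot F u y m) u n) (F n) (u 0) inv)
        where
        u₀ : shift n u n ≡ u 0
        u₀ = trans (cong (shift n u) (sym (ℕ.+-identityʳ n))) (shift-+ n 0 u)
        finish : ∀ {k} s t v → + k ∣ℤ v * y - + 1 → s + y * (t - s) * v ≡ t [mod k ]
        finish s t v h = mod (by ((t - s) ⊙ h) (solve (s ∷ t ∷ v ∷ y ∷ [])))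

  quot-small : ∀ {a F u y} m → (∀ n → n ℕ.< m → F n ≡ + 0 [mod a ]) →
               ∀ n → quot F u y m n ≡ + 0 [mod a ]
  -- All coefficients of the quotient are multiples of a, because those of F′ below m are. An error
  -- modulo b in the divisor, or in the inverse of its constant term, is therefore felt only modulo
  -- ab.
  quot-contract : ∀ {a b F F′ u u′ y y′} m →
                  (∀ n → F n ≡ F′ n [mod a ℕ.* b ]) → (∀ n → n ℕ.< m → F′ n ≡ + 0 [mod a ]) →
                  (∀ n → u n ≡ u′ n [mod b ]) → y ≡ y′ [mod b ] →
                  ∀ n → quot F u y m n ≡ quot F′ u′ y′ m n [mod a ℕ.* b ]
  mono-cong : ∀ {k c c′} → c ≡ c′ [mod k ] → ∀ m n → mono c m n ≡ mono c′ m n [mod k ]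

  mono-cong h zero    zero    = h
  mono-cong h zero    (suc n) = mod-refl _
  mono-cong h (suc m) zero    = mod-refl _
  mono-cong h (suc m) (suc n) = mono-cong h m n

  quot-error : ∀ {a F u y} m → (∀ n → n ℕ.< suc m → F n ≡ + 0 [mod a ]) →
               F m - conv (quot F u y m) u m ≡ + 0 [mod a ]
  quot-error {u = u} m h = mod-- (h m ℕ.≤-refl)
    (conv-small u (quot-small m λ n n<m → h n (ℕ.m<n⇒m<1+n n<m)) m)

  quot-small zero    h n = mod-refl (+ 0)
  quot-small {a} {F} {u} {y} (suc m) h n = mod-+
    (quot-small m (λ n n<m → h n (ℕ.m<n⇒m<1+n n<m)) n)
    (mod-trans (mono-cong (mod-trans (mod-* (mod-refl y) (quot-error m h)) (≡⇒mod (ℤ.*-zeroʳ y))) m n)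
      (≡⇒mod (mono-zero m n)))
    where
    mono-zero : ∀ m n → mono (+ 0) m n ≡ + 0
    mono-zero zero    zero    = refl
    mono-zero zero    (suc n) = refl
    mono-zero (suc m) zero    = refl
    mono-zero (suc m) (suc n) = mono-zero m n

  quot-contract zero F≡ F′≡0 u≡ y≡ n = mod-refl (+ 0)
  quot-contract {F = F} {F′} {u} {u′} {y} {y′} (suc m) F≡ F′≡0 u≡ y≡ n = mod-+ (rec n)
    (mono-cong (subst₂ (_≡_[mod _ ]) (ℤ.*-comm _ y) (ℤ.*-comm _ y′)
      (mod-*-contract
        (mod-- (F≡ m) (conv-contract rec (quot-small m F′≡0↓) u≡ m))
        (quot-error m F′≡0)
        y≡)) m n)
    where
    F′≡0↓ = λ n n<m → F′≡0 n (ℕ.m<n⇒m<1+n n<m)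
    rec = quot-contract m F≡ F′≡0↓ u≡ y≡

-- ℓ-adic integers, reduction of series modulo ℓ, Weierstrass preparation.

module AdicIntegers (ℓ : ℕ) (ℓ-prime : Prime ℓ) where

  open Congruence
  open PowerSeries
  open MonoidSum ℤ.+-0-commutativeMonoid using (sum)
  open Adic ℓ ℓ-prime hiding (_+_; _-_; -_) renaming (_*_ to _*ₗ_)
  open import Data.Integer.Base using (_+_; _*_; _-_; -_)
  open import Algebra.Definitions.RawMonoid +-rawMonoid using () renaming (sum to sumₗ)

  instance
    ℓ≢0 : NonZero ℓ
    ℓ≢0 = prime⇒nonZero ℓ-prime

  ℓ^1≡ℓ : ℓ ℕ.^ 1 ≡ ℓ
  ℓ^1≡ℓ = ℕ.*-identityʳ ℓ

  -- `ℓ ^ 1` unfolds to ℓ * 1 rather than to ℓ; the case k = 0 bridges this gap whenever a statement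
  -- about `rep x 1` is read modulo ℓ.
  mod-ℓ : ∀ k {x y} → x ≡ y [mod ℓ ℕ.^ suc k ] → x ≡ y [mod ℓ ]
  mod-ℓ k = mod-weaken (ℕ.m∣m*n (ℓ ℕ.^ k))

  ∤⇒mod-cancelˡ : ∀ d k {x} → ¬ + ℓ ∣ℤ d → d * x ≡ + 0 [mod ℓ ℕ.^ k ] → x ≡ + 0 [mod ℓ ℕ.^ k ]
  ∤⇒mod-cancelˡ d k {x} ℓ∤d h = ∣⇒0 (∣ᵤ⇒∣ (cancel-coprime ℤ.∣ d ∣ k ℤ.∣ x ∣ (ℓ∤d ∘ ∣ᵤ⇒∣)
    (subst (ℓ ℕ.^ k ∣_) (ℤ.abs-* d x) (∣⇒∣ᵤ (0⇒∣ h)))))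

  *-cancelʳ-∣ : ∀ l .{{_ : NonZero l}} q r c m → q * + l - r * + l ≡ c * + (l ℕ.* m) → q - r ≡ c * + m
  *-cancelʳ-∣ l q r c m h = ℤ.*-cancelʳ-≡ (q - r) (c * + m) (+ l) (begin
    (q - r) * + l         ≡⟨ lemma₁ q r (+ l) ⟩
    q * + l - r * + l     ≡⟨ h ⟩
    c * + (l ℕ.* m)       ≡⟨ cong (c *_) (ℤ.pos-* l m) ⟩
    c * (+ l * + m)       ≡⟨ lemma₂ c (+ l) (+ m) ⟩
    c * + m * + l         ∎)
    where
    open ≡-Reasoning
    lemma₁ : ∀ q r l → (q - r) * l ≡ q * l - r * l
    lemma₁ = solve-∀
    lemma₂ : ∀ c l m → c * (l * m) ≡ c * m * l
    lemma₂ = solve-∀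

  rep-suc : ∀ x k → rep x (suc k) ≡ rep x 1 [mod ℓ ]
  rep-suc x k = mod-ℓ 0 (subst (λ m → rep x m ≡ rep x 1 [mod ℓ ℕ.^ 1 ]) (ℕ.+-comm k 1) (coherent⁺ x 1 k))

  ∣ₗ⇒0 : ∀ {x} → fromℤ (+ ℓ) ∣ₗ x → rep x 1 ≡ + 0 [mod ℓ ]
  ∣ₗ⇒0 {x} (q , x≈qℓ) = mod-trans (mod-ℓ 0 (at x≈qℓ 1)) (∣⇒0 (divides (rep q 1) refl))

  0⇒∣ₗ : ∀ {x} → rep x 1 ≡ + 0 [mod ℓ ] → fromℤ (+ ℓ) ∣ₗ x
  0⇒∣ₗ {x} x≡0 = quotient , ≈-by λ k → mod-trans (mod-sym (coherent x k)) (≡⇒mod (q-eq k))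
    where
    open Data.Integer.Divisibility.Signed._∣_ using () renaming (quotient to quo; equality to eqn)
    ℓ∣x : ∀ k → + ℓ ∣ℤ rep x (suc k)
    ℓ∣x k = 0⇒∣ (mod-trans (rep-suc x k) x≡0)
    q-eq : ∀ k → rep x (suc k) ≡ quo (ℓ∣x k) * + ℓ
    q-eq k = eqn (ℓ∣x k)
    quotient : ℤₗ
    -- Division by ℓ costs one digit: the class of the quotient modulo ℓᵏ is read off from that of x
    -- modulo ℓᵏ⁺¹.
    quotient .rep k = quo (ℓ∣x k)
    quotient .coherent k = cancel (coherent x (suc k))
      where
      cancel : rep x (suc (suc k)) ≡ rep x (suc k) [mod ℓ ℕ.^ suc k ] →
               quo (ℓ∣x (suc k)) ≡ quo (ℓ∣x k) [mod ℓ ℕ.^ k ]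
      cancel (mod (divides c h)) = mod (divides c (*-cancelʳ-∣ ℓ (quo (ℓ∣x (suc k))) (quo (ℓ∣x k)) c (ℓ ℕ.^ k)
        (trans (sym (cong₂ _-_ (q-eq (suc k)) (q-eq k))) h)))

  rep-sum : ∀ k {n} (t : Fin n → ℤₗ) → rep (sumₗ t) k ≡ sum (λ i → rep (t i) k)
  rep-sum k {zero}  t = refl
  rep-sum k {suc n} t = cong (_+_ (rep (t zero) k)) (rep-sum k (t ∘ suc))

  coeffs : ℕ → Series → ℕ → ℤ
  coeffs k f n = rep (f n) k

  coeffs-* : ∀ k f g n → coeffs k (f *ₛ g) n ≡ conv (coeffs k f) (coeffs k g) n
  coeffs-* k f g n = rep-sum k {suc n} λ i → f (toℕ i) *ₗ g (n ℕ.∸ toℕ i)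

  coeffs-constant : ∀ k c n → coeffs k (constant c) n ≡ mono (rep c k) 0 n
  coeffs-constant k c zero    = refl
  coeffs-constant k c (suc n) = refl

  coeffs-constant-* : ∀ k c f n → coeffs k (constant c *ₛ f) n ≡ rep c k * coeffs k f n
  coeffs-constant-* k c f n = begin
    coeffs k (constant c *ₛ f) n              ≡⟨ coeffs-* k (constant c) f n ⟩
    conv (coeffs k (constant c)) (coeffs k f) n
      ≡⟨ sum-cong {suc n} (λ i → cong (_* coeffs k f (n ℕ.∸ toℕ i)) (coeffs-constant k c (toℕ i))) ⟩
    conv (mono (rep c k) 0) (coeffs k f) n    ≡⟨ conv-mono (rep c k) 0 (coeffs k f) n ⟩
    rep c k * coeffs k f n                  ∎
    where
    open ≡-Reasoning
    open MonoidSum ℤ.+-0-commutativeMonoid using () renaming (sum-cong-≗ to sum-cong)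

  HasOrder : Series → ℕ → Set
  HasOrder f n = (∀ i → i ℕ.< n → rep (f i) 1 ≡ + 0 [mod ℓ ]) × ¬ (rep (f n) 1 ≡ + 0 [mod ℓ ])

  order-unique : ∀ {f m n} → HasOrder f m → HasOrder f n → m ≡ n
  order-unique {m = m} {n} (f<m , fₘ) (f<n , fₙ) with ℕ.<-cmp m n
  ... | tri< m<n _ _ = contradiction (f<n m m<n) fₘ
  ... | tri≈ _ m≡n _ = m≡n
  ... | tri> _ _ n<m = contradiction (f<m n n<m) fₙ

  1≢0 : ¬ (+ 1 ≡ + 0 [mod ℓ ])
  1≢0 h = ℕ.>⇒∤ (ℕ.nonTrivial⇒n>1 ℓ {{prime⇒nonTrivial ℓ-prime}}) (∣⇒∣ᵤ (0⇒∣ h))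

  -- Modulo ℓ the distinguished polynomial becomes Tᵈ, so f reduces to Tᵈ u, and the constant term
  -- of a unit is prime to ℓ.
  weierstrass⇒order : ∀ {f d} → WeierstrassForm f 0 d → HasOrder f d
  weierstrass⇒order {f} {d} W = (λ i i<d → mod-trans (f≡ i) (≡⇒mod (shift-< U i<d))) , fd≢0
    where
    open WeierstrassForm W
    open IsDistinguished g-distinguished
    U = coeffs 1 u
    g≡ : ∀ i → coeffs 1 g i ≡ mono (+ 1) d i [mod ℓ ]
    g≡ i with ℕ.<-cmp i d
    ... | tri< i<d i≢d _ = mod-trans (∣ₗ⇒0 (nonLeading i i<d)) (≡⇒mod (sym (mono-≢ (+ 1) (i≢d ∘ sym))))
    ... | tri≈ _ refl _  = mod-trans (mod-ℓ 0 (at monic 1)) (≡⇒mod (sym (mono-≡ (+ 1) i)))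
    ... | tri> _ i≢d d<i = mod-trans (mod-ℓ 0 (at (degree i d<i) 1)) (≡⇒mod (sym (mono-≢ (+ 1) (i≢d ∘ sym))))
    f≡ : ∀ n → rep (f n) 1 ≡ shift d U n [mod ℓ ]
    f≡ n = mod-trans (mod-ℓ 0 (at (factorization n) 1))
      (mod-trans (≡⇒mod (trans (coeffs-constant-* 1 (fromℤ (+ 1)) (g *ₛ u) n)
                   (trans (ℤ.*-identityˡ _) (coeffs-* 1 g u n))))
      (mod-trans (conv-congˡ U n λ i _ → g≡ i)
      (≡⇒mod (trans (conv-mono (+ 1) d U n) (ℤ.*-identityˡ _)))))
    shift-d : shift d U d ≡ U 0
    shift-d = trans (cong (shift d U) (sym (ℕ.+-identityʳ d))) (shift-+ d 0 U)
    fd≢0 : ¬ (rep (f d) 1 ≡ + 0 [mod ℓ ])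
    fd≢0 fd≡0 = 1≢0 (mod-trans
      (mod-sym (mod-trans (≡⇒mod (sym (trans (coeffs-* 1 u (proj₁ u-unit) 0) (ℤ.+-identityʳ _))))
        (mod-ℓ 0 (at (proj₂ u-unit 0) 1))))
      (mod-* (mod-trans (≡⇒mod (sym shift-d)) (mod-trans (mod-sym (f≡ d)) fd≡0)) (mod-refl (rep (proj₁ u-unit 0) 1))))

  weierstrass⇒μ≡0 : ∀ {f μ d n} → WeierstrassForm f μ d → ¬ (rep (f n) 1 ≡ + 0 [mod ℓ ]) → μ ≡ 0
  weierstrass⇒μ≡0 {μ = zero}  W fₙ≢0 = refl
  weierstrass⇒μ≡0 {f} {suc μ} {n = n} W fₙ≢0 = contradiction
    (mod-trans (mod-ℓ 0 (at (factorization n) 1))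
    (mod-trans (≡⇒mod (coeffs-constant-* 1 (fromℤ (+ (ℓ ℕ.^ suc μ))) (g *ₛ u) n))
      (mod-* {b = + 0} (mod-weaken (ℕ.m∣m*n (ℓ ℕ.^ μ)) (∣⇒0 (divides (+ 1) (sym (ℤ.*-identityˡ (+ (ℓ ℕ.^ suc μ))))))) (mod-refl (rep ((g *ₛ u) n) 1)))))
    fₙ≢0
    where open WeierstrassForm W

  -- The factors of f are the limit of a contraction: dividing the low part of
  -- f by an approximation of u modulo ℓᵏ gives the low part of g modulo
  -- ℓᵏ⁺¹, because that part of f vanishes modulo ℓ; comparing the
  -- remaining coefficients then gives u modulo ℓᵏ⁺¹.
  module Preparation (f : Series) (d : ℕ) (order : HasOrder f d)
                     (w : ℤ) (w-inverse : rep (f d) 1 * w ≡ + 1 [mod ℓ ]) where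

    -- One digit more than k: the k-th state is meaningful modulo ℓᵏ, and the step that uses `F k`
    -- raises it to ℓᵏ⁺¹.
    F : ℕ → ℕ → ℤ
    F k = coeffs (suc k) f

    F-small : ∀ k n → n ℕ.< d → F k n ≡ + 0 [mod ℓ ]
    F-small k n n<d = mod-trans (rep-suc (f n) k) (proj₁ order n n<d)

    record State : Set where
      constructor ⟨_,_⟩
      field
        unit    : ℕ → ℤ
        inverse : ℤ

    open State

    low : ℕ → State → ℕ → ℤ
    low k s = quot (F k) (unit s) (inverse s) d

    next : ℕ → State → ℕ → ℤ
    next k s m = F k (d ℕ.+ m) - conv (low k s) (unit s) (d ℕ.+ m)

    -- The inverse of the constant term u₀ is the fixed point of y ↦ w + (1 - u₀ w) y. Since w
    -- inverts u₀ modulo ℓ, the factor 1 - u₀ w is a multiple of ℓ, so this component contracts at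
    -- the same rate as the series.
    step : ℕ → State → State
    step k s = ⟨ next k s , w + (+ 1 - next k s 0 * w) * inverse s ⟩

    state : ℕ → State
    -- Modulo ℓ⁰ = 1 any starting value is correct.
    state zero    = ⟨ (λ _ → + 0) , + 0 ⟩
    state (suc k) = step k (state k)

    infix 4 _~_[_]
    record _~_[_] (s t : State) (m : ℕ) : Set where
      constructor ⟪_,_⟫
      field
        unit~    : ∀ n → unit s n ≡ unit t n [mod m ]
        inverse~ : inverse s ≡ inverse t [mod m ]

    open _~_[_]

    low-small : ∀ k s n → low k s n ≡ + 0 [mod ℓ ]
    low-small k s = quot-small d (F-small k)

    low-cong : ∀ k {s t} → s ~ t [ ℓ ℕ.^ k ] → ∀ n → low (suc k) s n ≡ low k t n [mod ℓ ℕ.^ suc k ]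
    low-cong k ⟪ u~ , y~ ⟫ = quot-contract d (λ n → coherent (f n) (suc k)) (F-small k) u~ y~

    next-cong : ∀ k {s t} → s ~ t [ ℓ ℕ.^ k ] → ∀ m → next (suc k) s m ≡ next k t m [mod ℓ ℕ.^ suc k ]
    next-cong k {t = t} s~t m = mod-- (coherent (f (d ℕ.+ m)) (suc k))
      (conv-contract (low-cong k s~t) (low-small k t) (unit~ s~t) (d ℕ.+ m))

    next-0 : ∀ k s → + 1 - next k s 0 * w ≡ + 0 [mod ℓ ]
    next-0 k s = mod-- (mod-refl (+ 1)) (mod-trans (mod-* next≡ (mod-refl w)) w-inverse)
      where
      next≡ : next k s 0 ≡ rep (f d) 1 [mod ℓ ]
      next≡ = mod-trans (mod-- (rep-suc (f (d ℕ.+ 0)) k) (conv-small (unit s) (low-small k s) (d ℕ.+ 0)))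
        (≡⇒mod (trans (ℤ.+-identityʳ _) (cong (λ m → rep (f m) 1) (ℕ.+-identityʳ d))))

    step-cong : ∀ k {s t} → s ~ t [ ℓ ℕ.^ k ] → step (suc k) s ~ step k t [ ℓ ℕ.^ suc k ]
    step-cong k {s} {t} s~t = ⟪ next-cong k s~t ,
      mod-+ (mod-refl w) (mod-*-contract
        (mod-- (mod-refl (+ 1)) (mod-* (next-cong k s~t 0) (mod-refl w)))
        (next-0 k t) (inverse~ s~t)) ⟫

    state-coherent : ∀ k → state (suc k) ~ state k [ ℓ ℕ.^ k ]
    state-coherent zero    = ⟪ (λ _ → mod-1) , mod-1 ⟫
    state-coherent (suc k) = step-cong k (state-coherent k)

    U : ℕ → ℕ → ℤ
    U k = unit (state k)

    Y : ℕ → ℤ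
    Y k = inverse (state k)

    U-coherent : ∀ k n → U (suc k) n ≡ U k n [mod ℓ ℕ.^ k ]
    U-coherent k = unit~ (state-coherent k)

    Y-coherent : ∀ k → Y (suc k) ≡ Y k [mod ℓ ℕ.^ k ]
    Y-coherent k = inverse~ (state-coherent k)

    ℓ∤w : ¬ + ℓ ∣ℤ w
    ℓ∤w h = 1≢0 (mod-trans (mod-sym w-inverse) (∣⇒0 (rep (f d) 1 ⊙ h)))

    -- By coherence y ≡ w + (1 - u₀ w) y modulo ℓᵏ, that is w (1 - u₀ y) ≡ 0, and w is prime to ℓ.
    U-inverse : ∀ k → U k 0 * Y k ≡ + 1 [mod ℓ ℕ.^ k ]
    U-inverse k = mod-sym (mod (0⇒∣ (∤⇒mod-cancelˡ w k ℓ∤w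
      (collect (U k 0) (Y k) (mod-trans (mod-sym (Y-coherent k))
        (mod-+ (mod-refl w) (mod-* (mod-- (mod-refl (+ 1)) (mod-* (U-coherent k 0) (mod-refl w))) (mod-refl (Y k)))))))))
      where
      collect : ∀ {m} u y → y ≡ w + (+ 1 - u * w) * y [mod m ] →
                w * (+ 1 - u * y) ≡ + 0 [mod m ]
      collect u y (mod h) = ∣⇒0 (by (ℤ.- + 1 ⊙ h) (solve (u ∷ y ∷ w ∷ [])))

    u v g : Series
    u n .rep      k = U k n
    u n .coherent k = U-coherent k n
    -- The quotient 1 / u, whose coefficient n is final after n + 1 stages of the division. Its
    -- coherence is `quot-contract` with a = 1, where smallness holds trivially.
    v n .rep      k = quot (mono (+ 1) 0) (U k) (Y k) (suc n) n
    v n .coherent k = subst (λ m → quot (mono (+ 1) 0) (U (suc k)) (Y (suc k)) (suc n) n ≡ rep (v n) k [mod m ])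
      (ℕ.*-identityˡ (ℓ ℕ.^ k))
      (quot-contract (suc n) (λ _ → mod-refl _) (λ _ _ → mod-1) (U-coherent k) (Y-coherent k) n)
    g n .rep      k = low k (state k) n + mono (+ 1) d n
    g n .coherent k = mod-+ (mod-weaken (^-mono-∣ (ℕ.n≤1+n k)) (low-cong k (state-coherent k) n)) (mod-refl _)

    g-distinguished : IsDistinguished g d
    g-distinguished = record
      { monic      = ≈-by λ k → ≡⇒mod (cong₂ _+_ (quot-≥ (F k) (U k) (Y k) {d} ℕ.≤-refl) (mono-≡ (+ 1) d))
      ; degree     = λ n d<n → ≈-by λ k → ≡⇒mod
          (cong₂ _+_ (quot-≥ (F k) (U k) (Y k) (ℕ.<⇒≤ d<n)) (mono-≢ (+ 1) (ℕ.<⇒≢ d<n)))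
      ; nonLeading = λ n n<d → 0⇒∣ₗ (mod-+ (low-small 1 (state 1) n) (≡⇒mod (mono-≢ (+ 1) (ℕ.>⇒≢ n<d))))
      }

    u-unit : IsUnit u
    u-unit = v , λ n → ≈-by λ k → subst₂ (_≡_[mod ℓ ℕ.^ k ])
      (sym (trans (coeffs-* k u v n) (conv-comm (U k) (coeffs k v) n)))
      (sym (coeffs-constant k 1ₗ n))
      (mod-trans
        (conv-congˡ (U k) n λ i i≤n → ≡⇒mod (sym (quot-stable (mono (+ 1) 0) (U k) (Y k) (s≤s i≤n))))
        (quot-spec (mono (+ 1) 0) (U k) (Y k) (U-inverse k) (ℕ.n<1+n n)))

    -- This is f = (low + Tᵈ) u. Below degree d it is the defining property of the quotient; from
    -- degree d on, the next approximation of u was defined as exactly this remainder, and it agrees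
    -- with the present one modulo ℓᵏ.
    low+shift : ∀ k n → conv (low k (state k)) (U k) n + shift d (U k) n ≡ F k n [mod ℓ ℕ.^ k ]
    low+shift k n with n ℕ.<? d
    ... | yes n<d = mod-trans
      (≡⇒mod (trans (cong (_+_ (conv (low k (state k)) (U k) n)) (shift-< (U k) n<d)) (ℤ.+-identityʳ _)))
      (quot-spec (F k) (U k) (Y k) (U-inverse k) n<d)
    ... | no n≮d = subst (λ n → conv (low k (state k)) (U k) n + shift d (U k) n ≡ F k n [mod ℓ ℕ.^ k ])
      (ℕ.m+[n∸m]≡n (ℕ.≮⇒≥ n≮d)) (high (n ℕ.∸ d))
      where
      restore : ∀ {m} c x y → x - c ≡ y [mod m ] → c + y ≡ x [mod m ]
      restore c x y (mod h) = mod (by (ℤ.- + 1 ⊙ h) (solve (c ∷ x ∷ y ∷ [])))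
      high : ∀ m → conv (low k (state k)) (U k) (d ℕ.+ m) + shift d (U k) (d ℕ.+ m) ≡
                   F k (d ℕ.+ m) [mod ℓ ℕ.^ k ]
      high m = restore _ _ _ (mod-trans (U-coherent k m) (≡⇒mod (sym (shift-+ d m (U k)))))

    weierstrassForm : WeierstrassForm f 0 d
    weierstrassForm = record
      { g = g ; u = u ; g-distinguished = g-distinguished ; u-unit = u-unit
      ; factorization = λ n → ≈-by λ k → mod-sym (mod-trans (≡⇒mod (g*u k n))
          (mod-trans (low+shift k n) (coherent (f n) k)))
      }
      where
      open ≡-Reasoning
      g*u : ∀ k n → coeffs k (constant (fromℤ (+ 1)) *ₛ (g *ₛ u)) n ≡
                    conv (low k (state k)) (U k) n + shift d (U k) n
      g*u k n = begin
        coeffs k (constant (fromℤ (+ 1)) *ₛ (g *ₛ u)) n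
          ≡⟨ coeffs-constant-* k (fromℤ (+ 1)) (g *ₛ u) n ⟩
        + 1 * coeffs k (g *ₛ u) n
          ≡⟨ ℤ.*-identityˡ _ ⟩
        coeffs k (g *ₛ u) n
          ≡⟨ coeffs-* k g u n ⟩
        conv (coeffs k g) (U k) n
          ≡⟨ conv-+ (low k (state k)) (mono (+ 1) d) (U k) n ⟩
        conv (low k (state k)) (U k) n + conv (mono (+ 1) d) (U k) n
          ≡⟨ cong (_+_ (conv (low k (state k)) (U k) n)) (trans (conv-mono (+ 1) d (U k) n) (ℤ.*-identityˡ _)) ⟩
        conv (low k (state k)) (U k) n + shift d (U k) n ∎

-- Arithmetic of 𝔽_ℓ, and -1 as a sum of two squares.

module PrimeField (ℓ : ℕ) (ℓ-prime : Prime ℓ) where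

  open import Data.Integer.Base using (_+_; _*_; _-_; -_)
  open Congruence

  private instance
    ℓ-nonZero : NonZero ℓ
    ℓ-nonZero = prime⇒nonZero ℓ-prime

  infix 4 ℓ∣_

  ℓ∣_ : ℤ → Set
  ℓ∣ x = + ℓ ∣ℤ x

  0-product : ∀ {x y} → ℓ∣ x * y → ℓ∣ x ⊎ ℓ∣ y
  0-product {x} {y} h = Sum.map ∣ᵤ⇒∣ ∣ᵤ⇒∣
    (euclidsLemma ℤ.∣ x ∣ ℤ.∣ y ∣ ℓ-prime (subst (ℓ ∣_) (ℤ.abs-* x y) (∣⇒∣ᵤ h)))

  cancelˡ : ∀ {x y} → ¬ ℓ∣ x → ℓ∣ x * y → ℓ∣ y
  cancelˡ ℓ∤x h with 0-product h
  ... | inj₁ ℓ∣x = contradiction ℓ∣x ℓ∤x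
  ... | inj₂ ℓ∣y = ℓ∣y

  0-square : ∀ {x} → ℓ∣ x * x → ℓ∣ x
  0-square {x} h = Sum.reduce (0-product {x} {x} h)

  ∤-small : ∀ n .{{_ : NonZero n}} → n ℕ.< ℓ → ¬ ℓ∣ + n
  ∤-small n n<ℓ h = ℕ.>⇒∤ n<ℓ (∣⇒∣ᵤ h)

  ∤1 : ¬ ℓ∣ + 1
  ∤1 = ∤-small 1 (ℕ.nonTrivial⇒n>1 ℓ {{prime⇒nonTrivial ℓ-prime}})

  ∤! : ∀ n → n ℕ.< ℓ → ¬ ℓ∣ + (n ℕ.!)
  ∤! zero    _   = ∤1
  ∤! (suc n) n<ℓ = cancel ∘ subst ℓ∣_ (ℤ.pos-* (suc n) (n ℕ.!))
    where
    cancel : ¬ ℓ∣ + suc n * + (n ℕ.!)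
    cancel = ∤! n (ℕ.<-trans (ℕ.n<1+n n) n<ℓ) ∘ cancelˡ (∤-small (suc n) n<ℓ)

  inverse : ∀ x → ¬ ℓ∣ x → ∃[ y ] ℓ∣ x * y - + 1
  inverse x ℓ∤x with x %ℕ ℓ in eq | n%ℕd<d x ℓ
  ... | zero      | _   = contradiction (0⇒∣ (subst (λ r → x ≡ + r [mod ℓ ]) eq (mod-%ℕ x ℓ))) ℓ∤x
  ... | n@(suc _) | n<ℓ with subst (λ r → x ≡ + r [mod ℓ ]) eq (mod-%ℕ x ℓ) | coprime-Bézout (prime⇒coprime ℓ-prime n<ℓ)
  ...   | mod x≡n | Bézout.Identity.+- a b e = - + b , by (- + b ⊙ x≡n ⊕ - + a ⊙ ℓ∣ℓ) (bezout x (+ n) (+ a) (+ b) (+ ℓ) e′)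
    where
    ℓ∣ℓ : ℓ∣ + ℓ
    ℓ∣ℓ = divides (+ 1) (sym (ℤ.*-identityˡ (+ ℓ)))
    e′ : + a * + ℓ ≡ + 1 + + b * + n
    e′ = trans (sym (ℤ.pos-* a ℓ)) (trans (cong +_ (sym e)) (cong (_+_ (+ 1)) (ℤ.pos-* b n)))
    bezout : ∀ x n a b l → a * l ≡ + 1 + b * n → - b * (x - n) + - a * l ≡ x * - b - + 1
    bezout x n a b l h = trans (lemma x n a b l) (trans (cong (λ z → b * n - b * x - z) h) (solve (x ∷ n ∷ b ∷ [])))
      where
      lemma : ∀ x n a b l → - b * (x - n) + - a * l ≡ b * n - b * x - a * l
      lemma = solve-∀
  ...   | mod x≡n | Bézout.Identity.-+ a b e = + b , by (+ b ⊙ x≡n ⊕ + a ⊙ ℓ∣ℓ) (bezout x (+ n) (+ a) (+ b) (+ ℓ) e′)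
    where
    ℓ∣ℓ : ℓ∣ + ℓ
    ℓ∣ℓ = divides (+ 1) (sym (ℤ.*-identityˡ (+ ℓ)))
    e′ : + 1 + + a * + ℓ ≡ + b * + n
    e′ = trans (cong (_+_ (+ 1)) (sym (ℤ.pos-* a ℓ))) (trans (cong +_ e) (ℤ.pos-* b n))
    bezout : ∀ x n a b l → + 1 + a * l ≡ b * n → b * (x - n) + a * l ≡ x * b - + 1
    bezout x n a b l h = trans (lemma x n a b l) (trans (cong (λ z → x * b - + 1 + z - b * n) h) (solve (x ∷ n ∷ b ∷ [])))
      where
      lemma : ∀ x n a b l → b * (x - n) + a * l ≡ x * b - + 1 + (+ 1 + a * l) - b * n
      lemma = solve-∀

  -- Total inverse, with junk value 0 on multiples of ℓ.
  abstract
    inv : ℤ → ℤ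
    inv x with + ℓ ∣? x
    ... | yes _  = + 0
    ... | no ℓ∤x = proj₁ (inverse x ℓ∤x)

    inv-spec : ∀ {x} → ¬ ℓ∣ x → ℓ∣ x * inv x - + 1
    inv-spec {x} ℓ∤x with + ℓ ∣? x
    ... | yes ℓ∣x = contradiction ℓ∣x ℓ∤x
    ... | no ℓ∤x′ = proj₂ (inverse x ℓ∤x′)

  bounded-unique : ∀ {m n} → m ℕ.< ℓ → n ℕ.< ℓ → ℓ∣ + m - + n → m ≡ n
  bounded-unique {m} {n} m<ℓ n<ℓ h with ℤ.∣ + m - + n ∣ in eq | ∣⇒∣ᵤ h | bound
    where
    bound : ℤ.∣ + m - + n ∣ ℕ.< ℓ
    bound = ℕ.≤-<-trans (subst (λ z → ℤ.∣ z ∣ ℕ.≤ m ℕ.⊔ n) (sym (ℤ.m-n≡m⊖n m n)) (ℤ.∣m⊝n∣≤m⊔n m n))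
      (ℕ.⊔-lub m<ℓ n<ℓ)
  ... | zero  | _ | _   = ℤ.+-injective (ℤ.i-j≡0⇒i≡j (+ m) (+ n) (ℤ.∣i∣≡0⇒i≡0 eq))
  ... | suc k | d | k<ℓ = contradiction d (ℕ.>⇒∤ k<ℓ)

  ⟦_⟧ : Fin ℓ → ℤ
  ⟦ a ⟧ = + toℕ a

  ⟦⟧-injective : ∀ {a b} → ℓ∣ ⟦ a ⟧ - ⟦ b ⟧ → a ≡ b
  ⟦⟧-injective {a} {b} h = Fin.toℕ-injective (bounded-unique (Fin.toℕ<n a) (Fin.toℕ<n b) h)

  abstract
    reduce : ℤ → Fin ℓ
    reduce x = fromℕ< (n%ℕd<d x ℓ)

    reduce-≡ : ∀ x → ℓ∣ ⟦ reduce x ⟧ - x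
    reduce-≡ x with mod-sym (mod-%ℕ x ℓ)
    ... | mod h = subst (λ r → ℓ∣ + r - x) (sym (Fin.toℕ-fromℕ< (n%ℕd<d x ℓ))) h

  reduce-unique : ∀ {x a} → ℓ∣ x - ⟦ a ⟧ → reduce x ≡ a
  reduce-unique {x} {a} h = ⟦⟧-injective (by (reduce-≡ x ⊕ h) (lemma ⟦ reduce x ⟧ x ⟦ a ⟧))
    where
    lemma : ∀ r x a → r - x + (x - a) ≡ r - a
    lemma = solve-∀

  reduce-cong : ∀ {x y} → ℓ∣ x - y → reduce x ≡ reduce y
  reduce-cong {x} {y} h = reduce-unique {x} (by (h ⊕ - + 1 ⊙ reduce-≡ y) (lemma ⟦ reduce y ⟧ x y))
    where
    lemma : ∀ r x y → x - y + - + 1 * (r - y) ≡ x - r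
    lemma = solve-∀

  reduce-injective : ∀ x y → reduce x ≡ reduce y → ℓ∣ x - y
  reduce-injective x y eq = by (reduce-≡ y ⊕ - + 1 ⊙ reduce-≡ x)
    (trans (cong (λ r → ⟦ reduce y ⟧ - y + - + 1 * (⟦ r ⟧ - x)) eq) (lemma ⟦ reduce y ⟧ x y))
    where
    lemma : ∀ r x y → r - y + - + 1 * (r - x) ≡ x - y
    lemma = solve-∀

  module SumOfSquares (5≤ℓ : 5 ℕ.≤ ℓ) where

    h : ℕ
    h = ℓ ℕ./ 2

    odd : ℓ ≡ suc (h ℕ.+ h)
    odd with ℓ ℕ.% 2 in eq | ℕ.m%n<n ℓ 2 | ℕ.m≡m%n+[m/n]*n ℓ 2
    ... | 0 | _ | _ = contradiction (prime⇒irreducible ℓ-prime (ℕ.m%n≡0⇒n∣m ℓ 2 eq))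
      λ { (inj₁ ()) ; (inj₂ refl) → contradiction 5≤ℓ (ℕ.<⇒≱ (ℕ.m≤m+n 3 2)) }
    ... | 1 | _ | e = trans e (cong suc (trans (ℕ.*-comm h 2) (cong (h ℕ.+_) (ℕ.+-identityʳ h))))
    ... | suc (suc _) | s≤s (s≤s ()) | _

    -- ℓ divides (x - y)(x + y), and both factors are smaller than ℓ in absolute value; a vanishing
    -- sum forces x = y = 0.
    squares-distinct : ∀ {x y} → x ℕ.≤ h → y ℕ.≤ h → ℓ∣ + x * + x - + y * + y → x ≡ y
    squares-distinct {x} {y} x≤h y≤h d with 0-product {+ x - + y} {+ x + + y} (by d (difference (+ x) (+ y)))
      where
      difference : ∀ x y → x * x - y * y ≡ (x - y) * (x + y)
      difference = solve-∀
    ... | inj₁ x≡y = bounded-unique (≤h⇒<ℓ x≤h) (≤h⇒<ℓ y≤h) x≡y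
      where
      ≤h⇒<ℓ : ∀ {z} → z ℕ.≤ h → z ℕ.< ℓ
      ≤h⇒<ℓ {z} z≤h = subst (z ℕ.<_) (sym odd) (s≤s (ℕ.≤-trans z≤h (ℕ.m≤m+n h h)))
    ... | inj₂ x+y≡0 with x ℕ.+ y in eq | subst (x ℕ.+ y ℕ.<_) (sym odd) (s≤s (ℕ.+-mono-≤ x≤h y≤h))
    ...   | zero  | _   = trans (ℕ.m+n≡0⇒m≡0 x eq) (sym (ℕ.m+n≡0⇒n≡0 x eq))
    ...   | suc k | k<ℓ = contradiction (∣⇒∣ᵤ x+y≡0) (ℕ.>⇒∤ k<ℓ)

    sq : Fin (suc h) → ℤ
    sq x = + toℕ x * + toℕ x

    value : Fin (suc h) ⊎ Fin (suc h) → Fin ℓ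
    value (inj₁ x) = reduce (sq x)
    value (inj₂ y) = reduce (- + 1 - sq y)

    -- The h + 1 squares x² and the h + 1 values −1 − y² cannot all be distinct
    -- modulo ℓ = 2h + 1.
    sum-of-squares : ∃[ u ] ∃[ v ] ℓ∣ u * u + v * v + + 1
    sum-of-squares with pigeonhole ℓ<2+2h (value ∘ splitAt (suc h))
      where
      ℓ<2+2h : ℓ ℕ.< suc h ℕ.+ suc h
      ℓ<2+2h = ℕ.≤-reflexive (cong suc (trans odd (sym (ℕ.+-suc h h))))
    ... | i , j , i<j , fi≡fj = collision (splitAt (suc h) i) (splitAt (suc h) j) distinct fi≡fj
      where
      distinct : splitAt (suc h) i ≢ splitAt (suc h) j
      distinct eq = Fin.<⇒≢ i<j (trans (sym (Fin.join-splitAt (suc h) (suc h) i))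
        (trans (cong (join (suc h) (suc h)) eq) (Fin.join-splitAt (suc h) (suc h) j)))
      ≤h : ∀ (x : Fin (suc h)) → toℕ x ℕ.≤ h
      ≤h x = ℕ.s≤s⁻¹ (Fin.toℕ<n x)
      found : ∀ x y → ℓ∣ x * x - (- + 1 - y * y) → ∃[ u ] ∃[ v ] ℓ∣ u * u + v * v + + 1
      found x y d = x , y , by d (solve (x ∷ y ∷ []))
      collision : ∀ s t → s ≢ t → value s ≡ value t → ∃[ u ] ∃[ v ] ℓ∣ u * u + v * v + + 1
      collision (inj₁ x) (inj₁ y) s≢t eq = contradiction
        (cong inj₁ (Fin.toℕ-injective (squares-distinct (≤h x) (≤h y) (reduce-injective (sq x) (sq y) eq)))) s≢t
      collision (inj₁ x) (inj₂ y) s≢t eq =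
        found (+ toℕ x) (+ toℕ y) (reduce-injective (sq x) (- + 1 - sq y) eq)
      collision (inj₂ x) (inj₁ y) s≢t eq =
        found (+ toℕ y) (+ toℕ x) (reduce-injective (sq y) (- + 1 - sq x) (sym eq))
      collision (inj₂ x) (inj₂ y) s≢t eq = contradiction
        (cong inj₂ (Fin.toℕ-injective (squares-distinct (≤h x) (≤h y)
          (by (reduce-injective (- + 1 - sq y) (- + 1 - sq x) (sym eq)) (lemma (sq x) (sq y)))))) s≢t
        where
        lemma : ∀ x y → - + 1 - y - (- + 1 - x) ≡ x - y
        lemma = solve-∀

-- Fixed points of permutations of order 3.

module OrbitCounting where

  open MonoidSum ℕ.+-0-commutativeMonoid
  open import Data.Nat.Base using (_+_; _*_; _<_)

  indicator : ∀ {P : Set} → Dec P → ℕ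
  indicator d = if does d then 1 else 0

  indicator-yes : ∀ {P : Set} (d : Dec P) → P → indicator d ≡ 1
  indicator-yes (yes _) p = refl
  indicator-yes (no ¬p) p = contradiction p ¬p

  indicator-no : ∀ {P : Set} (d : Dec P) → ¬ P → indicator d ≡ 0
  indicator-no (yes p) ¬p = contradiction p ¬p
  indicator-no (no _)  ¬p = refl

  sum-1 : ∀ n → sum {n} (λ _ → 1) ≡ n
  sum-1 zero    = refl
  sum-1 (suc n) = cong suc (sum-1 n)

  sum-singleton : ∀ {n} (a : Fin n) → sum (λ x → indicator (x Fin.≟ a)) ≡ 1
  sum-singleton {suc n} zero    = cong suc (sum-replicate-zero n)
  sum-singleton {suc n} (suc a) = sum-singleton a

  lt : ℕ → ℕ → ℕ
  lt x y = indicator (x ℕ.<? y)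

  least : ℕ → ℕ → ℕ → ℕ
  least x y z = lt x y * lt x z

  least-cyclic : ∀ x y z → x ≢ y → y ≢ z → z ≢ x →
                 least x y z + least y z x + least z x y ≡ 1
  least-cyclic x y z x≢y y≢z z≢x with ℕ.<-cmp x y | ℕ.<-cmp y z | ℕ.<-cmp z x
  ... | tri≈ _ e _ | _ | _ = contradiction e x≢y
  ... | _ | tri≈ _ e _ | _ = contradiction e y≢z
  ... | _ | _ | tri≈ _ e _ = contradiction e z≢x
  -- Of the eight patterns of strict comparisons, the two cyclic ones are inconsistent; each of the
  -- other six has one least element.
  ... | tri< a _ a′ | tri< b _ b′ | tri< c _ c′ = contradiction (ℕ.<-trans a b) c′
  ... | tri> a _ a′ | tri> b _ b′ | tri> c _ c′ = contradiction (ℕ.<-trans b′ a′) c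
  ... | tri< a _ a′ | tri< b _ b′ | tri> c _ c′
    rewrite indicator-yes (x ℕ.<? y) a | indicator-no (y ℕ.<? x) a′ | indicator-yes (y ℕ.<? z) b
          | indicator-no (z ℕ.<? y) b′ | indicator-no (z ℕ.<? x) c | indicator-yes (x ℕ.<? z) c′ = refl
  ... | tri< a _ a′ | tri> b _ b′ | tri< c _ c′
    rewrite indicator-yes (x ℕ.<? y) a | indicator-no (y ℕ.<? x) a′ | indicator-no (y ℕ.<? z) b
          | indicator-yes (z ℕ.<? y) b′ | indicator-yes (z ℕ.<? x) c | indicator-no (x ℕ.<? z) c′ = refl
  ... | tri< a _ a′ | tri> b _ b′ | tri> c _ c′
    rewrite indicator-yes (x ℕ.<? y) a | indicator-no (y ℕ.<? x) a′ | indicator-no (y ℕ.<? z) b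
          | indicator-yes (z ℕ.<? y) b′ | indicator-no (z ℕ.<? x) c | indicator-yes (x ℕ.<? z) c′ = refl
  ... | tri> a _ a′ | tri< b _ b′ | tri< c _ c′
    rewrite indicator-no (x ℕ.<? y) a | indicator-yes (y ℕ.<? x) a′ | indicator-yes (y ℕ.<? z) b
          | indicator-no (z ℕ.<? y) b′ | indicator-yes (z ℕ.<? x) c = refl
  ... | tri> a _ a′ | tri< b _ b′ | tri> c _ c′
    rewrite indicator-no (x ℕ.<? y) a | indicator-yes (y ℕ.<? x) a′ | indicator-yes (y ℕ.<? z) b
          | indicator-no (z ℕ.<? y) b′ | indicator-no (z ℕ.<? x) c = refl
  ... | tri> a _ a′ | tri> b _ b′ | tri< c _ c′
    rewrite indicator-no (x ℕ.<? y) a | indicator-yes (y ℕ.<? x) a′ | indicator-no (y ℕ.<? z) b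
          | indicator-yes (z ℕ.<? y) b′ | indicator-yes (z ℕ.<? x) c = refl

  module _ {n : ℕ} (σ : Fin n → Fin n) (σ³≡id : ∀ x → σ (σ (σ x)) ≡ x) where

    fixed : Fin n → ℕ
    fixed x = indicator (σ x Fin.≟ x)

    -- Each orbit of length 3 contains exactly one minimal element.
    minimal : Fin n → ℕ
    minimal x = least (toℕ x) (toℕ (σ x)) (toℕ (σ (σ x)))

    minimal-or-fixed : ∀ x → minimal x + minimal (σ x) + minimal (σ (σ x)) + fixed x ≡ 1
    minimal-or-fixed x with σ x Fin.≟ x
    ... | yes σx≡x rewrite σx≡x | σx≡x | σx≡x | indicator-no (toℕ x ℕ.<? toℕ x) (ℕ.<-irrefl refl) = refl
    ... | no  σx≢x rewrite σ³≡id x = trans (ℕ.+-identityʳ _)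
      (least-cyclic (toℕ x) (toℕ (σ x)) (toℕ (σ (σ x)))
        (σx≢x ∘ sym ∘ Fin.toℕ-injective)
        (λ e → σx≢x (sym (trans (sym (σ³≡id x))
          (trans (cong (σ ∘ σ) (Fin.toℕ-injective e)) (cong σ (σ³≡id x))))))
        (λ e → σx≢x (trans (cong σ (sym (Fin.toℕ-injective e))) (σ³≡id x))))

    π : Permutation n n
    π = permutation σ (σ ∘ σ) σ³≡id σ³≡id

    -- Summing `minimal-or-fixed` over all x gives n. Reindexing by σ shows that the three sums of
    -- `minimal` agree, so n is three times the number of orbits of length 3 plus the number of
    -- fixed points.
    orbit-count : n ℕ.% 3 ≡ sum fixed ℕ.% 3
    orbit-count = trans (cong (ℕ._% 3) (sym (begin
      sum fixed + sum minimal * 3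
        ≡⟨ ℕ.+-comm (sum fixed) (sum minimal * 3) ⟩
      sum minimal * 3 + sum fixed
        ≡⟨ cong (_+ sum fixed) (trans (ℕ.*-comm (sum minimal) 3) (triple (sum minimal))) ⟩
      sum minimal + sum minimal + sum minimal + sum fixed
        ≡⟨ cong₂ (λ a b → sum minimal + a + b + sum fixed) invariant (trans invariant invariant²) ⟩
      sum minimal + sum (minimal ∘ σ) + sum (minimal ∘ σ ∘ σ) + sum fixed
        ≡⟨ cong (λ s → s + sum (minimal ∘ σ ∘ σ) + sum fixed) (∑-distrib-+ minimal (minimal ∘ σ)) ⟨
      sum (λ x → minimal x + minimal (σ x)) + sum (minimal ∘ σ ∘ σ) + sum fixed
        ≡⟨ cong (_+ sum fixed) (∑-distrib-+ _ (minimal ∘ σ ∘ σ)) ⟨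
      sum (λ x → minimal x + minimal (σ x) + minimal (σ (σ x))) + sum fixed
        ≡⟨ ∑-distrib-+ _ fixed ⟨
      sum (λ x → minimal x + minimal (σ x) + minimal (σ (σ x)) + fixed x)
        ≡⟨ sum-cong-≗ minimal-or-fixed ⟩
      sum {n} (λ _ → 1)
        ≡⟨ sum-1 n ⟩
      n ∎))) (ℕ.[m+kn]%n≡m%n (sum fixed) (sum minimal) 3)
      where
      open ≡-Reasoning
      invariant : sum minimal ≡ sum (minimal ∘ σ)
      invariant = sum-permute minimal π
      invariant² : sum (minimal ∘ σ) ≡ sum (minimal ∘ σ ∘ σ)
      invariant² = sum-permute (minimal ∘ σ) π
      triple : ∀ m → 3 * m ≡ m + m + m
      triple m = trans (cong (λ z → m + (m + z)) (ℕ.+-identityʳ m)) (sym (ℕ.+-assoc m m m))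

-- Primitive cube roots of unity and the class of ℓ modulo 3.

module CubeRoots (ℓ : ℕ) (ℓ-prime : Prime ℓ) (5≤ℓ : 5 ℕ.≤ ℓ) where

  open import Data.Integer.Base using (_+_; _*_; _-_; -_)
  open Congruence
  open OrbitCounting
  open PrimeField ℓ ℓ-prime
  open MonoidSum ℕ.+-0-commutativeMonoid using (sum; sum-cong-≗; ∑-distrib-+)

  private instance
    ℓ-nonZero : NonZero ℓ
    ℓ-nonZero = prime⇒nonZero ℓ-prime

  -- As ℓ ≠ 3, the roots of x² + x + 1 are the primitive cube roots of unity.
  IsRoot : ℤ → Set
  IsRoot x = ℓ∣ x * x + x + + 1

  ∤2 : ¬ ℓ∣ + 2
  ∤2 = ∤-small 2 (ℕ.≤-trans (ℕ.m≤m+n 3 2) 5≤ℓ)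

  ∤3 : ¬ ℓ∣ + 3
  ∤3 = ∤-small 3 (ℕ.≤-trans (ℕ.m≤m+n 4 1) 5≤ℓ)

  ≢reduce : ∀ {x} c → x ≢ reduce c → ¬ ℓ∣ ⟦ x ⟧ - c
  ≢reduce {x} c x≢c h = x≢c (⟦⟧-injective (by (h ⊕ - + 1 ⊙ reduce-≡ c) (lemma ⟦ x ⟧ c ⟦ reduce c ⟧)))
    where
    lemma : ∀ x c r → x - c + - + 1 * (r - c) ≡ x - r
    lemma = solve-∀

  -- Multiplication by ω has the single fixed point 0, so 3 divides ℓ − 1.
  root⇒ℓ%3≡1 : ∀ {ω} → IsRoot ω → ℓ ℕ.% 3 ≡ 1
  root⇒ℓ%3≡1 {ω} ω-root = trans (orbit-count σ σ³≡id) (cong (ℕ._% 3)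
    (trans (sum-cong-≗ fixed≡) (sum-singleton (reduce (+ 0)))))
    where
    σ : Fin ℓ → Fin ℓ
    σ x = reduce (ω * ⟦ x ⟧)
    σ³≡id : ∀ x → σ (σ (σ x)) ≡ x
    σ³≡id x = ⟦⟧-injective (by
      (reduce-≡ (ω * ⟦ σ (σ x) ⟧) ⊕ ω ⊙ (reduce-≡ (ω * ⟦ σ x ⟧) ⊕ ω ⊙ reduce-≡ (ω * ⟦ x ⟧))
        ⊕ (⟦ x ⟧ * (ω - + 1)) ⊙ ω-root)
      (lemma ω ⟦ x ⟧ ⟦ σ x ⟧ ⟦ σ (σ x) ⟧ ⟦ σ (σ (σ x)) ⟧))
      where
      lemma : ∀ w x y z t →
              t - w * z + w * (z - w * y + w * (y - w * x)) + x * (w - + 1) * (w * w + w + + 1) ≡ t - x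
      lemma = solve-∀
    -- At 1 the polynomial x² + x + 1 takes the value 3, which is prime to ℓ.
    ω≢1 : ¬ ℓ∣ ω - + 1
    ω≢1 h = ∤3 (by (ω-root ⊕ - (ω + + 2) ⊙ h) (solve (ω ∷ [])))
    σ0 : σ (reduce (+ 0)) ≡ reduce (+ 0)
    σ0 = reduce-cong {ω * ⟦ reduce (+ 0) ⟧} {+ 0} (by (ω ⊙ reduce-≡ (+ 0)) (lemma ω ⟦ reduce (+ 0) ⟧))
      where
      lemma : ∀ w r → w * (r - + 0) ≡ w * r - + 0
      lemma = solve-∀
    fixed⇒0 : ∀ x → σ x ≡ x → ℓ∣ ⟦ x ⟧ - + 0
    fixed⇒0 x σx≡x = by (cancelˡ ω≢1 (by (- + 1 ⊙ reduce-≡ (ω * ⟦ x ⟧))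
        (trans (cong (λ r → - + 1 * (⟦ r ⟧ - ω * ⟦ x ⟧)) σx≡x) (lemma ω ⟦ x ⟧)))) (lemma′ ⟦ x ⟧)
      where
      lemma : ∀ w x → - + 1 * (x - w * x) ≡ (w - + 1) * x
      lemma = solve-∀
      lemma′ : ∀ x → x ≡ x - + 0
      lemma′ = solve-∀
    fixed≡ : ∀ x → fixed σ σ³≡id x ≡ indicator (x Fin.≟ reduce (+ 0))
    fixed≡ x with x Fin.≟ reduce (+ 0)
    ... | yes refl = indicator-yes (σ x Fin.≟ x) σ0
    ... | no x≢0   = indicator-no (σ x Fin.≟ x) (≢reduce (+ 0) x≢0 ∘ fixed⇒0 x)

  -- x ↦ 1/(1 − x) has order 3 away from 0 and 1, and its fixed points there
  -- are the negatives of the roots.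
  module Möbius (no-root : ∀ x → ¬ IsRoot x) where

    a₀ a₁ : Fin ℓ
    a₀ = reduce (+ 0)
    a₁ = reduce (+ 1)

    a₀≢a₁ : a₀ ≢ a₁
    a₀≢a₁ e = ∤1 (by (- + 1 ⊙ reduce-injective (+ 0) (+ 1) e) refl)

    -- On the projective line x ↦ 1/(1 - x) cycles 0, 1, ∞. Declaring 0 and 1 fixed instead gives a
    -- permutation of 𝔽_ℓ; in the absence of roots these are its only fixed points, whence ℓ ≡ 2.
    σ : Fin ℓ → Fin ℓ
    σ x with x Fin.≟ a₀ | x Fin.≟ a₁
    ... | no _ | no _ = reduce (inv (+ 1 - ⟦ x ⟧))
    ... | _    | _    = x

    σ-a₀ : ∀ {x} → x ≡ a₀ → σ x ≡ x
    σ-a₀ {x} x≡a₀ with x Fin.≟ a₀ | x Fin.≟ a₁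
    ... | yes _   | _ = refl
    ... | no x≢a₀ | _ = contradiction x≡a₀ x≢a₀

    σ-a₁ : ∀ {x} → x ≡ a₁ → σ x ≡ x
    σ-a₁ {x} x≡a₁ with x Fin.≟ a₀ | x Fin.≟ a₁
    ... | yes _ | _       = refl
    ... | no _  | yes _   = refl
    ... | no _  | no x≢a₁ = contradiction x≡a₁ x≢a₁

    record Regular (x : Fin ℓ) : Set where
      field
        ≢a₀ : x ≢ a₀
        ≢a₁ : x ≢ a₁
      ∤x : ¬ ℓ∣ ⟦ x ⟧
      ∤x h = ≢reduce (+ 0) ≢a₀ (by h (sym (ℤ.+-identityʳ ⟦ x ⟧)))
      ∤1-x : ¬ ℓ∣ + 1 - ⟦ x ⟧
      ∤1-x h = ≢reduce (+ 1) ≢a₁ (by (- + 1 ⊙ h) (lemma ⟦ x ⟧))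
        where
        lemma : ∀ x → - + 1 * (+ 1 - x) ≡ x - + 1
        lemma = solve-∀

    open Regular

    σ-spec : ∀ {x} → Regular x → ℓ∣ ⟦ σ x ⟧ * (+ 1 - ⟦ x ⟧) - + 1
    σ-spec {x} reg with x Fin.≟ a₀ | x Fin.≟ a₁
    ... | yes e | _     = contradiction e (≢a₀ reg)
    ... | no _  | yes e = contradiction e (≢a₁ reg)
    ... | no _  | no _  = by ((+ 1 - ⟦ x ⟧) ⊙ reduce-≡ (inv (+ 1 - ⟦ x ⟧)) ⊕ inv-spec (∤1-x reg))
      (lemma (+ 1 - ⟦ x ⟧) (inv (+ 1 - ⟦ x ⟧)) ⟦ reduce (inv (+ 1 - ⟦ x ⟧)) ⟧)
      where
      lemma : ∀ t i r → t * (r - i) + (t * i - + 1) ≡ r * t - + 1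
      lemma = solve-∀

    σ-regular : ∀ {x} → Regular x → Regular (σ x)
    σ-regular {x} reg = record
      { ≢a₀ = λ e → ∤1 (by ((+ 1 - ⟦ x ⟧) ⊙ at (+ 0) e ⊕ - + 1 ⊙ σ-spec reg) (lemma₀ ⟦ x ⟧ ⟦ σ x ⟧))
      ; ≢a₁ = λ e → ∤x reg (by (- + 1 ⊙ σ-spec reg ⊕ (+ 1 - ⟦ x ⟧) ⊙ at (+ 1) e) (lemma₁ ⟦ x ⟧ ⟦ σ x ⟧))
      }
      where
      at : ∀ {y} c → y ≡ reduce c → ℓ∣ ⟦ y ⟧ - c
      at c refl = reduce-≡ c
      lemma₀ : ∀ x y → (+ 1 - x) * (y - + 0) + - + 1 * (y * (+ 1 - x) - + 1) ≡ + 1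
      lemma₀ = solve-∀
      lemma₁ : ∀ x y → - + 1 * (y * (+ 1 - x) - + 1) + (+ 1 - x) * (y - + 1) ≡ x
      lemma₁ = solve-∀

    -- With y = σ x and z = σ y, the two defining equations yield y (x (1 - z) - 1) ≡ 0. Hence x
    -- solves the equation that determines σ z.
    σ³-regular : ∀ {x} → Regular x → σ (σ (σ x)) ≡ x
    σ³-regular {x} reg = ⟦⟧-injective (cancelˡ (∤1-x reg″) (by (σ-spec reg″ ⊕ - + 1 ⊙ xz)
      (lemma₂ ⟦ x ⟧ ⟦ σ (σ x) ⟧ ⟦ σ (σ (σ x)) ⟧)))
      where
      reg′ = σ-regular reg
      reg″ = σ-regular reg′
      xz : ℓ∣ ⟦ x ⟧ * (+ 1 - ⟦ σ (σ x) ⟧) - + 1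
      xz = cancelˡ (∤x reg′) (by (σ-spec reg′ ⊕ (⟦ σ (σ x) ⟧ - + 1) ⊙ σ-spec reg)
        (lemma₁ ⟦ x ⟧ ⟦ σ x ⟧ ⟦ σ (σ x) ⟧))
        where
        lemma₁ : ∀ x y z → z * (+ 1 - y) - + 1 + (z - + 1) * (y * (+ 1 - x) - + 1) ≡ y * (x * (+ 1 - z) - + 1)
        lemma₁ = solve-∀
      lemma₂ : ∀ x z w → w * (+ 1 - z) - + 1 + - + 1 * (x * (+ 1 - z) - + 1) ≡ (+ 1 - z) * (w - x)
      lemma₂ = solve-∀

    σ³≡id : ∀ x → σ (σ (σ x)) ≡ x
    σ³≡id x = go (x Fin.≟ a₀) (x Fin.≟ a₁)
      where
      σ-fixed : σ x ≡ x → σ (σ (σ x)) ≡ x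
      σ-fixed e = trans (cong (σ ∘ σ) e) (trans (cong σ e) e)
      go : Dec (x ≡ a₀) → Dec (x ≡ a₁) → σ (σ (σ x)) ≡ x
      go (yes e) _       = σ-fixed (σ-a₀ e)
      go (no _)  (yes e) = σ-fixed (σ-a₁ e)
      go (no n₀) (no n₁) = σ³-regular record { ≢a₀ = n₀ ; ≢a₁ = n₁ }

    no-fixed : ∀ {x} → Regular x → σ x ≢ x
    no-fixed {x} reg e = no-root (- ⟦ x ⟧) (by
      (- + 1 ⊙ subst (λ y → ℓ∣ ⟦ y ⟧ * (+ 1 - ⟦ x ⟧) - + 1) e (σ-spec reg)) (lemma ⟦ x ⟧))
      where
      lemma : ∀ x → - + 1 * (x * (+ 1 - x) - + 1) ≡ - x * - x + - x + + 1
      lemma = solve-∀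

    fixed≡ : ∀ x → fixed σ σ³≡id x ≡ indicator (x Fin.≟ a₀) ℕ.+ indicator (x Fin.≟ a₁)
    fixed≡ x = go (x Fin.≟ a₀) (x Fin.≟ a₁)
      where
      go : (d₀ : Dec (x ≡ a₀)) (d₁ : Dec (x ≡ a₁)) → fixed σ σ³≡id x ≡ indicator d₀ ℕ.+ indicator d₁
      go (yes e) (yes e′) = contradiction (trans (sym e) e′) a₀≢a₁
      go (yes e) (no _)   = indicator-yes (σ x Fin.≟ x) (σ-a₀ e)
      go (no _)  (yes e)  = indicator-yes (σ x Fin.≟ x) (σ-a₁ e)
      go (no n₀) (no n₁)  = indicator-no (σ x Fin.≟ x) (no-fixed record { ≢a₀ = n₀ ; ≢a₁ = n₁ })

    ℓ%3≡2 : ℓ ℕ.% 3 ≡ 2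
    ℓ%3≡2 = trans (orbit-count σ σ³≡id) (cong (ℕ._% 3) (trans (sum-cong-≗ fixed≡)
      (trans (∑-distrib-+ (λ x → indicator (x Fin.≟ a₀)) _)
        (cong₂ ℕ._+_ (sum-singleton a₀) (sum-singleton a₁)))))

  ℓ%3≡1⇒root : ℓ ℕ.% 3 ≡ 1 → ∃[ ω ] IsRoot ω
  ℓ%3≡1⇒root ℓ%3≡1 with any? (λ x → + ℓ ∣? ⟦ x ⟧ * ⟦ x ⟧ + ⟦ x ⟧ + + 1)
  ... | yes (x , root) = ⟦ x ⟧ , root
  ... | no ∄root = contradiction (trans (sym ℓ%3≡1) (Möbius.ℓ%3≡2 λ x root → ∄root (reduce x , root′ x root))) λ ()
    where
    root′ : ∀ x → IsRoot x → IsRoot ⟦ reduce x ⟧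
    root′ x root = by (root ⊕ (⟦ reduce x ⟧ + x + + 1) ⊙ reduce-≡ x) (lemma x ⟦ reduce x ⟧)
      where
      lemma : ∀ x r → x * x + x + + 1 + (r + x + + 1) * (r - x) ≡ r * r + r + + 1
      lemma = solve-∀

-- Cardinalities of lists without repetition.

module FiniteSets where

  open import Data.Nat.Base using (_+_; _*_; _≤_)

  length-cartesianProduct : ∀ {A B : Set} (xs : List A) (ys : List B) →
                            length (cartesianProduct xs ys) ≡ length xs * length ys
  length-cartesianProduct []       ys = refl
  length-cartesianProduct (x ∷ xs) ys = trans (List.length-++ (map (x ,_) ys))
    (cong₂ _+_ (List.length-map (x ,_) ys) (length-cartesianProduct xs ys))

  module _ {A : Set} where

    Unique-⊆⇒length≤ : ∀ {xs ys : List A} → Unique xs → xs ⊆ ys → length xs ≤ length ys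
    Unique-⊆⇒length≤ {xs} {ys} unique xs⊆ys = Fin.injective⇒≤ {f = position} λ {i} {j} eq →
      lookup-injective unique (begin
        lookup xs i             ≡⟨ lookup-index (xs⊆ys (∈-lookup i)) ⟩
        lookup ys (position i)  ≡⟨ cong (lookup ys) eq ⟩
        lookup ys (position j)  ≡⟨ lookup-index (xs⊆ys (∈-lookup j)) ⟨
        lookup xs j             ∎)
      where
      open ≡-Reasoning
      position : Fin (length xs) → Fin (length ys)
      position i = index (xs⊆ys (∈-lookup i))
      lookup-injective : ∀ {xs} → Unique xs → ∀ {i j} → lookup xs i ≡ lookup xs j → i ≡ j
      lookup-injective (_ ∷ _)  {zero}  {zero}  eq = refl
      lookup-injective (x∉ ∷ _) {zero}  {suc j} eq = contradiction eq (All.lookup x∉ (∈-lookup j))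
      lookup-injective (x∉ ∷ _) {suc i} {zero}  eq = contradiction (sym eq) (All.lookup x∉ (∈-lookup i))
      lookup-injective (_ ∷ u)  {suc i} {suc j} eq = cong suc (lookup-injective u eq)

  module Difference {A : Set} (_≟_ : DecidableEquality A) where

    open import Data.List.Membership.DecPropositional _≟_ using (_∈?_; _∉?_)

    infixl 6 _∖_

    _∖_ : List A → List A → List A
    xs ∖ ys = filter (_∉? ys) xs

    ∈-∖⁺ : ∀ {x xs ys} → x ∈ xs → ¬ x ∈ ys → x ∈ xs ∖ ys
    ∈-∖⁺ {ys = ys} = ∈-filter⁺ (_∉? ys)

    ∈-∖⁻ : ∀ {x} xs ys → x ∈ xs ∖ ys → x ∈ xs × ¬ x ∈ ys
    ∈-∖⁻ xs ys = ∈-filter⁻ (_∉? ys) {xs = xs}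

    ∖-unique : ∀ {xs} ys → Unique xs → Unique (xs ∖ ys)
    ∖-unique ys = Unique.filter⁺ (_∉? ys)

    length-∖ : ∀ {xs ys} → Unique xs → Unique ys → ys ⊆ xs → length ys + length (xs ∖ ys) ≡ length xs
    length-∖ {xs} {ys} u v ys⊆xs = trans (sym (List.length-++ ys)) (ℕ.≤-antisym
      (Unique-⊆⇒length≤ (Unique.++⁺ v (∖-unique ys u) λ (x∈ys , x∈) → proj₂ (∈-∖⁻ xs ys x∈) x∈ys)
        (λ x∈ → Sum.[ ys⊆xs , proj₁ ∘ ∈-∖⁻ xs ys ] (∈-++⁻ ys x∈)))
      (Unique-⊆⇒length≤ u split))
      where
      split : xs ⊆ ys ++ (xs ∖ ys)
      split {x} x∈xs with x ∈? ys
      ... | yes x∈ys = ∈-++⁺ˡ x∈ys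
      ... | no  x∉ys = ∈-++⁺ʳ ys (∈-∖⁺ x∈xs x∉ys)

-- Rational numbers as explicit fractions.

module Fractions where

  open import Data.Rational.Base using (_+_; _*_; _-_; -_; _/_)

  /-cross : ∀ a b d e .{{_ : NonZero d}} .{{_ : NonZero e}} → a ℤ.* + e ≡ b ℤ.* + d → a / d ≡ b / e
  /-cross a b (suc d) (suc e) eq = ℚ.fromℚᵘ-cong {mkℚᵘ a d} {mkℚᵘ b e} (*≡* eq)

  toℚᵘ-/ : ∀ a d .{{_ : NonZero d}} → toℚᵘ (a / d) ≃ a ℚᵘ./ d
  toℚᵘ-/ a (suc d) = ℚ.toℚᵘ-fromℚᵘ (mkℚᵘ a d)

  /-+ : ∀ a b d .{{_ : NonZero d}} → a / d + b / d ≡ (a ℤ.+ b) / d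
  /-+ a b d@(suc _) = ℚ.toℚᵘ-injective (begin
    toℚᵘ (a / d + b / d)              ≈⟨ ℚ.toℚᵘ-homo-+ (a / d) (b / d) ⟩
    toℚᵘ (a / d) ℚᵘ.+ toℚᵘ (b / d)    ≈⟨ ℚᵘ.+-cong (toℚᵘ-/ a d) (toℚᵘ-/ b d) ⟩
    (a ℚᵘ./ d) ℚᵘ.+ (b ℚᵘ./ d)        ≈⟨ *≡* (lemma a b (+ d)) ⟩
    (a ℤ.+ b) ℚᵘ./ d                  ≈⟨ toℚᵘ-/ (a ℤ.+ b) d ⟨
    toℚᵘ ((a ℤ.+ b) / d)              ∎)
    where
    open ℚᵘ.≃-Reasoning
    lemma : ∀ a b d → (a ℤ.* d ℤ.+ b ℤ.* d) ℤ.* d ≡ (a ℤ.+ b) ℤ.* (d ℤ.* d)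
    lemma = solve-∀

  -- Shaped for (ℓ³ - 1)/ℓ³ · k/(1 + ℓ + ℓ²), where the second denominator cancels against the first
  -- numerator and ℓ³ is kept.
  /-* : ∀ a b d e n .{{_ : NonZero d}} .{{_ : NonZero e}} →
        a ℤ.* b ≡ n ℤ.* + e → (a / d) * (b / e) ≡ n / d
  /-* a b d@(suc _) e@(suc _) n eq = ℚ.toℚᵘ-injective (begin
    toℚᵘ ((a / d) * (b / e))          ≈⟨ ℚ.toℚᵘ-homo-* (a / d) (b / e) ⟩
    toℚᵘ (a / d) ℚᵘ.* toℚᵘ (b / e)    ≈⟨ ℚᵘ.*-cong (toℚᵘ-/ a d) (toℚᵘ-/ b e) ⟩
    (a ℚᵘ./ d) ℚᵘ.* (b ℚᵘ./ e)        ≈⟨ *≡* (trans (cong (ℤ._* + d) eq) (lemma n (+ d) (+ e))) ⟩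
    n ℚᵘ./ d                          ≈⟨ toℚᵘ-/ n d ⟨
    toℚᵘ (n / d)                      ∎)
    where
    open ℚᵘ.≃-Reasoning
    lemma : ∀ n d e → n ℤ.* e ℤ.* d ≡ n ℤ.* (d ℤ.* e)
    lemma = solve-∀

  d/d≡1 : ∀ d .{{_ : NonZero d}} → + d / d ≡ 1ℚ
  d/d≡1 d = /-cross (+ d) (+ 1) d 1 (ℤ.*-comm (+ d) (+ 1))

  0≤n/d : ∀ n d .{{_ : NonZero d}} → 0ℚ ℚ.≤ + n / d
  0≤n/d n d = ℚ.nonNegative⁻¹ (+ n / d) {{ℚ.normalize-nonNeg n d}}

  1-1/d : ∀ d .{{_ : NonZero d}} → 1ℚ - + 1 / d ≡ (+ d ℤ.- + 1) / d
  1-1/d d = trans (cong (_- + 1 / d) (sym (d/d≡1 d))) (/-+ (+ d) (ℤ.- + 1) d)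

  1-complement : ∀ p q → p + q ≡ 1ℚ → 1ℚ - p ≡ q
  1-complement p q eq = begin
    1ℚ - p              ≡⟨ cong (_- p) eq ⟨
    p + q - p           ≡⟨ cong (_- p) (ℚ.+-comm p q) ⟩
    q + p - p           ≡⟨ ℚ.+-assoc q p (- p) ⟩
    q + (p - p)         ≡⟨ cong (_+_ q) (ℚ.+-inverseʳ p) ⟩
    q + 0ℚ              ≡⟨ ℚ.+-identityʳ q ⟩
    q                   ∎
    where open ≡-Reasoning

-- Measure of unions of residue classes modulo ℓ.

module ResidueClasses (ℓ : ℕ) (ℓ-prime : Prime ℓ) where

  open Congruence
  open FiniteSets
  open Fractions
  open PrimeField ℓ ℓ-prime
  open AdicIntegers ℓ ℓ-prime using (ℓ^1≡ℓ; 0⇒∣ₗ)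
  open Adic ℓ ℓ-prime

  private instance
    ℓ-nonZero : NonZero ℓ
    ℓ-nonZero = prime⇒nonZero ℓ-prime
    ℓ³-nonZero : NonZero (ℓ ℕ.^ 3)
    ℓ³-nonZero = ℕ.m^n≢0 ℓ 3

  Triple : Set
  Triple = Fin ℓ × Fin ℓ × Fin ℓ

  _≟₃_ : DecidableEquality Triple
  _≟₃_ = ≡-dec Fin._≟_ (≡-dec Fin._≟_ Fin._≟_)

  open Difference _≟₃_ public

  pairs : List (Fin ℓ × Fin ℓ)
  pairs = cartesianProduct (allFin ℓ) (allFin ℓ)

  triples : List Triple
  triples = cartesianProduct (allFin ℓ) pairs

  pairs-unique : Unique pairs
  pairs-unique = Unique.cartesianProduct⁺ (Unique.allFin⁺ ℓ) (Unique.allFin⁺ ℓ)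

  triples-unique : Unique triples
  triples-unique = Unique.cartesianProduct⁺ (Unique.allFin⁺ ℓ) pairs-unique

  ∈-pairs : ∀ p → p ∈ pairs
  ∈-pairs (a , b) = ∈-cartesianProduct⁺ (∈-allFin a) (∈-allFin b)

  ∈-triples : ∀ t → t ∈ triples
  ∈-triples (a , p) = ∈-cartesianProduct⁺ (∈-allFin a) (∈-pairs p)

  length-allFin : length (allFin ℓ) ≡ ℓ
  length-allFin = List.length-tabulate {n = ℓ} (λ i → i)

  length-pairs : length pairs ≡ ℓ ℕ.* ℓ
  length-pairs = trans (length-cartesianProduct (allFin ℓ) (allFin ℓ)) (cong₂ ℕ._*_ length-allFin length-allFin)

  length-triples : length triples ≡ ℓ ℕ.^ 3
  length-triples = begin
    length triples       ≡⟨ length-cartesianProduct (allFin ℓ) pairs ⟩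
    length (allFin ℓ) ℕ.* length pairs ≡⟨ cong₂ ℕ._*_ length-allFin length-pairs ⟩
    ℓ ℕ.* (ℓ ℕ.* ℓ)      ≡⟨ cong (λ m → ℓ ℕ.* (ℓ ℕ.* m)) ℓ^1≡ℓ ⟨
    ℓ ℕ.^ 3              ∎
    where open ≡-Reasoning

  digit : ℤₗ → Fin ℓ
  digit x = reduce (rep x 1)

  residues : (Fin 3 → ℤₗ) → Triple
  residues α = digit (α zero) , digit (α (suc zero)) , digit (α (suc (suc zero)))

  ball : Triple → Ball 3
  ball (a , b , c) .Ball.level = 1
  ball (a , b , c) .Ball.centre zero             = fromℤ ⟦ a ⟧
  ball (a , b , c) .Ball.centre (suc zero)       = fromℤ ⟦ b ⟧
  ball (a , b , c) .Ball.centre (suc (suc zero)) = fromℤ ⟦ c ⟧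

  ∈-ball : ∀ α → α ∈ᵇ just (ball (residues α))
  ∈-ball α j = subst (λ m → fromℤ (+ m) ∣ₗ (α j - Ball.centre (ball (residues α)) j)) (sym ℓ^1≡ℓ) (near j)
    where
    close : ∀ x → fromℤ (+ ℓ) ∣ₗ (x - fromℤ ⟦ digit x ⟧)
    close x with mod-sym {ℓ} {⟦ digit x ⟧} {rep x 1} (mod (reduce-≡ (rep x 1)))
    ... | mod h = 0⇒∣ₗ (∣⇒0 {ℓ} {rep x 1 ℤ.- ⟦ digit x ⟧} h)
    near : ∀ j → fromℤ (+ ℓ) ∣ₗ (α j - Ball.centre (ball (residues α)) j)
    near zero             = close (α zero)
    near (suc zero)       = close (α (suc zero))
    near (suc (suc zero)) = close (α (suc (suc zero)))

  balls : List Triple → ℕ → Maybe (Ball 3)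
  balls []       i       = nothing
  balls (t ∷ ts) zero    = just (ball t)
  balls (t ∷ ts) (suc i) = balls ts i

  ∈-balls : ∀ {α ts} → residues α ∈ ts → ∃[ i ] α ∈ᵇ balls ts i
  ∈-balls {α} (here refl) = zero , ∈-ball α
  ∈-balls (there t∈ts)    with ∈-balls t∈ts
  ... | i , α∈B = suc i , α∈B

  totalVolume-suc : ∀ {t} (U : ℕ → Maybe (Ball t)) N →
                    totalVolume U (suc N) ≡ volume (U 0) ℚ.+ totalVolume (U ∘ suc) N
  totalVolume-suc U zero    = ℚ.+-comm 0ℚ (volume (U 0))
  totalVolume-suc U (suc N) = trans (cong (ℚ._+ volume (U (suc N))) (totalVolume-suc U N))
    (ℚ.+-assoc (volume (U 0)) (totalVolume (U ∘ suc) N) (volume (U (suc N))))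

  density : ℕ → ℚ
  density n = + n ℚ./ (ℓ ℕ.^ 3)

  totalVolume-balls : ∀ ts N → totalVolume (balls ts) N ℚ.≤ density (length ts)
  totalVolume-balls ts       zero    = 0≤n/d (length ts) (ℓ ℕ.^ 3)
  totalVolume-balls []       (suc N) = ℚ.≤-trans (ℚ.≤-reflexive (ℚ.+-identityʳ _)) (totalVolume-balls [] N)
  totalVolume-balls (t ∷ ts) (suc N) = begin
    totalVolume (balls (t ∷ ts)) (suc N)          ≡⟨ totalVolume-suc (balls (t ∷ ts)) N ⟩
    density 1 ℚ.+ totalVolume (balls ts) N        ≤⟨ ℚ.+-monoʳ-≤ (density 1) (totalVolume-balls ts N) ⟩
    density 1 ℚ.+ density (length ts)             ≡⟨ /-+ (+ 1) (+ length ts) (ℓ ℕ.^ 3) ⟩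
    density (suc (length ts))                     ∎
    where open ℚ.≤-Reasoning

  outerMeasure≤ : ∀ {S : Pred (Fin 3 → ℤₗ) 0ℓ} ts → (∀ α → S α → residues α ∈ ts) →
                  OuterMeasure≤ S (density (length ts))
  outerMeasure≤ ts covers ε 0<ε = balls ts , (λ α Sα → ∈-balls (covers α Sα)) , λ N → begin
    totalVolume (balls ts) N        ≤⟨ totalVolume-balls ts N ⟩
    density (length ts)             ≡⟨ ℚ.+-identityʳ _ ⟨
    density (length ts) ℚ.+ 0ℚ      ≤⟨ ℚ.+-monoʳ-≤ (density (length ts)) (ℚ.<⇒≤ 0<ε) ⟩
    density (length ts) ℚ.+ ε       ∎
    where open ℚ.≤-Reasoning

  hasMeasure : ∀ {S : Pred (Fin 3 → ℤₗ) 0ℓ} ts → Unique ts →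
               (∀ α → S α → residues α ∈ ts) → (∀ α → residues α ∈ ts → S α) →
               HasMeasure S (density (length ts))
  hasMeasure {S} ts unique S⊆ts ts⊆S = outerMeasure≤ ts S⊆ts ,
    subst (OuterMeasure≤ (∁ S)) (sym (1-complement (density (length ts)) (density (length (triples ∖ ts))) total))
      (outerMeasure≤ (triples ∖ ts) λ α ¬Sα → ∈-∖⁺ (∈-triples (residues α)) (¬Sα ∘ ts⊆S α))
    where
    open ≡-Reasoning
    total : density (length ts) ℚ.+ density (length (triples ∖ ts)) ≡ 1ℚ
    total = begin
      density (length ts) ℚ.+ density (length (triples ∖ ts))
        ≡⟨ /-+ (+ length ts) (+ length (triples ∖ ts)) (ℓ ℕ.^ 3) ⟩
      density (length ts ℕ.+ length (triples ∖ ts))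
        ≡⟨ cong density (trans (length-∖ triples-unique unique (λ _ → ∈-triples _)) length-triples) ⟩
      density (ℓ ℕ.^ 3)
        ≡⟨ d/d≡1 (ℓ ℕ.^ 3) ⟩
      1ℚ ∎

  -- ℓ³ - 1 = (ℓ - 1)(1 + ℓ + ℓ²), so (1 - ℓ⁻³) · k/(1 + ℓ + ℓ²) is the measure of k (ℓ - 1) classes
  -- out of ℓ³. In the applications k is a number of projective points, each a line with ℓ - 1
  -- nonzero vectors.
  probability : ∀ {μ₀ λ₀} k ts → Unique ts →
                (∀ α → Admissible α × HasInvariants α μ₀ λ₀ → residues α ∈ ts) →
                (∀ α → residues α ∈ ts → Admissible α × HasInvariants α μ₀ λ₀) →
                + length ts ≡ k ℤ.* (+ ℓ ℤ.- + 1) →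
                Prob≡ 3 μ₀ λ₀ (k ℚ./ (1 ℕ.+ ℓ ℕ.+ ℓ ℕ.^ 2))
  probability k ts unique S⊆ts ts⊆S size = subst (HasMeasure _) (sym value) (hasMeasure ts unique S⊆ts ts⊆S)
    where
    open ≡-Reasoning
    e = 1 ℕ.+ ℓ ℕ.+ ℓ ℕ.^ 2
    value : (1ℚ ℚ.- ℓ^- 3) ℚ.* (k ℚ./ e) ≡ density (length ts)
    value = trans (cong (ℚ._* (k ℚ./ e)) (1-1/d (ℓ ℕ.^ 3))) (/-* (+ (ℓ ℕ.^ 3) ℤ.- + 1) k (ℓ ℕ.^ 3) e (+ length ts) (begin
      (+ (ℓ ℕ.^ 3) ℤ.- + 1) ℤ.* k            ≡⟨ cong (λ z → (z ℤ.- + 1) ℤ.* k) ℓ³ ⟩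
      (+ ℓ ℤ.* (+ ℓ ℤ.* + ℓ) ℤ.- + 1) ℤ.* k  ≡⟨ lemma k (+ ℓ) ⟩
      k ℤ.* (+ ℓ ℤ.- + 1) ℤ.* (+ 1 ℤ.+ + ℓ ℤ.+ + ℓ ℤ.* + ℓ) ≡⟨ cong₂ ℤ._*_ size (cong (λ z → + 1 ℤ.+ + ℓ ℤ.+ z) ℓ²) ⟨
      + length ts ℤ.* + e                    ∎))
      where
      ℓ² : + (ℓ ℕ.^ 2) ≡ + ℓ ℤ.* + ℓ
      ℓ² = trans (ℤ.pos-* ℓ (ℓ ℕ.^ 1)) (cong (λ m → + ℓ ℤ.* + m) ℓ^1≡ℓ)
      ℓ³ : + (ℓ ℕ.^ 3) ≡ + ℓ ℤ.* (+ ℓ ℤ.* + ℓ)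
      ℓ³ = trans (ℤ.pos-* ℓ (ℓ ℕ.^ 2)) (cong (ℤ._*_ (+ ℓ)) ℓ²)
      lemma : ∀ k l → (l ℤ.* (l ℤ.* l) ℤ.- + 1) ℤ.* k ≡ k ℤ.* (l ℤ.- + 1) ℤ.* (+ 1 ℤ.+ l ℤ.+ l ℤ.* l)
      lemma = solve-∀

-- The first coefficients of the characteristic series modulo ℓ.

module Coefficients (ℓ : ℕ) (ℓ-prime : Prime ℓ) where

  open import Data.Integer.Base using (_+_; _*_; _-_; -_)
  open Congruence
  open PrimeField ℓ ℓ-prime
  open AdicIntegers ℓ ℓ-prime
  open ResidueClasses ℓ ℓ-prime using (Triple; digit; residues)
  open Adic ℓ ℓ-prime hiding (_+_; _*_; _-_) renaming (-_ to -ₗ_)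

  ℤ³ : Set
  ℤ³ = ℤ × ℤ × ℤ

  coords : Triple → ℤ³
  coords (a , b , c) = ⟦ a ⟧ , ⟦ b ⟧ , ⟦ c ⟧

  p₂ p₄ p₆ : ℤ³ → ℤ
  p₂ (a , b , c) = a * a + b * b + c * c
  p₄ (a , b , c) = a * a * (a * a) + b * b * (b * b) + c * c * (c * c)
  p₆ (a , b , c) = a * a * (a * a) * (a * a) + b * b * (b * b) * (b * b) + c * c * (c * c) * (c * c)

  -- This is n! times the coefficient of Tⁿ in (1 + T)ˣ + (1 + T)⁻ˣ. Clearing the denominator makes
  -- it an integer polynomial in x, and its symmetry makes it a polynomial in x².
  fallingPair : ℤ → ℕ → ℤ
  fallingPair x n = fallingℤ x n + fallingℤ (- x) n

  n!*binom : ∀ b n {x} → rep b 1 ≡ x [mod ℓ ] → ℓ∣ + (n ℕ.!) * rep (binom b n) 1 - fallingℤ x n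
  n!*binom b n b≡x = divisible (mod-trans (mod-ℓ 0 (at (binom-spec b n) 1))
    (mod-trans (≡⇒mod (rep-falling n)) (mod-fallingℤ n b≡x)))
    where
    rep-falling : ∀ n → rep (falling b n) 1 ≡ fallingℤ (rep b 1) n
    rep-falling zero    = refl
    rep-falling (suc n) = cong (_* (rep b 1 - + n)) (rep-falling n)

  term : ℤₗ → ℕ → ℤ
  term b n = rep (constant (fromℤ (+ 2)) n) 1 + - rep (binom b n) 1 + - rep (binom (-ₗ b) n) 1

  n!*term : ∀ b n → ℓ∣ + (n ℕ.!) * term b n
                      - (+ (n ℕ.!) * rep (constant (fromℤ (+ 2)) n) 1 - fallingPair ⟦ digit b ⟧ n)
  n!*term b n = by (- + 1 ⊙ n!*binom b n b≡ ⊕ - + 1 ⊙ n!*binom (-ₗ b) n (mod-neg b≡))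
    (lemma (+ (n ℕ.!)) (rep (constant (fromℤ (+ 2)) n) 1) (rep (binom b n) 1) (rep (binom (-ₗ b) n) 1)
      (fallingℤ ⟦ digit b ⟧ n) (fallingℤ (- ⟦ digit b ⟧) n))
    where
    b≡ : rep b 1 ≡ ⟦ digit b ⟧ [mod ℓ ]
    b≡ = mod-sym (mod (reduce-≡ (rep b 1)))
    lemma : ∀ n c x y f g → - + 1 * (n * x - f) + - + 1 * (n * y - g) ≡
                            n * (c + - x + - y) - (n * c - (f + g))
    lemma = solve-∀

  f : (Fin 3 → ℤₗ) → ℕ → ℤ
  f α n = rep (charSeries α n) 1

  module _ (α : Fin 3 → ℤₗ) where

    t = coords (residues α)
    x₀ = proj₁ t
    x₁ = proj₁ (proj₂ t)
    x₂ = proj₂ (proj₂ t)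

    n!*coefficient : ∀ n {q} →
      (+ (n ℕ.!) * rep (constant (fromℤ (+ 2)) n) 1 - fallingPair x₀ n) +
      (+ (n ℕ.!) * rep (constant (fromℤ (+ 2)) n) 1 - fallingPair x₁ n) +
      (+ (n ℕ.!) * rep (constant (fromℤ (+ 2)) n) 1 - fallingPair x₂ n) ≡ q →
      ℓ∣ + (n ℕ.!) * f α n - q
    n!*coefficient n eq = by (n!*term (α zero) n ⊕ n!*term (α (suc zero)) n ⊕ n!*term (α (suc (suc zero))) n)
      (trans (lemma (+ (n ℕ.!)) (term (α zero) n) (term (α (suc zero)) n) (term (α (suc (suc zero))) n) _ _ _)
        (cong (_-_ (+ (n ℕ.!) * f α n)) eq))
      where
      lemma : ∀ n x y z a b c → n * x - a + (n * y - b) + (n * z - c) ≡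
                                n * (x + (y + (z + + 0))) - (a + b + c)
      lemma = solve-∀

    coefficient₀ : ℓ∣ + 1 * f α 0 - + 0
    coefficient₀ = n!*coefficient 0 refl

    coefficient₁ : ℓ∣ + 1 * f α 1 - + 0
    coefficient₁ = n!*coefficient 1 (cong₂ _+_ (cong₂ _+_ (even x₀) (even x₁)) (even x₂))
      where
      even : ∀ x → + 1 * + 0 - (+ 1 * (x - + 0) + + 1 * (- x - + 0)) ≡ + 0
      even = solve-∀

    -- Here and below, the odd powers of x cancel in `fallingPair`, and the constants are -2 times
    -- the signed Stirling numbers of the first kind s(n, 2), s(n, 4), s(n, 6).
    coefficient₂ : ℓ∣ + 2 * f α 2 - - + 2 * p₂ t
    coefficient₂ = n!*coefficient 2 (trans (cong₂ _+_ (cong₂ _+_ (even x₀) (even x₁)) (even x₂)) (collect x₀ x₁ x₂))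
      where
      even : ∀ x → + 2 * + 0 - (+ 1 * (x - + 0) * (x - + 1) + + 1 * (- x - + 0) * (- x - + 1)) ≡ - + 2 * (x * x)
      even = solve-∀
      collect : ∀ x y z → - + 2 * (x * x) + - + 2 * (y * y) + - + 2 * (z * z) ≡ - + 2 * (x * x + y * y + z * z)
      collect = solve-∀

    coefficient₃ : ℓ∣ + 6 * f α 3 - + 6 * p₂ t
    coefficient₃ = n!*coefficient 3 (trans (cong₂ _+_ (cong₂ _+_ (even x₀) (even x₁)) (even x₂)) (collect x₀ x₁ x₂))
      where
      even : ∀ x → + 6 * + 0 - (+ 1 * (x - + 0) * (x - + 1) * (x - + 2) +
                                + 1 * (- x - + 0) * (- x - + 1) * (- x - + 2)) ≡ + 6 * (x * x)
      even = solve-∀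
      collect : ∀ x y z → + 6 * (x * x) + + 6 * (y * y) + + 6 * (z * z) ≡ + 6 * (x * x + y * y + z * z)
      collect = solve-∀

    coefficient₄ : ℓ∣ + 24 * f α 4 - (- + 2 * p₄ t - + 22 * p₂ t)
    coefficient₄ = n!*coefficient 4 (trans (cong₂ _+_ (cong₂ _+_ (even x₀) (even x₁)) (even x₂))
      (collect (x₀ * x₀) (x₁ * x₁) (x₂ * x₂)))
      where
      even : ∀ x → + 24 * + 0 - (+ 1 * (x - + 0) * (x - + 1) * (x - + 2) * (x - + 3) +
                                 + 1 * (- x - + 0) * (- x - + 1) * (- x - + 2) * (- x - + 3)) ≡
                   - + 2 * (x * x * (x * x)) - + 22 * (x * x)
      even = solve-∀
      collect : ∀ x y z → - + 2 * (x * x) - + 22 * x + (- + 2 * (y * y) - + 22 * y) + (- + 2 * (z * z) - + 22 * z) ≡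
                          - + 2 * (x * x + y * y + z * z) - + 22 * (x + y + z)
      collect = solve-∀

    coefficient₅ : ℓ∣ + 120 * f α 5 - (+ 20 * p₄ t + + 100 * p₂ t)
    coefficient₅ = n!*coefficient 5 (trans (cong₂ _+_ (cong₂ _+_ (even x₀) (even x₁)) (even x₂))
      (collect (x₀ * x₀) (x₁ * x₁) (x₂ * x₂)))
      where
      even : ∀ x → + 120 * + 0 -
                   (+ 1 * (x - + 0) * (x - + 1) * (x - + 2) * (x - + 3) * (x - + 4) +
                    + 1 * (- x - + 0) * (- x - + 1) * (- x - + 2) * (- x - + 3) * (- x - + 4)) ≡
                   + 20 * (x * x * (x * x)) + + 100 * (x * x)
      even = solve-∀
      collect : ∀ x y z → + 20 * (x * x) + + 100 * x + (+ 20 * (y * y) + + 100 * y) + (+ 20 * (z * z) + + 100 * z) ≡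
                          + 20 * (x * x + y * y + z * z) + + 100 * (x + y + z)
      collect = solve-∀

    coefficient₆ : ℓ∣ + 720 * f α 6 - (- + 2 * p₆ t - + 170 * p₄ t - + 548 * p₂ t)
    coefficient₆ = n!*coefficient 6 (trans (cong₂ _+_ (cong₂ _+_ (even x₀) (even x₁)) (even x₂))
      (collect (x₀ * x₀) (x₁ * x₁) (x₂ * x₂)))
      where
      even : ∀ x → + 720 * + 0 -
                   (+ 1 * (x - + 0) * (x - + 1) * (x - + 2) * (x - + 3) * (x - + 4) * (x - + 5) +
                    + 1 * (- x - + 0) * (- x - + 1) * (- x - + 2) * (- x - + 3) * (- x - + 4) * (- x - + 5)) ≡
                   - + 2 * (x * x * (x * x) * (x * x)) - + 170 * (x * x * (x * x)) - + 548 * (x * x)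
      even = solve-∀
      collect : ∀ x y z →
        - + 2 * (x * x * x) - + 170 * (x * x) - + 548 * x + (- + 2 * (y * y * y) - + 170 * (y * y) - + 548 * y)
          + (- + 2 * (z * z * z) - + 170 * (z * z) - + 548 * z) ≡
        - + 2 * (x * x * x + y * y * y + z * z * z) - + 170 * (x * x + y * y + z * z) - + 548 * (x + y + z)
      collect = solve-∀

    private
      nonzero : ∀ {n} → ¬ ℓ∣ f α n → ¬ (f α n ≡ + 0 [mod ℓ ])
      nonzero ℓ∤f h = ℓ∤f (0⇒∣ h)

      -- Passing from n! f(n) to f(n) inverts n!, which requires n < ℓ; the way back, `solve-q`, is
      -- plain multiplication.
      solve-f : ∀ n {q} → n ℕ.< ℓ → ℓ∣ + (n ℕ.!) * f α n - q → ℓ∣ q → f α n ≡ + 0 [mod ℓ ]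
      solve-f n {q} n<ℓ h ℓ∣q = ∣⇒0 (cancelˡ (∤! n n<ℓ) (by (h ⊕ ℓ∣q) (lemma (+ (n ℕ.!) * f α n) q)))
        where
        lemma : ∀ x q → x - q + q ≡ x
        lemma = solve-∀

      solve-q : ∀ n {q} → ℓ∣ + (n ℕ.!) * f α n - q → f α n ≡ + 0 [mod ℓ ] → ℓ∣ q
      solve-q n {q} h f≡0 = by (+ (n ℕ.!) ⊙ 0⇒∣ f≡0 ⊕ - + 1 ⊙ h) (lemma (+ (n ℕ.!)) (f α n) q)
        where
        lemma : ∀ n x q → n * x + - + 1 * (n * x - q) ≡ q
        lemma = solve-∀

    module _ (5≤ℓ : 5 ℕ.≤ ℓ) where

      private
        4<ℓ = 5≤ℓ
        3<ℓ = ℕ.<-trans (ℕ.n<1+n 3) 4<ℓ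
        2<ℓ = ℕ.<-trans (ℕ.n<1+n 2) 3<ℓ
        1<ℓ = ℕ.<-trans (ℕ.n<1+n 1) 2<ℓ
        0<ℓ = ℕ.<-trans (ℕ.n<1+n 0) 1<ℓ

        ∤-2 : ¬ ℓ∣ - + 2
        ∤-2 h = ∤-small 2 2<ℓ (- + 1 ⊙ h)

        f₀≡0 : f α 0 ≡ + 0 [mod ℓ ]
        f₀≡0 = solve-f 0 0<ℓ coefficient₀ (divides (+ 0) refl)

        f₁≡0 : f α 1 ≡ + 0 [mod ℓ ]
        f₁≡0 = solve-f 1 1<ℓ coefficient₁ (divides (+ 0) refl)

        f₂≡0 : ℓ∣ p₂ t → f α 2 ≡ + 0 [mod ℓ ]
        f₂≡0 h = solve-f 2 2<ℓ coefficient₂ (- + 2 ⊙ h)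

        f₃≡0 : ℓ∣ p₂ t → f α 3 ≡ + 0 [mod ℓ ]
        f₃≡0 h = solve-f 3 3<ℓ coefficient₃ (+ 6 ⊙ h)

        p₄⇒24f₄ : ℓ∣ p₂ t → ℓ∣ + 24 * f α 4 - (- + 2 * p₄ t)
        p₄⇒24f₄ h = by (coefficient₄ ⊕ - + 22 ⊙ h) (lemma (+ 24 * f α 4) (p₂ t) (p₄ t))
          where
          lemma : ∀ x p q → x - (- + 2 * q - + 22 * p) + - + 22 * p ≡ x - (- + 2 * q)
          lemma = solve-∀

        p₂≡0 : f α 2 ≡ + 0 [mod ℓ ] → ℓ∣ p₂ t
        p₂≡0 h = cancelˡ ∤-2 (solve-q 2 coefficient₂ h)

        p₄≡0 : ℓ∣ p₂ t → f α 4 ≡ + 0 [mod ℓ ] → ℓ∣ p₄ t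
        p₄≡0 p₂≡0 h = cancelˡ ∤-2 (solve-q 4 (p₄⇒24f₄ p₂≡0) h)

      order-2⇒ : HasOrder (charSeries α) 2 → ¬ ℓ∣ p₂ t
      order-2⇒ (_ , f₂≢0) h = f₂≢0 (f₂≡0 h)

      order-2⇐ : ¬ ℓ∣ p₂ t → HasOrder (charSeries α) 2
      order-2⇐ ℓ∤p₂ = below , ℓ∤p₂ ∘ p₂≡0
        where
        below : ∀ i → i ℕ.< 2 → f α i ≡ + 0 [mod ℓ ]
        below 0 _ = f₀≡0
        below 1 _ = f₁≡0
        below (suc (suc _)) (s≤s (s≤s ()))

      order-4⇒ : HasOrder (charSeries α) 4 → ℓ∣ p₂ t × ¬ ℓ∣ p₄ t
      order-4⇒ (below , f₄≢0) = ℓ∣p₂ , λ ℓ∣p₄ → f₄≢0 (solve-f 4 4<ℓ (p₄⇒24f₄ ℓ∣p₂) (- + 2 ⊙ ℓ∣p₄))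
        where
        ℓ∣p₂ = p₂≡0 (below 2 (ℕ.m≤m+n 3 1))

      private
        below₄ : ℓ∣ p₂ t → ∀ i → i ℕ.< 4 → f α i ≡ + 0 [mod ℓ ]
        below₄ ℓ∣p₂ 0 _ = f₀≡0
        below₄ ℓ∣p₂ 1 _ = f₁≡0
        below₄ ℓ∣p₂ 2 _ = f₂≡0 ℓ∣p₂
        below₄ ℓ∣p₂ 3 _ = f₃≡0 ℓ∣p₂
        below₄ ℓ∣p₂ (suc (suc (suc (suc _)))) (s≤s (s≤s (s≤s (s≤s ()))))

      order-4⇐ : ℓ∣ p₂ t → ¬ ℓ∣ p₄ t → HasOrder (charSeries α) 4
      order-4⇐ ℓ∣p₂ ℓ∤p₄ = below₄ ℓ∣p₂ , ℓ∤p₄ ∘ p₄≡0 ℓ∣p₂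

      order-6⇒ : HasOrder (charSeries α) 6 → ℓ∣ p₂ t × ℓ∣ p₄ t
      order-6⇒ (below , _) = ℓ∣p₂ , p₄≡0 ℓ∣p₂ (below 4 (ℕ.m≤m+n 5 1))
        where
        ℓ∣p₂ = p₂≡0 (below 2 (ℕ.m≤m+n 3 3))

      order-6⇐ : 7 ℕ.≤ ℓ → ℓ∣ p₂ t → ℓ∣ p₄ t → ¬ ℓ∣ p₆ t → HasOrder (charSeries α) 6
      order-6⇐ 6<ℓ ℓ∣p₂ ℓ∣p₄ ℓ∤p₆ = below , λ h → ℓ∤p₆ (cancelˡ ∤-2
        (by (solve-q 6 coefficient₆ h ⊕ + 170 ⊙ ℓ∣p₄ ⊕ + 548 ⊙ ℓ∣p₂) (lemma (p₂ t) (p₄ t) (p₆ t))))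
        where
        lemma : ∀ p q r → - + 2 * r - + 170 * q - + 548 * p + + 170 * q + + 548 * p ≡ - + 2 * r
        lemma = solve-∀
        below : ∀ i → i ℕ.< 6 → f α i ≡ + 0 [mod ℓ ]
        below 4 _ = solve-f 4 4<ℓ (p₄⇒24f₄ ℓ∣p₂) (- + 2 ⊙ ℓ∣p₄)
        -- Here 5! is inverted, which would fail for ℓ = 5; this is what the bound 7 ≤ ℓ provides.
        below 5 _ = solve-f 5 (ℕ.<-trans (ℕ.n<1+n 5) 6<ℓ) coefficient₅ (+ 20 ⊙ ℓ∣p₄ ⊕ + 100 ⊙ ℓ∣p₂)
        below 0 _ = below₄ ℓ∣p₂ 0 (ℕ.m≤m+n 1 3)
        below 1 _ = below₄ ℓ∣p₂ 1 (ℕ.m≤m+n 2 2)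
        below 2 _ = below₄ ℓ∣p₂ 2 (ℕ.m≤m+n 3 1)
        below 3 _ = below₄ ℓ∣p₂ 3 (ℕ.m≤m+n 4 0)
        below (suc (suc (suc (suc (suc (suc _)))))) (s≤s (s≤s (s≤s (s≤s (s≤s (s≤s ()))))))

  origin : Triple
  origin = reduce (+ 0) , reduce (+ 0) , reduce (+ 0)

  origin-unique : ∀ {a b c} → ℓ∣ ⟦ a ⟧ → ℓ∣ ⟦ b ⟧ → ℓ∣ ⟦ c ⟧ → (a , b , c) ≡ origin
  origin-unique ha hb hc = cong₂ _,_ (zero-unique ha) (cong₂ _,_ (zero-unique hb) (zero-unique hc))
    where
    zero-unique : ∀ {a} → ℓ∣ ⟦ a ⟧ → a ≡ reduce (+ 0)
    zero-unique {a} h = sym (reduce-unique {+ 0} (by (- + 1 ⊙ h) (lemma ⟦ a ⟧)))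
      where
      lemma : ∀ a → - + 1 * a ≡ + 0 - a
      lemma = solve-∀

  digit-0 : ∀ x → rep x 1 ≡ + 0 [mod ℓ ] → ℓ∣ ⟦ digit x ⟧
  digit-0 x h = by (reduce-≡ (rep x 1) ⊕ 0⇒∣ h) (lemma ⟦ digit x ⟧ (rep x 1))
    where
    lemma : ∀ d x → d - x + x ≡ d
    lemma = solve-∀

  admissible⇒≢origin : ∀ α → Admissible α → residues α ≢ origin
  admissible⇒≢origin α admissible eq = admissible λ where
      zero             → divisible-digit (α zero) (cong proj₁ eq)
      (suc zero)       → divisible-digit (α (suc zero)) (cong (proj₁ ∘ proj₂) eq)
      (suc (suc zero)) → divisible-digit (α (suc (suc zero))) (cong (proj₂ ∘ proj₂) eq)
    where
    divisible-digit : ∀ x → digit x ≡ reduce (+ 0) → fromℤ (+ ℓ) ∣ₗ x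
    divisible-digit x e = 0⇒∣ₗ (mod (reduce-injective (rep x 1) (+ 0) e))

  ≢origin⇒admissible : ∀ α → residues α ≢ origin → Admissible α
  ≢origin⇒admissible α ≢origin all-divisible = ≢origin (origin-unique
    (digit-0 (α zero) (∣ₗ⇒0 (all-divisible zero)))
    (digit-0 (α (suc zero)) (∣ₗ⇒0 (all-divisible (suc zero))))
    (digit-0 (α (suc (suc zero))) (∣ₗ⇒0 (all-divisible (suc (suc zero))))))

  order⇒weierstrass : ∀ g {n} → HasOrder g n → WeierstrassForm g 0 n
  order⇒weierstrass g {n} order@(_ , gₙ≢0) with inverse (rep (g n) 1) (gₙ≢0 ∘ ∣⇒0)
  ... | w , h = Preparation.weierstrassForm g n order w (mod h)

-- Congruence of integer triples modulo ℓ.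

module Vectors (ℓ : ℕ) (ℓ-prime : Prime ℓ) where

  open import Data.Integer.Base using (_+_; _*_; _-_; -_)
  open Congruence
  open PrimeField ℓ ℓ-prime
  open ResidueClasses ℓ ℓ-prime using (Triple)
  open Coefficients ℓ ℓ-prime using (ℤ³; coords)

  infix 4 _≋_

  record _≋_ (v w : ℤ³) : Set where
    constructor ≋-by
    field
      fst : ℓ∣ proj₁ v - proj₁ w
      snd : ℓ∣ proj₁ (proj₂ v) - proj₁ (proj₂ w)
      trd : ℓ∣ proj₂ (proj₂ v) - proj₂ (proj₂ w)

  private
    chain : ∀ x y z → x - y + (y - z) ≡ x - z
    chain = solve-∀

    flip : ∀ x y → - + 1 * (x - y) ≡ y - x
    flip = solve-∀

  ≋-sym : ∀ {v w} → v ≋ w → w ≋ v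
  ≋-sym {a , b , c} {a′ , b′ , c′} (≋-by h k l) =
    ≋-by (by (- + 1 ⊙ h) (flip a a′)) (by (- + 1 ⊙ k) (flip b b′)) (by (- + 1 ⊙ l) (flip c c′))

  ≋-trans : ∀ {u v w} → u ≋ v → v ≋ w → u ≋ w
  ≋-trans {a , b , c} {a′ , b′ , c′} {a″ , b″ , c″} (≋-by h k l) (≋-by h′ k′ l′) =
    ≋-by (by (h ⊕ h′) (chain a a′ a″)) (by (k ⊕ k′) (chain b b′ b″)) (by (l ⊕ l′) (chain c c′ c″))

  reduce₃ : ℤ³ → Triple
  reduce₃ (a , b , c) = reduce a , reduce b , reduce c

  reduce₃-≋ : ∀ v → coords (reduce₃ v) ≋ v
  reduce₃-≋ (a , b , c) = ≋-by (reduce-≡ a) (reduce-≡ b) (reduce-≡ c)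

  reduce₃-unique : ∀ {v t} → v ≋ coords t → reduce₃ v ≡ t
  reduce₃-unique {a , b , c} {x , y , z} (≋-by h k l) =
    cong₂ _,_ (reduce-unique {a} h) (cong₂ _,_ (reduce-unique {b} k) (reduce-unique {c} l))

-- The ℓ² points of the cone a² + b² + c² = 0.

-- Given u² + v² + 1 = 0, the form a² + b² + c² becomes XY − Z² in the
-- coordinates X = c − (ua + vb), Y = c + (ua + vb), Z = ub − va, and the cone
-- XY = Z² is parametrised by (x , z) ↦ (x , z²/x , z) for x ≠ 0 and
-- (0 , z) ↦ (0 , z , 0).
module Cone (ℓ : ℕ) (ℓ-prime : Prime ℓ) (5≤ℓ : 5 ℕ.≤ ℓ) where

  open import Data.Integer.Base using (_+_; _*_; _-_; -_)
  open Congruence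
  open PrimeField ℓ ℓ-prime
  open ResidueClasses ℓ ℓ-prime
  open Coefficients ℓ ℓ-prime using (ℤ³; coords; p₂)
  open Vectors ℓ ℓ-prime

  -- Abstract, since unfolding the pigeonhole search is prohibitively expensive.
  abstract
    private
      u v : ℤ
      u = proj₁ (SumOfSquares.sum-of-squares 5≤ℓ)
      v = proj₁ (proj₂ (SumOfSquares.sum-of-squares 5≤ℓ))

      s : ℓ∣ u * u + v * v + + 1
      s = proj₂ (proj₂ (SumOfSquares.sum-of-squares 5≤ℓ))

  private
    ½ = inv (+ 2)

    ½-spec : ℓ∣ + 2 * ½ - + 1
    ½-spec = inv-spec (∤-small 2 (ℕ.≤-trans (ℕ.m≤m+n 3 2) 5≤ℓ))

  forms : ℤ³ → ℤ³
  forms (a , b , c) = c - (u * a + v * b) , c + (u * a + v * b) , u * b - v * a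

  -- ½(X + Y) is c and ½(Y - X) is ua + vb. The map (a , b) ↦ (ua + vb , ub - va) has determinant u²
  -- + v² ≡ -1, which accounts for the signs of its inverse.
  back : ℤ³ → ℤ³
  back (X , Y , Z) = v * Z - u * (½ * (Y - X)) , - (v * (½ * (Y - X)) + u * Z) , ½ * (X + Y)

  hyper : ℤ³ → ℤ
  hyper (X , Y , Z) = X * Y - Z * Z

  forms-cong : ∀ {w w′} → w ≋ w′ → forms w ≋ forms w′
  forms-cong {a , b , c} {a′ , b′ , c′} (≋-by h k l) = ≋-by
    (by (l ⊕ - u ⊙ h ⊕ - v ⊙ k) (lemma₁ u v a b c a′ b′ c′))
    (by (l ⊕ u ⊙ h ⊕ v ⊙ k) (lemma₂ u v a b c a′ b′ c′))
    (by (u ⊙ k ⊕ - v ⊙ h) (lemma₃ u v a b a′ b′))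
    where
    lemma₁ : ∀ u v a b c a′ b′ c′ → c - c′ + - u * (a - a′) + - v * (b - b′) ≡
             c - (u * a + v * b) - (c′ - (u * a′ + v * b′))
    lemma₁ = solve-∀
    lemma₂ : ∀ u v a b c a′ b′ c′ → c - c′ + u * (a - a′) + v * (b - b′) ≡
             c + (u * a + v * b) - (c′ + (u * a′ + v * b′))
    lemma₂ = solve-∀
    lemma₃ : ∀ u v a b a′ b′ → u * (b - b′) + - v * (a - a′) ≡ u * b - v * a - (u * b′ - v * a′)
    lemma₃ = solve-∀

  back-cong : ∀ {w w′} → w ≋ w′ → back w ≋ back w′
  back-cong {X , Y , Z} {X′ , Y′ , Z′} (≋-by h k l) = ≋-by
    (by (v ⊙ l ⊕ - (u * ½) ⊙ (k ⊕ - + 1 ⊙ h)) (lemma₁ u v ½ X Y Z X′ Y′ Z′))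
    (by (- u ⊙ l ⊕ - (v * ½) ⊙ (k ⊕ - + 1 ⊙ h)) (lemma₂ u v ½ X Y Z X′ Y′ Z′))
    (by (½ ⊙ (h ⊕ k)) (lemma₃ ½ X Y X′ Y′))
    where
    lemma₁ : ∀ u v i X Y Z X′ Y′ Z′ →
             v * (Z - Z′) + - (u * i) * (Y - Y′ + - + 1 * (X - X′)) ≡
             v * Z - u * (i * (Y - X)) - (v * Z′ - u * (i * (Y′ - X′)))
    lemma₁ = solve-∀
    lemma₂ : ∀ u v i X Y Z X′ Y′ Z′ →
             - u * (Z - Z′) + - (v * i) * (Y - Y′ + - + 1 * (X - X′)) ≡
             - (v * (i * (Y - X)) + u * Z) - - (v * (i * (Y′ - X′)) + u * Z′)
    lemma₂ = solve-∀
    lemma₃ : ∀ i X Y X′ Y′ → i * (X - X′ + (Y - Y′)) ≡ i * (X + Y) - i * (X′ + Y′)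
    lemma₃ = solve-∀

  forms-back : ∀ w → forms (back w) ≋ w
  forms-back (X , Y , Z) = ≋-by
    (by (X ⊙ ½-spec ⊕ (½ * (Y - X)) ⊙ s) (lemma₁ u v ½ X Y Z))
    (by (Y ⊙ ½-spec ⊕ - (½ * (Y - X)) ⊙ s) (lemma₂ u v ½ X Y Z))
    (by (- Z ⊙ s) (lemma₃ u v ½ X Y Z))
    where
    lemma₁ : ∀ u v i X Y Z →
             X * (+ 2 * i - + 1) + (i * (Y - X)) * (u * u + v * v + + 1) ≡
             i * (X + Y) - (u * (v * Z - u * (i * (Y - X))) + v * - (v * (i * (Y - X)) + u * Z)) - X
    lemma₁ = solve-∀
    lemma₂ : ∀ u v i X Y Z →
             Y * (+ 2 * i - + 1) + - (i * (Y - X)) * (u * u + v * v + + 1) ≡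
             i * (X + Y) + (u * (v * Z - u * (i * (Y - X))) + v * - (v * (i * (Y - X)) + u * Z)) - Y
    lemma₂ = solve-∀
    lemma₃ : ∀ u v i X Y Z →
             - Z * (u * u + v * v + + 1) ≡
             u * - (v * (i * (Y - X)) + u * Z) - v * (v * Z - u * (i * (Y - X))) - Z
    lemma₃ = solve-∀

  back-forms : ∀ w → back (forms w) ≋ w
  back-forms (a , b , c) = ≋-by
    (by (- a ⊙ s ⊕ - (u * (u * a + v * b)) ⊙ ½-spec) (lemma₁ u v ½ a b c))
    (by (- b ⊙ s ⊕ - (v * (u * a + v * b)) ⊙ ½-spec) (lemma₂ u v ½ a b c))
    (by (c ⊙ ½-spec) (lemma₃ u v ½ a b c))
    where
    lemma₁ : ∀ u v i a b c →
             - a * (u * u + v * v + + 1) + - (u * (u * a + v * b)) * (+ 2 * i - + 1) ≡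
             v * (u * b - v * a) - u * (i * (c + (u * a + v * b) - (c - (u * a + v * b)))) - a
    lemma₁ = solve-∀
    lemma₂ : ∀ u v i a b c →
             - b * (u * u + v * v + + 1) + - (v * (u * a + v * b)) * (+ 2 * i - + 1) ≡
             - (v * (i * (c + (u * a + v * b) - (c - (u * a + v * b)))) + u * (u * b - v * a)) - b
    lemma₂ = solve-∀
    lemma₃ : ∀ u v i a b c →
             c * (+ 2 * i - + 1) ≡ i * (c - (u * a + v * b) + (c + (u * a + v * b))) - c
    lemma₃ = solve-∀

  -- XY - Z² = c² - (ua + vb)² - (ub - va)² = c² - (u² + v²)(a² + b²), by the two-square identity.
  p₂≡hyper : ∀ w → ℓ∣ p₂ w - hyper (forms w)
  p₂≡hyper (a , b , c) = by ((a * a + b * b) ⊙ s) (lemma u v a b c)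
    where
    lemma : ∀ u v a b c → (a * a + b * b) * (u * u + v * v + + 1) ≡
            a * a + b * b + c * c -
            ((c - (u * a + v * b)) * (c + (u * a + v * b)) - (u * b - v * a) * (u * b - v * a))
    lemma = solve-∀

  hyper-cong : ∀ {w w′} → w ≋ w′ → ℓ∣ hyper w - hyper w′
  hyper-cong {X , Y , Z} {X′ , Y′ , Z′} (≋-by h k l) = by (Y ⊙ h ⊕ X′ ⊙ k ⊕ - (Z + Z′) ⊙ l)
    (lemma X Y Z X′ Y′ Z′)
    where
    lemma : ∀ X Y Z X′ Y′ Z′ → Y * (X - X′) + X′ * (Y - Y′) + - (Z + Z′) * (Z - Z′) ≡
            X * Y - Z * Z - (X′ * Y′ - Z′ * Z′)
    lemma = solve-∀

  private
    a₀ : Fin ℓ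
    a₀ = reduce (+ 0)

    ∤⇐≢a₀ : ∀ {x} → x ≢ a₀ → ¬ ℓ∣ ⟦ x ⟧
    ∤⇐≢a₀ {x} x≢ h = x≢ (⟦⟧-injective (by (h ⊕ - + 1 ⊙ reduce-≡ (+ 0)) (lemma ⟦ x ⟧ ⟦ a₀ ⟧)))
      where
      lemma : ∀ x r → x + - + 1 * (r - + 0) ≡ x - r
      lemma = solve-∀

  conePoint : Fin ℓ × Fin ℓ → ℤ³
  conePoint (x , z) with x Fin.≟ a₀
  ... | yes _ = + 0 , ⟦ z ⟧ , + 0
  ... | no _  = ⟦ x ⟧ , ⟦ z ⟧ * ⟦ z ⟧ * inv ⟦ x ⟧ , ⟦ z ⟧

  conePoint-a₀ : ∀ {x} z → x ≡ a₀ → conePoint (x , z) ≡ (+ 0 , ⟦ z ⟧ , + 0)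
  conePoint-a₀ {x} z x≡a₀ with x Fin.≟ a₀
  ... | yes _   = refl
  ... | no x≢a₀ = contradiction x≡a₀ x≢a₀

  conePoint-≢a₀ : ∀ {x} z → x ≢ a₀ → conePoint (x , z) ≡ (⟦ x ⟧ , ⟦ z ⟧ * ⟦ z ⟧ * inv ⟦ x ⟧ , ⟦ z ⟧)
  conePoint-≢a₀ {x} z x≢a₀ with x Fin.≟ a₀
  ... | yes x≡a₀ = contradiction x≡a₀ x≢a₀
  ... | no _     = refl

  -- Inverse to the parametrisation: where X = 0 the cone forces Z = 0 and Y is the free coordinate;
  -- elsewhere Z is free and Y = Z²/X.
  choose : Fin ℓ → Fin ℓ → Fin ℓ → Fin ℓ × Fin ℓ
  choose x y z with x Fin.≟ a₀
  ... | yes _ = x , y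
  ... | no _  = x , z

  parameters : ℤ³ → Fin ℓ × Fin ℓ
  parameters (X , Y , Z) = choose (reduce X) (reduce Y) (reduce Z)

  parameters-cong : ∀ {w w′} → w ≋ w′ → parameters w ≡ parameters w′
  parameters-cong {X , Y , Z} {X′ , Y′ , Z′} (≋-by h k l) = trans
    (cong₂ (λ x y → choose x y (reduce Z)) (reduce-cong {X} h) (reduce-cong {Y} k))
    (cong (choose (reduce X′) (reduce Y′)) (reduce-cong {Z} l))

  reduce-⟦⟧ : ∀ a → reduce ⟦ a ⟧ ≡ a
  reduce-⟦⟧ a = reduce-unique {⟦ a ⟧} (divides (+ 0) (ℤ.+-inverseʳ ⟦ a ⟧))

  choose-a₀ : ∀ {x} y z → x ≡ a₀ → choose x y z ≡ (x , y)
  choose-a₀ {x} y z x≡a₀ with x Fin.≟ a₀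
  ... | yes _   = refl
  ... | no x≢a₀ = contradiction x≡a₀ x≢a₀

  choose-≢a₀ : ∀ {x} y z → x ≢ a₀ → choose x y z ≡ (x , z)
  choose-≢a₀ {x} y z x≢a₀ with x Fin.≟ a₀
  ... | yes x≡a₀ = contradiction x≡a₀ x≢a₀
  ... | no _     = refl

  parameters-conePoint : ∀ p → parameters (conePoint p) ≡ p
  parameters-conePoint (x , z) with x Fin.≟ a₀
  ... | yes x≡a₀ = trans (choose-a₀ (reduce ⟦ z ⟧) a₀ refl) (cong₂ _,_ (sym x≡a₀) (reduce-⟦⟧ z))
  ... | no x≢a₀  = trans
    (choose-≢a₀ (reduce (⟦ z ⟧ * ⟦ z ⟧ * inv ⟦ x ⟧)) (reduce ⟦ z ⟧) (x≢a₀ ∘ trans (sym (reduce-⟦⟧ x))))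
    (cong₂ _,_ (reduce-⟦⟧ x) (reduce-⟦⟧ z))

  hyper-conePoint : ∀ p → ℓ∣ hyper (conePoint p)
  hyper-conePoint (x , z) with x Fin.≟ a₀
  ... | yes _   = divides (+ 0) (lemma ⟦ z ⟧)
    where
    lemma : ∀ z → + 0 * z - + 0 * + 0 ≡ + 0
    lemma = solve-∀
  ... | no x≢a₀ = by ((⟦ z ⟧ * ⟦ z ⟧) ⊙ inv-spec (∤⇐≢a₀ x≢a₀)) (lemma ⟦ x ⟧ (inv ⟦ x ⟧) ⟦ z ⟧)
    where
    lemma : ∀ x i z → z * z * (x * i - + 1) ≡ x * (z * z * i) - z * z
    lemma = solve-∀

  conePoint-parameters : ∀ w → ℓ∣ hyper w → conePoint (parameters w) ≋ w
  conePoint-parameters (X , Y , Z) h = go (reduce X Fin.≟ a₀)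
    where
    x = reduce X
    y = reduce Y
    z = reduce Z
    go : Dec (x ≡ a₀) → conePoint (choose x y z) ≋ (X , Y , Z)
    go (yes x≡a₀) = subst (_≋ (X , Y , Z))
      (sym (trans (cong conePoint (choose-a₀ y z x≡a₀)) (conePoint-a₀ y x≡a₀)))
      (≋-by (by (- + 1 ⊙ X≡0) (lemma₁ X))
            (reduce-≡ Y)
            (by (- + 1 ⊙ 0-square {Z} (by (Y ⊙ X≡0 ⊕ - + 1 ⊙ h) (lemma₂ X Y Z))) (lemma₁ Z)))
      where
      X≡0 : ℓ∣ X
      X≡0 = by (reduce-injective X (+ 0) x≡a₀) (ℤ.+-identityʳ X)
      lemma₁ : ∀ X → - + 1 * X ≡ + 0 - X
      lemma₁ = solve-∀
      lemma₂ : ∀ X Y Z → Y * X + - + 1 * (X * Y - Z * Z) ≡ Z * Z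
      lemma₂ = solve-∀
    go (no x≢a₀) = subst (_≋ (X , Y , Z))
      (sym (trans (cong conePoint (choose-≢a₀ y z x≢a₀)) (conePoint-≢a₀ z x≢a₀)))
      (≋-by (reduce-≡ X)
            (cancelˡ (∤⇐≢a₀ x≢a₀) (by
              ((⟦ z ⟧ * ⟦ z ⟧) ⊙ inv-spec (∤⇐≢a₀ x≢a₀) ⊕ - + 1 ⊙ h ⊕ - Y ⊙ reduce-≡ X ⊕ (⟦ z ⟧ + Z) ⊙ reduce-≡ Z)
              (lemma ⟦ x ⟧ (inv ⟦ x ⟧) ⟦ z ⟧ X Y Z)))
            (reduce-≡ Z))
      where
      lemma : ∀ x i z X Y Z →
              z * z * (x * i - + 1) + - + 1 * (X * Y - Z * Z) + - Y * (x - X) + (z + Z) * (z - Z) ≡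
              x * (z * z * i - Y)
      lemma = solve-∀

  point : Fin ℓ × Fin ℓ → Triple
  point = reduce₃ ∘ back ∘ conePoint

  forms-point : ∀ p → forms (coords (point p)) ≋ conePoint p
  forms-point p = ≋-trans (forms-cong (reduce₃-≋ (back (conePoint p)))) (forms-back (conePoint p))

  point-injective : ∀ {p q} → point p ≡ point q → p ≡ q
  point-injective {p} {q} eq = begin
    p                                       ≡⟨ recover p ⟨
    parameters (forms (coords (point p)))   ≡⟨ cong (parameters ∘ forms ∘ coords) eq ⟩
    parameters (forms (coords (point q)))   ≡⟨ recover q ⟩
    q                                       ∎
    where
    open ≡-Reasoning
    recover : ∀ p → parameters (forms (coords (point p))) ≡ p
    recover p = trans (parameters-cong (forms-point p)) (parameters-conePoint p)

  cone : List Triple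
  cone = map point pairs

  cone-unique : Unique cone
  cone-unique = Unique.map⁺ point-injective pairs-unique

  length-cone : length cone ≡ ℓ ℕ.* ℓ
  length-cone = trans (List.length-map point pairs) length-pairs

  ∈-cone⇒ : ∀ {t} → t ∈ cone → ℓ∣ p₂ (coords t)
  ∈-cone⇒ t∈ with ∈-map⁻ point t∈
  ... | p , _ , refl = by (p₂≡hyper w ⊕ (hyper-cong (forms-point p) ⊕ hyper-conePoint p))
      (lemma (p₂ w) (hyper (forms w)) (hyper (conePoint p)))
    where
    w = coords (point p)
    lemma : ∀ x y z → x - y + (y - z + z) ≡ x
    lemma = solve-∀

  ∈-cone⇐ : ∀ {t} → ℓ∣ p₂ (coords t) → t ∈ cone
  ∈-cone⇐ {t} h = subst (_∈ cone)
    (reduce₃-unique (≋-trans (back-cong (conePoint-parameters w on-cone)) (back-forms (coords t))))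
    (∈-map⁺ point (∈-pairs (parameters w)))
    where
    w = forms (coords t)
    on-cone : ℓ∣ hyper w
    on-cone = by (h ⊕ - + 1 ⊙ p₂≡hyper (coords t)) (lemma (p₂ (coords t)) (hyper w))
      where
      lemma : ∀ x y → x + - + 1 * (x - y) ≡ y
      lemma = solve-∀

-- Common zeros of the quadratic and the quartic form.

-- The triples with a² + b² + c² = a⁴ + b⁴ + c⁴ = 0.
module DoubleZeros (ℓ : ℕ) (ℓ-prime : Prime ℓ) (5≤ℓ : 5 ℕ.≤ ℓ) where

  open import Data.Integer.Base using (_+_; _*_; _-_; -_)
  open Congruence
  open FiniteSets
  open PrimeField ℓ ℓ-prime
  open CubeRoots ℓ ℓ-prime 5≤ℓ using (IsRoot; root⇒ℓ%3≡1; ∤2; ∤3)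
  open ResidueClasses ℓ ℓ-prime
  open Coefficients ℓ ℓ-prime using (ℤ³; coords; p₂; p₄; p₆; origin; origin-unique)
  open Vectors ℓ ℓ-prime
  open Cone ℓ ℓ-prime 5≤ℓ using (reduce-⟦⟧)

  -- If a ≡ 0, then c² ≡ -b² turns the quartic form into 2b⁴, so b and then c vanish as well.
  first-nonzero : ∀ {t} → ℓ∣ p₂ (coords t) → ℓ∣ p₄ (coords t) → t ≢ origin → ¬ ℓ∣ ⟦ proj₁ t ⟧
  first-nonzero {a , b , c} h₂ h₄ t≢origin ha = t≢origin (origin-unique ha hb hc)
    where
    A = ⟦ a ⟧
    B = ⟦ b ⟧
    C = ⟦ c ⟧
    hb : ℓ∣ B
    hb = 0-square (0-square {B * B} (cancelˡ ∤2 (by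
      (h₄ ⊕ - (A * A * A) ⊙ ha ⊕ - (C * C - B * B) ⊙ (h₂ ⊕ - A ⊙ ha)) (lemma A B C))))
      where
      lemma : ∀ a b c →
        a * a * (a * a) + b * b * (b * b) + c * c * (c * c) + - (a * a * a) * a
          + - (c * c - b * b) * (a * a + b * b + c * c + - a * a) ≡ + 2 * (b * b * (b * b))
      lemma = solve-∀
    hc : ℓ∣ C
    hc = 0-square (by (h₂ ⊕ - A ⊙ ha ⊕ - B ⊙ hb) (lemma A B C))
      where
      lemma : ∀ a b c → a * a + b * b + c * c + - a * a + - b * b ≡ c * c
      lemma = solve-∀

  -- Substituting c² = -(a² + b²) into the quartic form gives 2(a⁴ + a²b² + b⁴), which factors as
  -- displayed. Dividing by a² then exhibits b/a or -b/a as a root of x² + x + 1.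
  quartic : ∀ a b c → ℓ∣ p₂ (a , b , c) → ℓ∣ p₄ (a , b , c) →
            ℓ∣ b * b + a * b + a * a ⊎ ℓ∣ b * b - a * b + a * a
  quartic a b c h₂ h₄ = 0-product {b * b + a * b + a * a} (cancelˡ ∤2
    (by (h₄ ⊕ - (c * c - (a * a + b * b)) ⊙ h₂) (lemma a b c)))
    where
    lemma : ∀ a b c →
      a * a * (a * a) + b * b * (b * b) + c * c * (c * c)
        + - (c * c - (a * a + b * b)) * (a * a + b * b + c * c) ≡
      + 2 * ((b * b + a * b + a * a) * (b * b - a * b + a * a))
    lemma = solve-∀

  quartic⇒root : ∀ a b i → ℓ∣ a * i - + 1 →
                 ℓ∣ b * b + a * b + a * a ⊎ ℓ∣ b * b - a * b + a * a → ∃[ ω ] IsRoot ω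
  quartic⇒root a b i inverse (inj₁ h) =
    b * i , by ((i * i) ⊙ h ⊕ - (b * i + a * i + + 1) ⊙ inverse) (lemma a b i)
    where
    lemma : ∀ a b i → i * i * (b * b + a * b + a * a) + - (b * i + a * i + + 1) * (a * i - + 1) ≡
                      b * i * (b * i) + b * i + + 1
    lemma = solve-∀
  quartic⇒root a b i inverse (inj₂ h) =
    - (b * i) , by ((i * i) ⊙ h ⊕ (b * i - a * i - + 1) ⊙ inverse) (lemma a b i)
    where
    lemma : ∀ a b i → i * i * (b * b - a * b + a * a) + (b * i - a * i - + 1) * (a * i - + 1) ≡
                      - (b * i) * - (b * i) + - (b * i) + + 1
    lemma = solve-∀

  ℓ%3≡2⇒origin : ℓ ℕ.% 3 ≡ 2 → ∀ {t} → ℓ∣ p₂ (coords t) → ℓ∣ p₄ (coords t) → t ≡ origin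
  ℓ%3≡2⇒origin ℓ%3≡2 {t@(a , b , c)} h₂ h₄ = decidable-stable (t ≟₃ origin) λ t≢origin →
    impossible (quartic⇒root ⟦ a ⟧ ⟦ b ⟧ (inv ⟦ a ⟧) (inv-spec (first-nonzero {t} h₂ h₄ t≢origin))
      (quartic ⟦ a ⟧ ⟦ b ⟧ ⟦ c ⟧ h₂ h₄))
    where
    impossible : ¬ (∃[ ω ] IsRoot ω)
    impossible (ω , root) = contradiction (trans (sym (root⇒ℓ%3≡1 {ω} root)) ℓ%3≡2) λ ()

  -- For ℓ ≡ 1 mod 3 they are the triples (a , ±ωa , ±ω²a) with a ≠ 0 and
  -- ω a primitive cube root of unity, together with the origin.
  module Enumeration (ω : ℤ) (ω-root : IsRoot ω) where

    sgn : Bool → ℤ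
    sgn true  = + 1
    sgn false = - + 1

    sgn² : ∀ s → ℓ∣ sgn s * sgn s - + 1
    sgn² true  = divides (+ 0) refl
    sgn² false = divides (+ 0) refl

    sgn-injective : ∀ s s′ → ℓ∣ sgn s - sgn s′ → s ≡ s′
    sgn-injective true  true  h = refl
    sgn-injective true  false h = contradiction h ∤2
    sgn-injective false true  h = contradiction (- + 1 ⊙ h) ∤2
    sgn-injective false false h = refl

    -- The second root -1 - ω is ω².
    cubeRoot : Bool → ℤ
    cubeRoot true  = ω
    cubeRoot false = - + 1 - ω

    isRoot : ∀ t → IsRoot (cubeRoot t)
    isRoot true  = ω-root
    isRoot false = by ω-root (lemma ω)
      where
      lemma : ∀ w → w * w + w + + 1 ≡ (- + 1 - w) * (- + 1 - w) + (- + 1 - w) + + 1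
      lemma = solve-∀

    -- The two roots differ by 2ω + 1, and (2ω + 1)² = 4(ω² + ω + 1) - 3, so a coincidence would
    -- make ℓ divide 3.
    cubeRoot-injective : ∀ t t′ → ℓ∣ cubeRoot t - cubeRoot t′ → t ≡ t′
    cubeRoot-injective true  true  h = refl
    cubeRoot-injective true  false h = contradiction
      (by (+ 4 ⊙ ω-root ⊕ - (+ 2 * ω + + 1) ⊙ h) (lemma ω)) ∤3
      where
      lemma : ∀ w → + 4 * (w * w + w + + 1) + - (+ 2 * w + + 1) * (w - (- + 1 - w)) ≡ + 3
      lemma = solve-∀
    cubeRoot-injective false true  h = contradiction
      (by (+ 4 ⊙ ω-root ⊕ (+ 2 * ω + + 1) ⊙ h) (lemma ω)) ∤3
      where
      lemma : ∀ w → + 4 * (w * w + w + + 1) + (+ 2 * w + + 1) * (- + 1 - w - w) ≡ + 3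
      lemma = solve-∀
    cubeRoot-injective false false h = refl

    Parameters : Set
    Parameters = Fin ℓ × Bool × Bool × Bool

    vector : Parameters → ℤ³
    vector (a , s , s′ , t) =
      ⟦ a ⟧ , sgn s * cubeRoot t * ⟦ a ⟧ , sgn s′ * (cubeRoot t * cubeRoot t) * ⟦ a ⟧

    module Remove = Difference (Fin._≟_ {ℓ})

    nonzeros : List (Fin ℓ)
    nonzeros = allFin ℓ Remove.∖ (reduce (+ 0) ∷ [])

    bools : List Bool
    bools = true ∷ false ∷ []

    bools-unique : Unique bools
    bools-unique = ((λ ()) All.∷ All.[]) ∷ All.[] ∷ []

    ∈-bools : ∀ s → s ∈ bools
    ∈-bools true  = here refl
    ∈-bools false = there (here refl)

    signs : List (Bool × Bool × Bool)
    signs = cartesianProduct bools (cartesianProduct bools bools)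

    parameters : List Parameters
    parameters = cartesianProduct nonzeros signs

    parameters-unique : Unique parameters
    parameters-unique = Unique.cartesianProduct⁺
      (Remove.∖-unique (reduce (+ 0) ∷ []) (Unique.allFin⁺ ℓ))
      (Unique.cartesianProduct⁺ bools-unique (Unique.cartesianProduct⁺ bools-unique bools-unique))

    length-nonzeros : suc (length nonzeros) ≡ ℓ
    length-nonzeros = trans (Remove.length-∖ (Unique.allFin⁺ ℓ) (All.[] ∷ []) λ { (here refl) → ∈-allFin _ }) length-allFin

    length-parameters : length parameters ≡ length nonzeros ℕ.* 8
    length-parameters = length-cartesianProduct nonzeros signs

    ∈-nonzeros⇒ : ∀ {a} → a ∈ nonzeros → ¬ ℓ∣ ⟦ a ⟧
    ∈-nonzeros⇒ {a} a∈ h = proj₂ (Remove.∈-∖⁻ (allFin ℓ) (reduce (+ 0) ∷ []) a∈) (here (⟦⟧-injective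
      (by (h ⊕ - + 1 ⊙ reduce-≡ (+ 0)) (lemma ⟦ a ⟧ ⟦ reduce (+ 0) ⟧))))
      where
      lemma : ∀ x r → x + - + 1 * (r - + 0) ≡ x - r
      lemma = solve-∀

    ∈-nonzeros⇐ : ∀ {a} → ¬ ℓ∣ ⟦ a ⟧ → a ∈ nonzeros
    ∈-nonzeros⇐ {a} ℓ∤a = Remove.∈-∖⁺ (∈-allFin a) λ { (here refl) → ℓ∤a (by (reduce-≡ (+ 0)) (ℤ.+-identityʳ _)) }

    double-zero : Parameters → Triple
    double-zero = reduce₃ ∘ vector

    module _ {a : Fin ℓ} (ℓ∤a : ¬ ℓ∣ ⟦ a ⟧) {s s′ t r r′ q : Bool} where

      private
        A = ⟦ a ⟧
        w = cubeRoot t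
        x = cubeRoot q

      vector-injective : vector (a , s , s′ , t) ≋ vector (a , r , r′ , q) →
                         (s , s′ , t) ≡ (r , r′ , q)
      vector-injective (≋-by _ h k) = cong₂ _,_ s≡r (cong₂ _,_ s′≡r′ t≡q)
        where
        cubed : ∀ w → IsRoot w → ℓ∣ w * w * w - + 1
        cubed w root = by ((w - + 1) ⊙ root) (lemma w)
          where
          lemma : ∀ w → (w - + 1) * (w * w + w + + 1) ≡ w * w * w - + 1
          lemma = solve-∀
        ratio : ℓ∣ sgn s * w - sgn r * x
        ratio = cancelˡ ℓ∤a (by h (lemma A (sgn s * w) (sgn r * x)))
          where
          lemma : ∀ a x y → x * a - y * a ≡ a * (x - y)
          lemma = solve-∀
        -- The sign is the cube of ±ω.
        s≡r : s ≡ r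
        s≡r = sgn-injective s r (by
          ((u * u + u * v + v * v) ⊙ ratio
            ⊕ - (sgn s * sgn s * sgn s) ⊙ cubed w (isRoot t) ⊕ - sgn s ⊙ sgn² s
            ⊕ (sgn r * sgn r * sgn r) ⊙ cubed x (isRoot q) ⊕ sgn r ⊙ sgn² r)
          (lemma (sgn s) (sgn r) w x))
          where
          u = sgn s * w
          v = sgn r * x
          lemma : ∀ s r w x →
            (s * w * (s * w) + s * w * (r * x) + r * x * (r * x)) * (s * w - r * x)
              + - (s * s * s) * (w * w * w - + 1) + - s * (s * s - + 1)
              + r * r * r * (x * x * x - + 1) + r * (r * r - + 1) ≡ s - r
          lemma = solve-∀
        t≡q : t ≡ q
        t≡q = cubeRoot-injective t q (by
          (sgn s ⊙ subst (λ r → ℓ∣ sgn s * w - sgn r * x) (sym s≡r) ratio ⊕ - (w - x) ⊙ sgn² s)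
          (lemma (sgn s) w x))
          where
          lemma : ∀ s w x → s * (s * w - s * x) + - (w - x) * (s * s - + 1) ≡ w - x
          lemma = solve-∀
        s′≡r′ : s′ ≡ r′
        -- Once the roots agree, multiplication by w turns the common coefficient w² into w³ ≡ 1 and
        -- isolates the signs.
        s′≡r′ = sgn-injective s′ r′ (by
          (w ⊙ cancelˡ ℓ∤a (by (subst (λ q → ℓ∣ sgn s′ * (w * w) * A - sgn r′ * (cubeRoot q * cubeRoot q) * A)
              (sym t≡q) k) (lemma₁ A (sgn s′) (sgn r′) w))
            ⊕ - (sgn s′ - sgn r′) ⊙ cubed w (isRoot t))
          (lemma₂ (sgn s′) (sgn r′) w))
          where
          lemma₁ : ∀ a s r w → s * (w * w) * a - r * (w * w) * a ≡ a * ((s - r) * (w * w))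
          lemma₁ = solve-∀
          lemma₂ : ∀ s r w → w * ((s - r) * (w * w)) + - (s - r) * (w * w * w - + 1) ≡ s - r
          lemma₂ = solve-∀

    module _ {a : Fin ℓ} {s s′ t : Bool} where

      private
        A = ⟦ a ⟧
        w = cubeRoot t
        d = double-zero (a , s , s′ , t)
        B = ⟦ proj₁ (proj₂ d) ⟧
        C = ⟦ proj₂ (proj₂ d) ⟧

        first≡ : ⟦ proj₁ d ⟧ ≡ A
        first≡ = cong ⟦_⟧ (reduce-⟦⟧ a)

        B² : ℓ∣ B * B - w * w * (A * A)
        B² = by ((B + sgn s * w * A) ⊙ reduce-≡ (sgn s * w * A) ⊕ (w * w * (A * A)) ⊙ sgn² s)
          (lemma A B (sgn s) w)
          where
          lemma : ∀ a b s w → (b + s * w * a) * (b - s * w * a) + w * w * (a * a) * (s * s - + 1) ≡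
                              b * b - w * w * (a * a)
          lemma = solve-∀

        -- The third coordinate ±w²a has square w⁴a², and w⁴ - w = w (w - 1)(w² + w + 1).
        C² : ℓ∣ C * C - w * (A * A)
        C² = by ((C + sgn s′ * (w * w) * A) ⊙ reduce-≡ (sgn s′ * (w * w) * A)
            ⊕ (w * w * (w * w) * (A * A)) ⊙ sgn² s′ ⊕ (w * (w - + 1) * (A * A)) ⊙ isRoot t)
          (lemma A C (sgn s′) w)
          where
          lemma : ∀ a c s w →
            (c + s * (w * w) * a) * (c - s * (w * w) * a) + w * w * (w * w) * (a * a) * (s * s - + 1)
              + w * (w - + 1) * (a * a) * (w * w + w + + 1) ≡ c * c - w * (a * a)
          lemma = solve-∀

      -- The squares of the coordinates are a², w²a² and wa². Their sum and, in the next lemma, the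
      -- sum of their squares vanish because 1 + w + w² divides 1 + w² + w⁴.
      p₂-double-zero : ℓ∣ p₂ (coords d)
      p₂-double-zero = subst (λ z → ℓ∣ p₂ (z , B , C)) (sym first≡) (by
        ((A * A) ⊙ isRoot t ⊕ B² ⊕ C²) (lemma A B C w))
        where
        lemma : ∀ a b c w → a * a * (w * w + w + + 1) + (b * b - w * w * (a * a)) + (c * c - w * (a * a)) ≡
                            a * a + b * b + c * c
        lemma = solve-∀

      p₄-double-zero : ℓ∣ p₄ (coords d)
      p₄-double-zero = subst (λ z → ℓ∣ p₄ (z , B , C)) (sym first≡) (by
        ((A * A * (A * A) * (w * w - w + + 1)) ⊙ isRoot t
          ⊕ (B * B + w * w * (A * A)) ⊙ B² ⊕ (C * C + w * (A * A)) ⊙ C²)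
        (lemma (A * A) (B * B) (C * C) w))
        where
        lemma : ∀ a b c w →
          a * a * (w * w - w + + 1) * (w * w + w + + 1)
            + (b + w * w * a) * (b - w * w * a) + (c + w * a) * (c - w * a) ≡ a * a + b * b + c * c
        lemma = solve-∀

      -- The cubes of a², w²a² and wa² all equal a⁶, so the sum is 3a⁶; explicitly 1 + w³ + w⁶ - 3 =
      -- (w³ + 2)(w³ - 1).
      p₆-double-zero : ¬ ℓ∣ A → ¬ ℓ∣ p₆ (coords d)
      p₆-double-zero ℓ∤a h = ℓ∤a (0-square (cancelˡ {A * A} {A * A} ℓ∤A² (0-product′ (cancelˡ ∤3
        (by (subst (λ z → ℓ∣ p₆ (z , B , C)) first≡ h
          ⊕ - (B * B * (B * B) + B * B * (w * w * (A * A)) + w * w * (A * A) * (w * w * (A * A))) ⊙ B²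
          ⊕ - (C * C * (C * C) + C * C * (w * (A * A)) + w * (A * A) * (w * (A * A))) ⊙ C²
          ⊕ - ((w * w * w + + 2) * (w - + 1) * (A * A * (A * A) * (A * A))) ⊙ isRoot t)
        (lemma (A * A) (B * B) (C * C) w))))))
        where
        ℓ∤A² : ¬ ℓ∣ A * A
        ℓ∤A² = ℓ∤a ∘ 0-square
        0-product′ : ℓ∣ A * A * (A * A) * (A * A) → ℓ∣ A * A * (A * A)
        0-product′ k with 0-product {A * A * (A * A)} k
        ... | inj₁ k′ = k′
        ... | inj₂ k′ = contradiction k′ ℓ∤A²
        lemma : ∀ a b c w →
          a * a * a + b * b * b + c * c * c
            + - (b * b + b * (w * w * a) + w * w * a * (w * w * a)) * (b - w * w * a)
            + - (c * c + c * (w * a) + w * a * (w * a)) * (c - w * a)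
            + - ((w * w * w + + 2) * (w - + 1) * (a * a * a)) * (w * w + w + + 1) ≡
          + 3 * (a * a * a)
        lemma = solve-∀

    double-zero-injective : ∀ {p q} → ¬ ℓ∣ ⟦ proj₁ p ⟧ → double-zero p ≡ double-zero q → p ≡ q
    double-zero-injective {a , σ} {b , τ} ℓ∤a eq with trans (sym (reduce-⟦⟧ a)) (trans (cong proj₁ eq) (reduce-⟦⟧ b))
    ... | refl = cong (a ,_) (vector-injective ℓ∤a (≋-trans (≋-sym (reduce₃-≋ (vector (a , σ))))
      (subst (λ d → coords d ≋ vector (a , τ)) (sym eq) (reduce₃-≋ (vector (a , τ))))))

    double-zeros : List Triple
    double-zeros = map double-zero parameters

    double-zeros-unique : Unique double-zeros
    double-zeros-unique = unique-map (λ p∈ → ∈-nonzeros⇒ (proj₁ (∈-cartesianProduct⁻ nonzeros signs p∈))) parameters-unique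
      where
      -- Relative to a list with nonzero first entries: over a ≡ 0 all eight choices of signs and
      -- root give the origin.
      unique-map : ∀ {ps} → (∀ {p} → p ∈ ps → ¬ ℓ∣ ⟦ proj₁ p ⟧) → Unique ps → Unique (map double-zero ps)
      unique-map {[]}     _      []       = []
      unique-map {p ∷ ps} nonzero (p∉ ∷ u) = All.tabulate distinct ∷ unique-map (nonzero ∘ there) u
        where
        distinct : ∀ {d} → d ∈ map double-zero ps → double-zero p ≢ d
        distinct d∈ eq with ∈-map⁻ double-zero d∈
        ... | q , q∈ , refl = All.lookup p∉ q∈ (double-zero-injective (nonzero (here refl)) eq)

    ∈-double-zeros⇒ : ∀ {d} → d ∈ double-zeros →
                      ℓ∣ p₂ (coords d) × ℓ∣ p₄ (coords d) × ¬ ℓ∣ p₆ (coords d)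
    ∈-double-zeros⇒ {d} d∈ = from-parameters (∈-map⁻ double-zero d∈)
      where
      from-parameters : (∃[ p ] p ∈ parameters × d ≡ double-zero p) →
                        ℓ∣ p₂ (coords d) × ℓ∣ p₄ (coords d) × ¬ ℓ∣ p₆ (coords d)
      from-parameters ((a , s , s′ , t) , p∈ , d≡) =
        subst (λ d → ℓ∣ p₂ (coords d) × ℓ∣ p₄ (coords d) × ¬ ℓ∣ p₆ (coords d)) (sym d≡)
          (p₂-double-zero {a} {s} {s′} {t} , p₄-double-zero {a} {s} {s′} {t} ,
           p₆-double-zero {a} {s} {s′} {t} (∈-nonzeros⇒ (proj₁ (∈-cartesianProduct⁻ nonzeros signs p∈))))

    module _ (a b c : ℤ) where

      -- The roots of the quadratic in b are sωa and sω²a: their sum is -sa and their product a².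
      solve-second : ∀ s → ℓ∣ b * b + sgn s * a * b + a * a → ∃[ t ] ℓ∣ b - sgn s * cubeRoot t * a
      solve-second s h = Sum.[ (true ,_) , (false ,_) ] (0-product
        {b - sgn s * ω * a} {b - sgn s * (- + 1 - ω) * a} (by
        (h ⊕ - (a * a) ⊙ ω-root ⊕ (- (ω * ω + ω) * (a * a)) ⊙ sgn² s) (lemma a b (sgn s) ω)))
        where
        lemma : ∀ a b s w →
          b * b + s * a * b + a * a + - (a * a) * (w * w + w + + 1) + - (w * w + w) * (a * a) * (s * s - + 1) ≡
          (b - s * w * a) * (b - s * (- + 1 - w) * a)
        lemma = solve-∀

      second : ℓ∣ b * b + a * b + a * a ⊎ ℓ∣ b * b - a * b + a * a →
               ∃[ s ] ∃[ t ] ℓ∣ b - sgn s * cubeRoot t * a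
      second (inj₁ h) = true , solve-second true (by h (lemma a b))
        where
        lemma : ∀ a b → b * b + a * b + a * a ≡ b * b + + 1 * a * b + a * a
        lemma = solve-∀
      second (inj₂ h) = false , solve-second false (by h (lemma a b))
        where
        lemma : ∀ a b → b * b - a * b + a * a ≡ b * b + - + 1 * a * b + a * a
        lemma = solve-∀

      -- c² ≡ -(1 + w²)a² ≡ wa² ≡ (w²a)², so c is one of the two square roots ±w²a.
      third : ∀ s t → ℓ∣ p₂ (a , b , c) → ℓ∣ b - sgn s * cubeRoot t * a →
              ∃[ s′ ] ℓ∣ c - sgn s′ * (cubeRoot t * cubeRoot t) * a
      third s t h₂ hb = Sum.[ (true ,_) , (false ,_) ] (0-product
        {c - + 1 * (w * w) * a} {c - - + 1 * (w * w) * a} (by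
        (h₂ ⊕ - (b + sgn s * w * a) ⊙ hb ⊕ - (w * w * (a * a)) ⊙ sgn² s
          ⊕ - ((w * w - w + + 1) * (a * a)) ⊙ isRoot t) (lemma a b c (sgn s) w)))
        where
        w = cubeRoot t
        lemma : ∀ a b c s w →
          a * a + b * b + c * c + - (b + s * w * a) * (b - s * w * a) + - (w * w * (a * a)) * (s * s - + 1)
            + - ((w * w - w + + 1) * (a * a)) * (w * w + w + + 1) ≡
          (c - + 1 * (w * w) * a) * (c - - + 1 * (w * w) * a)
        lemma = solve-∀

    ∈-parameters : ∀ {a} s s′ t → ¬ ℓ∣ ⟦ a ⟧ → (a , s , s′ , t) ∈ parameters
    ∈-parameters s s′ t ℓ∤a = ∈-cartesianProduct⁺ (∈-nonzeros⇐ ℓ∤a)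
      (∈-cartesianProduct⁺ (∈-bools s) (∈-cartesianProduct⁺ (∈-bools s′) (∈-bools t)))

    vector⇒∈ : ∀ {d} p → p ∈ parameters → coords d ≋ vector p → d ∈ double-zeros
    vector⇒∈ p p∈ d≋ = subst (_∈ double-zeros) (reduce₃-unique (≋-sym d≋)) (∈-map⁺ double-zero p∈)

    ∈-double-zeros⇐ : ∀ {d} → ℓ∣ p₂ (coords d) → ℓ∣ p₄ (coords d) → d ≢ origin → d ∈ double-zeros
    ∈-double-zeros⇐ {d@(a , b , c)} h₂ h₄ d≢origin = choose-signs (second A B C (quartic A B C h₂ h₄))
      where
      A = ⟦ a ⟧
      B = ⟦ b ⟧
      C = ⟦ c ⟧
      ℓ∤a : ¬ ℓ∣ ⟦ a ⟧
      ℓ∤a = first-nonzero {d} h₂ h₄ d≢origin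
      choose-sign : ∀ s t → ℓ∣ B - sgn s * cubeRoot t * A →
                    (∃[ s′ ] ℓ∣ C - sgn s′ * (cubeRoot t * cubeRoot t) * A) → d ∈ double-zeros
      choose-sign s t hb (s′ , hc) = vector⇒∈ (a , s , s′ , t) (∈-parameters s s′ t ℓ∤a)
        (≋-by (divides (+ 0) (ℤ.+-inverseʳ A)) hb hc)
      choose-signs : (∃[ s ] ∃[ t ] ℓ∣ B - sgn s * cubeRoot t * A) → d ∈ double-zeros
      choose-signs (s , t , hb) = choose-sign s t hb (third A B C s t h₂ hb)

-- The distribution of the invariants.

module Distribution (ℓ : ℕ) (ℓ-prime : Prime ℓ) (5≤ℓ : 5 ℕ.≤ ℓ) where

  open import Data.Integer.Base using (_+_; _*_; _-_; -_)
  open Congruence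
  open Fractions
  open PrimeField ℓ ℓ-prime
  open CubeRoots ℓ ℓ-prime 5≤ℓ using (ℓ%3≡1⇒root)
  open AdicIntegers ℓ ℓ-prime
  open ResidueClasses ℓ ℓ-prime
  open Coefficients ℓ ℓ-prime
  open Cone ℓ ℓ-prime 5≤ℓ using (cone; cone-unique; length-cone; ∈-cone⇒; ∈-cone⇐)
  open DoubleZeros ℓ ℓ-prime 5≤ℓ
  open Adic ℓ ℓ-prime using (ℤₗ; HasInvariants; Admissible; Prob≡; charSeries; WeierstrassForm)

  private
    p : (ℤ³ → ℤ) → (Fin 3 → ℤₗ) → ℤ
    p q α = q (coords (residues α))

    e : ℕ
    e = 1 ℕ.+ ℓ ℕ.+ ℓ ℕ.^ 2

  invariants⇒order : ∀ (α : Fin 3 → ℤₗ) {λ₀} → HasInvariants α 0 λ₀ → HasOrder (charSeries α) (suc λ₀)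
  invariants⇒order α = weierstrass⇒order {charSeries α}

  invariants-unique : ∀ {α : Fin 3 → ℤₗ} {μ₀ λ₀ d} → HasOrder (charSeries α) (suc d) → HasInvariants α μ₀ λ₀ →
                      (μ₀ , λ₀) ≡ (0 , d)
  invariants-unique {α} {d = d} order W with weierstrass⇒μ≡0 {charSeries α} {n = suc d} W (proj₂ order)
  ... | refl = cong (0 ,_) (ℕ.suc-injective (order-unique {charSeries α} (invariants⇒order α W) order))

  r₀ : ℓ∣ ⟦ reduce (+ 0) ⟧
  r₀ = by (reduce-≡ (+ 0)) (ℤ.+-identityʳ _)

  p₂-origin : ℓ∣ p₂ (coords origin)
  p₂-origin = r ⊙ r₀ ⊕ r ⊙ r₀ ⊕ r ⊙ r₀
    where r = ⟦ reduce (+ 0) ⟧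

  p₆-origin : ℓ∣ p₆ (coords origin)
  p₆-origin = (r * r * (r * r)) ⊙ r ⊙ r₀ ⊕ (r * r * (r * r)) ⊙ r ⊙ r₀ ⊕ (r * r * (r * r)) ⊙ r ⊙ r₀
    where r = ⟦ reduce (+ 0) ⟧

  complement-size : ∀ m n N → m ℕ.+ n ≡ N → + n ≡ + N - + m
  complement-size m n N refl = trans (lemma (+ m) (+ n)) (cong (_- + m) (sym (ℤ.pos-+ m n)))
    where
    lemma : ∀ m n → n ≡ m + n - m
    lemma = solve-∀

  +ℓ² : + (ℓ ℕ.* ℓ) ≡ + ℓ * + ℓ
  +ℓ² = ℤ.pos-* ℓ ℓ

  ℓ^2≡ℓ*ℓ : ℓ ℕ.^ 2 ≡ ℓ ℕ.* ℓ
  ℓ^2≡ℓ*ℓ = cong (ℓ ℕ.*_) ℓ^1≡ℓ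

  probability-λ=1 : Prob≡ 3 0 1 (+ (ℓ ℕ.^ 2) ℚ./ e)
  probability-λ=1 = probability (+ (ℓ ℕ.^ 2)) (triples ∖ cone) (∖-unique cone triples-unique)
    (λ α (_ , W) → ∈-∖⁺ (∈-triples _) (order-2⇒ α 5≤ℓ (invariants⇒order α W) ∘ ∈-cone⇒))
    (λ α t∈ → let t∉cone = proj₂ (∈-∖⁻ triples cone t∈) in
      -- The origin lies on the cone, so a class off the cone consists of admissible vectors.
      ≢origin⇒admissible α (λ t≡ → t∉cone (∈-cone⇐ (subst (ℓ∣_ ∘ p₂ ∘ coords) (sym t≡) p₂-origin))) ,
      order⇒weierstrass (charSeries α) (order-2⇐ α 5≤ℓ (t∉cone ∘ ∈-cone⇐)))
    (begin
      + length (triples ∖ cone)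
        ≡⟨ complement-size (length cone) _ (length triples) (length-∖ triples-unique cone-unique (λ _ → ∈-triples _)) ⟩
      + length triples - + length cone
        ≡⟨ cong₂ (λ m n → + m - + n) length-triples length-cone ⟩
      + (ℓ ℕ.* ℓ ℕ.^ 2) - + (ℓ ℕ.* ℓ)
        ≡⟨ cong (λ m → + (ℓ ℕ.* m) - + (ℓ ℕ.* ℓ)) ℓ^2≡ℓ*ℓ ⟩
      + (ℓ ℕ.* (ℓ ℕ.* ℓ)) - + (ℓ ℕ.* ℓ)
        ≡⟨ cong (_- + (ℓ ℕ.* ℓ)) (ℤ.pos-* ℓ (ℓ ℕ.* ℓ)) ⟩
      + ℓ * + (ℓ ℕ.* ℓ) - + (ℓ ℕ.* ℓ)
        ≡⟨ lemma (+ ℓ) (+ (ℓ ℕ.* ℓ)) ⟩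
      + (ℓ ℕ.* ℓ) * (+ ℓ - + 1)
        ≡⟨ cong (λ m → + m * (+ ℓ - + 1)) ℓ^2≡ℓ*ℓ ⟨
      + (ℓ ℕ.^ 2) * (+ ℓ - + 1) ∎)
    where
    open ≡-Reasoning
    lemma : ∀ l m → l * m - m ≡ m * (l - + 1)
    lemma = solve-∀

  probability-0 : ∀ μ₀ λ₀ → (∀ α → ¬ (Admissible α × HasInvariants α μ₀ λ₀)) → Prob≡ 3 μ₀ λ₀ 0ℚ
  probability-0 μ₀ λ₀ impossible = subst (Prob≡ 3 μ₀ λ₀) (/-cross (+ 0) (+ 0) e 1 refl)
    (probability (+ 0) [] [] (λ α Sα → contradiction Sα (impossible α)) (λ α ()) refl)

  module _ (ℓ%3≡2 : ℓ ℕ.% 3 ≡ 2) where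

    private
      ℓ∤p₄ : ∀ {t} → ℓ∣ p₂ (coords t) → t ≢ origin → ¬ ℓ∣ p₄ (coords t)
      ℓ∤p₄ {t} h₂ t≢ h₄ = t≢ (ℓ%3≡2⇒origin ℓ%3≡2 {t} h₂ h₄)

    probability-λ=3₂ : Prob≡ 3 0 3 (+ (ℓ ℕ.+ 1) ℚ./ e)
    probability-λ=3₂ = probability (+ (ℓ ℕ.+ 1)) (cone ∖ (origin ∷ [])) (∖-unique (origin ∷ []) cone-unique)
      (λ α (admissible , W) → ∈-∖⁺ (∈-cone⇐ (proj₁ (order-4⇒ α 5≤ℓ (invariants⇒order α W))))
        λ { (here t≡) → admissible⇒≢origin α admissible t≡ })
      (λ α t∈ → let t∈cone , t∉ = ∈-∖⁻ cone (origin ∷ []) t∈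
                    h₂ = ∈-cone⇒ t∈cone in
        ≢origin⇒admissible α (t∉ ∘ here) ,
        order⇒weierstrass (charSeries α) (order-4⇐ α 5≤ℓ h₂ (ℓ∤p₄ {residues α} h₂ (t∉ ∘ here))))
      (begin
        + length (cone ∖ (origin ∷ []))
          ≡⟨ complement-size 1 _ (length cone) (length-∖ cone-unique (All.[] ∷ [])
               (λ { (here refl) → ∈-cone⇐ p₂-origin })) ⟩
        + length cone - + 1
          ≡⟨ cong (_- + 1) (trans (cong +_ length-cone) +ℓ²) ⟩
        + ℓ * + ℓ - + 1
          ≡⟨ lemma (+ ℓ) ⟩
        (+ ℓ + + 1) * (+ ℓ - + 1)
          ≡⟨ cong (_* (+ ℓ - + 1)) (ℤ.pos-+ ℓ 1) ⟨
        + (ℓ ℕ.+ 1) * (+ ℓ - + 1) ∎)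
      where
      open ≡-Reasoning
      lemma : ∀ l → l * l - + 1 ≡ (l + + 1) * (l - + 1)
      lemma = solve-∀

    probability-otherwise₂ : ∀ μ₀ λ₀ → (μ₀ , λ₀) ≢ (0 , 1) → (μ₀ , λ₀) ≢ (0 , 3) → Prob≡ 3 μ₀ λ₀ 0ℚ
    probability-otherwise₂ μ₀ λ₀ ≢1 ≢3 = probability-0 μ₀ λ₀ λ α (admissible , W) →
      excluded α admissible W (+ ℓ ∣? p p₂ α)
      where
      excluded : ∀ α → Admissible α → HasInvariants α μ₀ λ₀ → ¬ Dec (ℓ∣ p p₂ α)
      excluded α _ W (no ℓ∤p₂) = ≢1 (invariants-unique {α} (order-2⇐ α 5≤ℓ ℓ∤p₂) W)
      excluded α admissible W (yes h₂) = ≢3 (invariants-unique {α}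
        (order-4⇐ α 5≤ℓ h₂ (ℓ∤p₄ {residues α} h₂ (admissible⇒≢origin α admissible))) W)

  module _ (ℓ%3≡1 : ℓ ℕ.% 3 ≡ 1) where

    open Enumeration (proj₁ (ℓ%3≡1⇒root ℓ%3≡1)) (proj₂ (ℓ%3≡1⇒root ℓ%3≡1))

    7≤ℓ : 7 ℕ.≤ ℓ
    7≤ℓ with ℕ.m≤n⇒m<n∨m≡n 5≤ℓ
    ... | inj₂ refl = contradiction ℓ%3≡1 λ ()
    ... | inj₁ 6≤ℓ with ℕ.m≤n⇒m<n∨m≡n 6≤ℓ
    ...   | inj₂ refl = contradiction ℓ%3≡1 λ ()
    ...   | inj₁ 7≤ℓ  = 7≤ℓ

    excluded-triples : List Triple
    excluded-triples = origin ∷ double-zeros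

    private
      ℓ∤p₄ : ∀ {t} → ℓ∣ p₂ (coords t) → ¬ t ∈ excluded-triples → ¬ ℓ∣ p₄ (coords t)
      ℓ∤p₄ h₂ t∉ h₄ = t∉ (there (∈-double-zeros⇐ h₂ h₄ (t∉ ∘ here)))

      -- The form `p₆` separates them: it vanishes at the origin only.
      origin∉double-zeros : ¬ origin ∈ double-zeros
      origin∉double-zeros o∈ = proj₂ (proj₂ (∈-double-zeros⇒ o∈)) p₆-origin

      excluded-unique : Unique excluded-triples
      excluded-unique = All.tabulate (λ t∈ o≡t → origin∉double-zeros (subst (_∈ double-zeros) (sym o≡t) t∈))
        ∷ double-zeros-unique

      excluded⊆cone : excluded-triples ⊆ cone
      excluded⊆cone (here refl) = ∈-cone⇐ p₂-origin
      excluded⊆cone (there t∈)  = ∈-cone⇐ (proj₁ (∈-double-zeros⇒ t∈))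

      m : ℕ
      m = length nonzeros

      +ℓ : + ℓ ≡ + 1 + + m
      +ℓ = trans (cong +_ (sym length-nonzeros)) (ℤ.pos-+ 1 m)

      length-double-zeros : length double-zeros ≡ m ℕ.* 8
      length-double-zeros = trans (List.length-map double-zero parameters) length-parameters

    -- The cone loses the origin and 8(ℓ - 1) further triples, and ℓ² - 1 - 8(ℓ - 1) = (ℓ - 7)(ℓ -
    -- 1). For ℓ = 7 nothing is left. The computation runs in m = ℓ - 1, the length of `nonzeros`.
    probability-λ=3₁ : Prob≡ 3 0 3 ((+ ℓ - + 7) ℚ./ e)
    probability-λ=3₁ = probability (+ ℓ - + 7) (cone ∖ excluded-triples) (∖-unique excluded-triples cone-unique)
      (λ α (admissible , W) → let h₂ , ℓ∤p₄ = order-4⇒ α 5≤ℓ (invariants⇒order α W) in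
        ∈-∖⁺ (∈-cone⇐ h₂) λ where
          (here t≡)  → admissible⇒≢origin α admissible t≡
          (there t∈) → ℓ∤p₄ (proj₁ (proj₂ (∈-double-zeros⇒ t∈))))
      (λ α t∈ → let t∈cone , t∉ = ∈-∖⁻ cone excluded-triples t∈
                    h₂ = ∈-cone⇒ t∈cone in
        ≢origin⇒admissible α (t∉ ∘ here) ,
        order⇒weierstrass (charSeries α) (order-4⇐ α 5≤ℓ h₂ (ℓ∤p₄ {residues α} h₂ t∉)))
      (begin
        + length (cone ∖ excluded-triples)
          ≡⟨ complement-size (length excluded-triples) _ (length cone)
               (length-∖ cone-unique excluded-unique excluded⊆cone) ⟩
        + length cone - + suc (length double-zeros)
          ≡⟨ cong₂ (λ x y → x - y) (trans (cong +_ length-cone) +ℓ²)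
               (trans (cong (+_ ∘ suc) length-double-zeros) (trans (ℤ.pos-+ 1 (m ℕ.* 8)) (cong (_+_ (+ 1)) (ℤ.pos-* m 8)))) ⟩
        + ℓ * + ℓ - (+ 1 + + m * + 8)
          ≡⟨ cong (λ l → l * l - (+ 1 + + m * + 8)) +ℓ ⟩
        (+ 1 + + m) * (+ 1 + + m) - (+ 1 + + m * + 8)
          ≡⟨ lemma (+ m) ⟩
        (+ 1 + + m - + 7) * (+ 1 + + m - + 1)
          ≡⟨ cong (λ l → (l - + 7) * (l - + 1)) +ℓ ⟨
        (+ ℓ - + 7) * (+ ℓ - + 1) ∎)
      where
      open ≡-Reasoning
      lemma : ∀ m → (+ 1 + m) * (+ 1 + m) - (+ 1 + m * + 8) ≡ (+ 1 + m - + 7) * (+ 1 + m - + 1)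
      lemma = solve-∀

    probability-λ=5 : Prob≡ 3 0 5 (+ 8 ℚ./ e)
    probability-λ=5 = probability (+ 8) double-zeros double-zeros-unique
      (λ α (admissible , W) → let h₂ , h₄ = order-6⇒ α 5≤ℓ (invariants⇒order α W) in
        ∈-double-zeros⇐ h₂ h₄ (admissible⇒≢origin α admissible))
      (λ α t∈ → let h₂ , h₄ , ℓ∤p₆ = ∈-double-zeros⇒ t∈ in
        ≢origin⇒admissible α (λ t≡ → origin∉double-zeros (subst (_∈ double-zeros) t≡ t∈)) ,
        order⇒weierstrass (charSeries α) (order-6⇐ α 5≤ℓ 7≤ℓ h₂ h₄ ℓ∤p₆))
      (begin
        + length double-zeros               ≡⟨ cong +_ length-double-zeros ⟩
        + (m ℕ.* 8)                         ≡⟨ ℤ.pos-* m 8 ⟩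
        + m * + 8                           ≡⟨ lemma (+ m) ⟩
        + 8 * (+ 1 + + m - + 1)             ≡⟨ cong (λ l → + 8 * (l - + 1)) +ℓ ⟨
        + 8 * (+ ℓ - + 1)                   ∎)
      where
      open ≡-Reasoning
      lemma : ∀ m → m * + 8 ≡ + 8 * (+ 1 + m - + 1)
      lemma = solve-∀

    -- Two decidable tests sort the admissible vectors into orders 2, 4 and 6, and the order
    -- determines both invariants; this excludes μ > 0 too.
    probability-otherwise₁ : ∀ μ₀ λ₀ → (μ₀ , λ₀) ≢ (0 , 1) → (μ₀ , λ₀) ≢ (0 , 3) → (μ₀ , λ₀) ≢ (0 , 5) →
                             Prob≡ 3 μ₀ λ₀ 0ℚ
    probability-otherwise₁ μ₀ λ₀ ≢1 ≢3 ≢5 = probability-0 μ₀ λ₀ λ α (admissible , W) →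
      excluded α admissible W (+ ℓ ∣? p p₂ α) (+ ℓ ∣? p p₄ α)
      where
      excluded : ∀ α → Admissible α → HasInvariants α μ₀ λ₀ → Dec (ℓ∣ p p₂ α) → ¬ Dec (ℓ∣ p p₄ α)
      excluded α _ W (no ℓ∤p₂) _          = ≢1 (invariants-unique {α} (order-2⇐ α 5≤ℓ ℓ∤p₂) W)
      excluded α _ W (yes h₂)  (no ℓ∤p₄)  = ≢3 (invariants-unique {α} (order-4⇐ α 5≤ℓ h₂ ℓ∤p₄) W)
      excluded α admissible W (yes h₂) (yes h₄) = ≢5 (invariants-unique {α}
        (order-6⇐ α 5≤ℓ 7≤ℓ h₂ h₄ (proj₂ (proj₂ (∈-double-zeros⇒
          (∈-double-zeros⇐ h₂ h₄ (admissible⇒≢origin α admissible)))))) W)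

open import Data.Integer.Base using (+_; _-_)
open import Data.Nat.Base using (ℕ; _+_; _^_; _≤_; _%_)
open import Data.Nat.Primality using (Prime)
open import Data.Product.Base using (_×_; _,_)
open import Data.Rational.Base using (0ℚ; _/_)
open import Relation.Binary.PropositionalEquality using (_≡_; _≢_)

proposition4p20 : (ℓ : ℕ) (ℓ-prime : Prime ℓ) → 5 ≤ ℓ →
    Adic.Prob≡ ℓ ℓ-prime 3 0 1 (+ (ℓ ^ 2) / (1 + ℓ + ℓ ^ 2))
    ×
    (ℓ % 3 ≡ 2 →
    Adic.Prob≡ ℓ ℓ-prime 3 0 1 (+ (ℓ ^ 2) / (1 + ℓ + ℓ ^ 2)) ×
    Adic.Prob≡ ℓ ℓ-prime 3 0 3 (+ (ℓ + 1) / (1 + ℓ + ℓ ^ 2)) ×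
    ((μ₀ λ₀ : ℕ) → (μ₀ , λ₀) ≢ (0 , 1) → (μ₀ , λ₀) ≢ (0 , 3) →
    Adic.Prob≡ ℓ ℓ-prime 3 μ₀ λ₀ 0ℚ))
    ×
    (ℓ % 3 ≡ 1 →
    Adic.Prob≡ ℓ ℓ-prime 3 0 1 (+ (ℓ ^ 2) / (1 + ℓ + ℓ ^ 2)) ×
    Adic.Prob≡ ℓ ℓ-prime 3 0 3 ((+ ℓ - + 7) / (1 + ℓ + ℓ ^ 2)) ×
    Adic.Prob≡ ℓ ℓ-prime 3 0 5 (+ 8 / (1 + ℓ + ℓ ^ 2)) ×
    ((μ₀ λ₀ : ℕ) → (μ₀ , λ₀) ≢ (0 , 1) → (μ₀ , λ₀) ≢ (0 , 3) → (μ₀ , λ₀) ≢ (0 , 5) →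
    Adic.Prob≡ ℓ ℓ-prime 3 μ₀ λ₀ 0ℚ))
proposition4p20 ℓ ℓ-prime 5≤ℓ =
  probability-λ=1 ,
  (λ ℓ%3≡2 → probability-λ=1 , probability-λ=3₂ ℓ%3≡2 , probability-otherwise₂ ℓ%3≡2) ,
  (λ ℓ%3≡1 → probability-λ=1 , probability-λ=3₁ ℓ%3≡1 , probability-λ=5 ℓ%3≡1 , probability-otherwise₁ ℓ%3≡1)
  where open Distribution ℓ ℓ-prime 5≤ℓ
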